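{- Let $r\ge1$ be an integer. The number of symmetric quivers in $\mathcal{Q}_{2r-1}$ is $\frac12\binom{2r}{r}$. For an integer $r_2\ge0$, the number of symmetric quivers in $\mathcal{Q}_{2r-1}$ with exactly $2r_2$ oriented 3-cycles is $$2^{r-2r_2-1}\binom{r}{r_2,\,r_2,\,r-2r_2}.$$
   Context: Multinomial coefficients with a negative lower entry are $0$. All quivers are finite, connected, without loops and without oriented 2-cycles, considered up to isomorphism. A rooted quiver of type $A$ is a quiver with a distinguished vertex (the root), defined recursively as one of: (i) a single vertex, the root; (ii) a root $\rho$, a rooted quiver of type $A$ with root $v\ne\rho$, and one arrow between $\rho$ and $v$ (either direction); (iii) a root $\rho$, an oriented 3-cycle $\rho\to u\to w\to\rho$, and two vertex-disjoint rooted quivers of type $A$ with roots $u$ and $w$. For $n\ge2$, $\mathcal{Q}_{n-1}$ is the class of quivers with $n$ vertices such that: (1) there is exactly one full subquiver which is a non-oriented cycle (underlying graph a cycle, arrows not all oriented the same way) of length $\ge2$ (length 2 = double arrow); its arrows are base arrows; (2) for each base arrow $\alpha:x\to y$ there may be a vertex $z_\alpha$ off the cycle with arrows $y\to z_\alpha\to x$ (for a double arrow only one of its arrows is regarded as part of such a 3-cycle), and no other arrows are incident to cycle vertices; (3) removing the cycle vertices leaves a disjoint union of rooted quivers of type $A$, one with root $z_\alpha$ for each existing $z_\alpha$, attached to $\alpha$. These are exactly the quivers of type $\tilde A_{n-1}$ (mutation equivalent to a non-oriented $n$-cycle). A realization of $Q\in\mathcal{Q}_{n-1}$ is $Q$ with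 an embedding of its non-oriented cycle in the plane (a choice of clockwise direction), realizations being identified if a quiver isomorphism maps one to the other preserving the clockwise direction. Each quiver has at most two realizations; $Q$ is symmetric if its two possible realizations coincide (i.e. $Q$ has an automorphism reversing the cyclic direction of its non-oriented cycle). -}

module Defs where

open import Data.Nat using (ℕ; zero; suc; _+_; _*_; _∸_; _<ᵇ_)
open import Data.Nat.DivMod using (_mod_)
open import Data.Fin using (Fin; toℕ)
open import Data.Fin.Properties using (_≟_)
open import Data.Fin.Subset using (Subset; _∈_; _∉_; ⁅_⁆; _∪_) renaming (⊥ to ∅)
open import Data.Maybe using (Maybe; just; nothing) renaming (map to mapMaybe)
open import Data.Product using (Σ; ∃; _×_; _,_; proj₁; proj₂)
open import Data.Sum using (_⊎_)
open import Data.Bool using (Bool; true; false; _∧_; if_then_else_)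
open import Data.List using (List; allFin; map; concatMap)
open import Data.Bool.ListAction using (any)
open import Data.Nat.ListAction using (sum)
open import Data.Empty using (⊥)
open import Relation.Nullary using (¬_)
open import Relation.Nullary.Decidable using (⌊_⌋)
open import Relation.Binary.PropositionalEquality using (_≡_; _≢_)
open import Function.Bundles using (_↔_; Inverse)

-- Quivers with vertex set Fin n and m individually named arrows
-- (arrows are named so that the two arrows of a double arrow are distinct).

record Quiver (n : ℕ) : Set where
  constructor quiver
  field
    m   : ℕ
    src : Fin m → Fin n
    tgt : Fin m → Fin n

open Quiver public

data Reach {n : ℕ} (Q : Quiver n) : Fin n → Fin n → Set where
  here : ∀ {x} → Reach Q x x
  fwd  : ∀ {y} (a : Fin (m Q)) → Reach Q (tgt Q a) y → Reach Q (src Q a) y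
  bwd  : ∀ {y} (a : Fin (m Q)) → Reach Q (src Q a) y → Reach Q (tgt Q a) y

record Valid {n : ℕ} (Q : Quiver n) : Set where
  field
    noLoops     : ∀ a → src Q a ≢ tgt Q a
    no2Cycles   : ∀ a b → src Q a ≡ tgt Q b → tgt Q a ≡ src Q b → ⊥
    connected   : ∀ x y → Reach Q x y

record _≅_ {n : ℕ} (Q Q' : Quiver n) : Set where
  field
    vmap : Fin n ↔ Fin n
    amap : Fin (m Q) ↔ Fin (m Q')
    src-pres : ∀ a → src Q' (Inverse.to amap a) ≡ Inverse.to vmap (src Q a)
    tgt-pres : ∀ a → tgt Q' (Inverse.to amap a) ≡ Inverse.to vmap (tgt Q a)

nxt : ∀ {ℓ} → Fin (suc (suc ℓ)) → Fin (suc (suc ℓ))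
nxt {ℓ} i = suc (toℕ i) mod (suc (suc ℓ))

revV : ∀ {ℓ} → Fin (suc (suc ℓ)) → Fin (suc (suc ℓ)) → Fin (suc (suc ℓ))
revV {ℓ} c i = (toℕ c + (suc (suc ℓ) ∸ toℕ i)) mod (suc (suc ℓ))

revE : ∀ {ℓ} → Fin (suc (suc ℓ)) → Fin (suc (suc ℓ)) → Fin (suc (suc ℓ))
revE {ℓ} c i = (toℕ c + (suc ℓ ∸ toℕ i)) mod (suc (suc ℓ))

-- A full subquiver of Q which is a non-oriented cycle of length k = 2 + ℓ ≥ 2:
-- distinct vertices v 0 … v (k-1), base arrows e i joining v i and v (i+1),
-- no other arrows between cycle vertices, and not all arrows oriented
-- the same way around the cycle.  (For k = 2 this is a double arrow.)

record NCycle {n : ℕ} (Q : Quiver n) : Set where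
  field
    ℓ  : ℕ
    v  : Fin (suc (suc ℓ)) → Fin n
    e  : Fin (suc (suc ℓ)) → Fin (m Q)
    v-inj  : ∀ i j → v i ≡ v j → i ≡ j
    e-inj  : ∀ i j → e i ≡ e j → i ≡ j
    e-link : ∀ i → (src Q (e i) ≡ v i × tgt Q (e i) ≡ v (nxt i))
                 ⊎ (src Q (e i) ≡ v (nxt i) × tgt Q (e i) ≡ v i)
    full   : ∀ a → (∃ λ i → v i ≡ src Q a) → (∃ λ j → v j ≡ tgt Q a) → ∃ λ i → a ≡ e i
    nonOriented : (∃ λ i → src Q (e i) ≡ v i) × (∃ λ j → src Q (e j) ≡ v (nxt j))

  k : ℕ
  k = suc (suc ℓ)

  OnCycle : Fin n → Set
  OnCycle x = ∃ λ i → v i ≡ x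

open NCycle public

-- "The full subquiver of Q on the vertex set S is a rooted quiver of
-- type A with root ρ", following the recursive definition (i)–(iii).

data IsRA {n : ℕ} (Q : Quiver n) : Subset n → Fin n → Set where
  single : ∀ ρ → IsRA Q ⁅ ρ ⁆ ρ
  edge   : ∀ {S S'} ρ w → S ≡ ⁅ ρ ⁆ ∪ S' → ρ ∉ S' → IsRA Q S' w →
           (a : Fin (m Q)) →
           ((src Q a ≡ ρ × tgt Q a ≡ w) ⊎ (src Q a ≡ w × tgt Q a ≡ ρ)) →
           (∀ b → src Q b ∈ S → tgt Q b ∈ S →
                  (src Q b ∈ S' × tgt Q b ∈ S') ⊎ b ≡ a) →
           IsRA Q S ρ
  tri    : ∀ {S S₁ S₂} ρ u w → S ≡ ⁅ ρ ⁆ ∪ (S₁ ∪ S₂) →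
           ρ ∉ S₁ → ρ ∉ S₂ → (∀ x → x ∈ S₁ → x ∉ S₂) →
           IsRA Q S₁ u → IsRA Q S₂ w →
           (a₁ a₂ a₃ : Fin (m Q)) →
           src Q a₁ ≡ ρ → tgt Q a₁ ≡ u →
           src Q a₂ ≡ u → tgt Q a₂ ≡ w →
           src Q a₃ ≡ w → tgt Q a₃ ≡ ρ →
           (∀ b → src Q b ∈ S → tgt Q b ∈ S →
                  (src Q b ∈ S₁ × tgt Q b ∈ S₁) ⊎ (src Q b ∈ S₂ × tgt Q b ∈ S₂)
                  ⊎ b ≡ a₁ ⊎ b ≡ a₂ ⊎ b ≡ a₃) →
           IsRA Q S ρ

-- Conditions (2) and (3) relative to a chosen non-oriented cycle C.
-- att i = just (z , b , c) means: the base arrow α = e i : x → y has the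
-- vertex z_α = z with arrows b : y → z and c : z → x (for a double arrow
-- this records which of its two arrows is regarded as part of the 3-cycle).
-- tree i is the vertex set of the rooted type-A quiver attached to α.

Triple : ℕ → ℕ → Set
Triple n m = Fin n × Fin m × Fin m

record Attach {n : ℕ} (Q : Quiver n) (C : NCycle Q) : Set where
  field
    att    : Fin (k C) → Maybe (Triple n (m Q))
    att-ok : ∀ i z b c → att i ≡ just (z , b , c) →
             src Q b ≡ tgt Q (e C i) × tgt Q b ≡ z ×
             src Q c ≡ z × tgt Q c ≡ src Q (e C i)
    incident : ∀ a → (OnCycle C (src Q a) ⊎ OnCycle C (tgt Q a)) →
               (∃ λ i → a ≡ e C i) ⊎
               (∃ λ i → Σ (Fin n) λ z → Σ (Fin (m Q)) λ b → Σ (Fin (m Q)) λ c →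
                   att i ≡ just (z , b , c) × (a ≡ b ⊎ a ≡ c))
    -- removing the cycle leaves a disjoint union of rooted type-A quivers,
    -- one with root z_α for each existing z_α
    tree       : Fin (k C) → Subset n
    tree-RA    : ∀ i z b c → att i ≡ just (z , b , c) → IsRA Q (tree i) z
    tree-none  : ∀ i → att i ≡ nothing → tree i ≡ ∅
    tree-off   : ∀ i x → x ∈ tree i → ¬ OnCycle C x
    tree-disj  : ∀ i j x → x ∈ tree i → x ∈ tree j → i ≡ j
    tree-cover : ∀ x → ¬ OnCycle C x → ∃ λ i → x ∈ tree i
    tree-sep   : ∀ a i j → src Q a ∈ tree i → tgt Q a ∈ tree j → i ≡ j

open Attach public

-- The class 𝒬_{n-1} (quivers with n vertices of the described shape).
record InQ {n : ℕ} (Q : Quiver n) : Set where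
  field
    valid     : Valid Q
    cyc       : NCycle Q
    attach    : Attach Q cyc
    uniqueCyc : ∀ (C C' : NCycle Q) → ∀ i → ∃ λ j → v C' j ≡ v C i

-- Symmetric: there is an automorphism of Q mapping the realization
-- (cycle with its cyclic direction and attachments) to the realization
-- with the reversed cyclic direction.

record Symmetric {n : ℕ} (Q : Quiver n) : Set where
  field
    cyc    : NCycle Q
    attach : Attach Q cyc
    aut    : Q ≅ Q
    shift  : Fin (k cyc)
    rev-v  : ∀ i → Inverse.to (_≅_.vmap aut) (v cyc i) ≡ v cyc (revV shift i)
    rev-e  : ∀ i → Inverse.to (_≅_.amap aut) (e cyc i) ≡ e cyc (revE shift i)
    rev-att : ∀ i → att attach (revE shift i) ≡
              mapMaybe (λ t → Inverse.to (_≅_.vmap aut) (proj₁ t) ,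
                              Inverse.to (_≅_.amap aut) (proj₁ (proj₂ t)) ,
                              Inverse.to (_≅_.amap aut) (proj₂ (proj₂ t)))
                       (att attach i)

-- Number of oriented 3-cycles: 3-element vertex sets {x,y,z} with arrows
-- x → y → z → x (each counted once, x being its smallest vertex).

arr : ∀ {n} → Quiver n → Fin n → Fin n → Bool
arr Q x y = any (λ a → ⌊ src Q a ≟ x ⌋ ∧ ⌊ tgt Q a ≟ y ⌋) (allFin (m Q))

isTri : ∀ {n} → Quiver n → Fin n → Fin n → Fin n → Bool
isTri Q x y z = (toℕ x <ᵇ toℕ y) ∧ (toℕ x <ᵇ toℕ z) ∧ arr Q x y ∧ arr Q y z ∧ arr Q z x

num3Cycles : ∀ {n} → Quiver n → ℕ
num3Cycles {n} Q =
  sum (concatMap (λ x → concatMap (λ y → map (λ z → if isTri Q x y z then 1 else 0)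
        (allFin n)) (allFin n)) (allFin n))

record IsoCount {n : ℕ} (P : Quiver n → Set) (N : ℕ) : Set where
  field
    rep      : Fin N → Quiver n
    rep-P    : ∀ i → P (rep i)
    rep-dist : ∀ i j → rep i ≅ rep j → i ≡ j
    rep-all  : ∀ Q → P Q → ∃ λ i → Q ≅ rep i

{-# OPTIONS --safe #-}
module Submission where

-- A reflection of the non-oriented cycle cannot fix a base arrow, so its axis meets the cycle
-- in two vertices and the cycle has even length 2t.  Reading from one of them, the quiver is
-- given by a word of t letters (direction of the base arrow, rooted quiver attached to it, if
-- any), the other half being the mirror image; the number of vertices is twice the weight of
-- the word.  A quiver has exactly two such words: if 2h is the least even period of the cyclic
-- sequence, the reflection axes meet the cycle in the multiples of h, reading from 0 and from h
-- gives different words, and any other reading is one of these.  Hence the number of symmetric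
-- quivers is half the number of words.
--
-- Words of weight r are bicoloured Motzkin paths of length r from 0 to 0 that may go below 0,
-- an attached rooted quiver being an excursion and an oriented triangle an up step (of |height|).
-- There are binom(2r, r) of them, and 2^(r-2j) r! / (j! j! (r-2j)!) with j up steps.
--
-- That the cycle is unique and that the oriented 3-cycles are the evident ones is seen by adding
-- the vertices off the cycle one at a time: each is joined to one earlier vertex, or to the two
-- ends of an earlier arrow with which it forms an oriented triangle.

open import Defs
open import Data.Nat using (ℕ; _+_; _*_; _∸_; _^_; _≤_; _>_; _!)
open import Data.Nat.Combinatorics using (_C_)
open import Data.Product using (Σ; _×_)
open import Relation.Binary.PropositionalEquality using (_≡_)

open import Axiom.UniquenessOfIdentityProofs.WithK using (uip)
open import Data.Bool using (Bool; true; false; not; if_then_else_; T; _∧_)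
open import Data.Bool.Properties using (not-involutive; T-∧; T?) renaming (_≟_ to _≟ᵇ_)
open import Data.Empty using (⊥; ⊥-elim)
open import Data.Fin using (Fin; toℕ; zero; suc; fromℕ; fromℕ<)
open import Data.Fin.Permutation using (↔⇒≡)
open import Data.Fin.Properties using (toℕ-fromℕ; toℕ-fromℕ<; toℕ-injective; toℕ<n; injective⇒≤; any?; +↔⊎) renaming (_≟_ to _≟ᶠ_)
open import Data.Fin.Subset using (Subset; ⁅_⁆; _∪_) renaming (_∈_ to _∈ˢ_; _∉_ to _∉ˢ_; ⊥ to ∅)
open import Data.Fin.Subset.Properties using (x∈⁅x⁆; x∈⁅y⁆⇒x≡y; x∈p∪q⁺; x∈p∪q⁻; ∉⊥)
open import Data.List using (List; []; _∷_; _++_; [_]; map; concatMap; length; lookup; filter; applyUpTo; allFin; cartesianProduct; tabulate)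
open import Data.List.Membership.Propositional using (_∈_; _∉_; find; lose)
open import Data.List.Membership.Propositional.Properties using (∈-map⁺; ∈-map⁻; ∈-++⁺ˡ; ∈-++⁺ʳ; ∈-++⁻; ∈-∃++; ∈-lookup; ∈-filter⁺; ∈-filter⁻; ∈-cartesianProduct⁺; ∈-allFin; ∈-tabulate⁺; ∈-tabulate⁻)
open import Data.List.Membership.Propositional.Properties.WithK using (unique∧set⇒bag)
open import Data.List.Properties using (length-++; length-map; length-tabulate; length-applyUpTo; filter-++; map-applyUpTo; applyUpTo-∷ʳ)
open import Data.List.Relation.Binary.BagAndSetEquality using (∼bag⇒↭)
open import Data.List.Relation.Binary.Permutation.Propositional using (_↭_; ↭-sym; ↭⇒↭ₛ; prep)
open import Data.List.Relation.Binary.Permutation.Propositional.Properties using (∈-resp-↭; ↭-length) renaming (shift to ↭-shift)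
open import Data.List.Relation.Binary.Permutation.Setoid.Properties using (Unique-resp-↭)
open import Data.List.Relation.Unary.All using ([]; _∷_)
import Data.List.Relation.Unary.All as All
open import Data.List.Relation.Unary.AllPairs using ([]; _∷_)
open import Data.List.Relation.Unary.Any using (here; there; index)
open import Data.List.Relation.Unary.Any.Properties using (any⁺; any⁻; lookup-index)
open import Data.List.Relation.Unary.Unique.Propositional using (Unique)
open import Data.List.Relation.Unary.Unique.Propositional.Properties using (allFin⁺; cartesianProduct⁺; tabulate⁺) renaming (map⁺ to unique-map⁺; ++⁺ to unique-++⁺; filter⁺ to unique-filter⁺)
open import Data.Maybe using (Maybe; just; nothing) renaming (map to mapMaybe)
open import Data.Maybe.Properties using (just-injective) renaming (≡-dec to ≡-decᵐ)
open import Data.Nat using (zero; suc; pred; _<_; _<ᵇ_; _≡ᵇ_; _≟_; _≤?_; _<?_; z≤n; s≤s; NonZero)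
open import Data.Nat.Combinatorics using (nCk+nC[k+1]≡[n+1]C[k+1]; nCk≡nC[n∸k])
open import Data.Nat.Combinatorics.Specification using (k>n⇒nCk≡0)
open import Data.Nat.Divisibility using (_∣_; divides; m%n≡0⇒n∣m)
open import Data.Nat.DivMod using (_/_; _%_; _mod_; m%n<n; m%n%n≡m%n; %-distribˡ-+; m<n⇒m%n≡m; [m+kn]%n≡m%n; [m+n]%n≡m%n; m≡m%n+[m/n]*n; m*n%n≡0)
open import Data.Nat.ListAction using (sum)
open import Data.Nat.ListAction.Properties using (sum-++)
open import Data.Nat.Properties hiding (_≟_; _≤?_; _<?_)
open import Data.Nat.Solver using (module +-*-Solver)
open import Data.Product using (∃; _,_; proj₁; proj₂; map₂)
open import Data.Product.Properties using () renaming (≡-dec to ≡-decᵖ)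
open import Data.Sum using (_⊎_; inj₁; inj₂; swap)
open import Data.Sum.Function.Propositional using (_⊎-↔_)
open import Data.Vec using (Vec; []; _∷_)
open import Function using (_∘_; id)
open import Function.Bundles using (_↔_; Inverse; Equivalence; mk↔ₛ′; mk⇔)
open import Function.Construct.Composition using (_↔-∘_)
open import Function.Construct.Identity using (↔-id)
open import Function.Construct.Symmetry using (↔-sym)
open import Relation.Binary.Definitions using (DecidableEquality; tri<; tri≈; tri>)
open import Relation.Binary.PropositionalEquality using (_≢_; refl; sym; trans; cong; cong₂; subst; subst₂; setoid; module ≡-Reasoning)
open import Relation.Nullary using (¬_; Dec; yes; no; does)
open import Relation.Nullary.Decidable using (⌊_⌋; toWitness; fromWitness; map′)

-- Cyclic indices

-- All quivers are compared through one model: positions `V`, `E` of a cyclic sequence of letters,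
-- and a `Real` matching them with the vertices and arrows of a quiver. Existence and uniqueness of
-- the letters are then separate questions. Uniqueness is delicate in two places. The cycle is
-- unique only as a set of vertices, so two readings agree up to the dihedral group; but reading
-- backwards flips all letters, and in a mirror-symmetric sequence this is again a rotation. On a
-- cycle of length 2 it is not an invariant which arrow of the double arrow carries a given
-- triangle; mirror symmetry attaches equal quivers to both, which settles the case. A symmetric
-- quiver comes with its own cycle and attachment, so its letters are read off from these. That the
-- automorphism respects the shapes follows from a description of attached quivers by incident
-- arrows only. Each letter is met twice around the cycle, once flipped, which is why vertices and
-- triangles come in even numbers.

toℕ-mod : ∀ a k .{{_ : NonZero k}} → toℕ (a mod k) ≡ a % k
toℕ-mod a k = toℕ-fromℕ< (m%n<n a k)

[m%k+n]%k : ∀ m n k .{{_ : NonZero k}} → (m % k + n) % k ≡ (m + n) % k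
[m%k+n]%k m n k = begin
  (m % k + n) % k         ≡⟨ %-distribˡ-+ (m % k) n k ⟩
  (m % k % k + n % k) % k ≡⟨ cong (λ x → (x + n % k) % k) (m%n%n≡m%n m k) ⟩
  (m % k + n % k) % k     ≡⟨ %-distribˡ-+ m n k ⟨
  (m + n) % k             ∎
  where open ≡-Reasoning

module Cyclic {ℓ : ℕ} where
  k′ : ℕ
  k′ = suc (suc ℓ)

  toℕ% : (i : Fin k′) → toℕ i % k′ ≡ toℕ i
  toℕ% i = m<n⇒m%n≡m (toℕ<n i)

  infixl 6 _⊕_
  _⊕_ : Fin k′ → ℕ → Fin k′
  i ⊕ n = (toℕ i + n) mod k′

  toℕ-⊕ : ∀ i n → toℕ (i ⊕ n) ≡ (toℕ i + n) % k′
  toℕ-⊕ i n = toℕ-mod (toℕ i + n) k′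

  toℕ-nxt : ∀ (i : Fin k′) → toℕ (nxt i) ≡ suc (toℕ i) % k′
  toℕ-nxt i = toℕ-mod (suc (toℕ i)) k′

  ⊕-⊕ : ∀ i m n → i ⊕ m ⊕ n ≡ i ⊕ (m + n)
  ⊕-⊕ i m n = toℕ-injective (begin
    toℕ (i ⊕ m ⊕ n)             ≡⟨ toℕ-⊕ (i ⊕ m) n ⟩
    (toℕ (i ⊕ m) + n) % k′      ≡⟨ cong (λ x → (x + n) % k′) (toℕ-⊕ i m) ⟩
    ((toℕ i + m) % k′ + n) % k′ ≡⟨ [m%k+n]%k (toℕ i + m) n k′ ⟩
    (toℕ i + m + n) % k′        ≡⟨ cong (_% k′) (+-assoc (toℕ i) m n) ⟩
    (toℕ i + (m + n)) % k′      ≡⟨ toℕ-⊕ i (m + n) ⟨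
    toℕ (i ⊕ (m + n))           ∎)
    where open ≡-Reasoning

  ⊕-multiple : ∀ i q → i ⊕ (q * k′) ≡ i
  ⊕-multiple i q = toℕ-injective (begin
    toℕ (i ⊕ q * k′)      ≡⟨ toℕ-⊕ i (q * k′) ⟩
    (toℕ i + q * k′) % k′ ≡⟨ [m+kn]%n≡m%n (toℕ i) q k′ ⟩
    toℕ i % k′            ≡⟨ toℕ% i ⟩
    toℕ i                 ∎)
    where open ≡-Reasoning

  ⊕-identityʳ : ∀ i → i ⊕ 0 ≡ i
  ⊕-identityʳ i = ⊕-multiple i 0

  nxt≡⊕1 : ∀ i → nxt i ≡ i ⊕ 1
  nxt≡⊕1 i = cong (_mod k′) (+-comm 1 (toℕ i))

  nxt-⊕ : ∀ i n → nxt (i ⊕ n) ≡ nxt i ⊕ n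
  nxt-⊕ i n = begin
    nxt (i ⊕ n) ≡⟨ nxt≡⊕1 (i ⊕ n) ⟩
    i ⊕ n ⊕ 1   ≡⟨ ⊕-⊕ i n 1 ⟩
    i ⊕ (n + 1) ≡⟨ cong (i ⊕_) (+-comm n 1) ⟩
    i ⊕ (1 + n) ≡⟨ ⊕-⊕ i 1 n ⟨
    i ⊕ 1 ⊕ n   ≡⟨ cong (_⊕ n) (nxt≡⊕1 i) ⟨
    nxt i ⊕ n   ∎
    where open ≡-Reasoning

  ⊕-suc : ∀ i n → i ⊕ suc n ≡ nxt (i ⊕ n)
  ⊕-suc i n = sym (trans (nxt-⊕ i n) (trans (cong (_⊕ n) (nxt≡⊕1 i)) (⊕-⊕ i 1 n)))

  ⊕-reach : ∀ i j → i ⊕ (k′ ∸ toℕ i + toℕ j) ≡ j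
  ⊕-reach i j = toℕ-injective (begin
    toℕ (i ⊕ (k′ ∸ toℕ i + toℕ j))      ≡⟨ toℕ-⊕ i _ ⟩
    (toℕ i + (k′ ∸ toℕ i + toℕ j)) % k′ ≡⟨ cong (_% k′) (+-assoc (toℕ i) _ _) ⟨
    (toℕ i + (k′ ∸ toℕ i) + toℕ j) % k′ ≡⟨ cong (λ x → (x + toℕ j) % k′) (m+[n∸m]≡n (<⇒≤ (toℕ<n i))) ⟩
    (k′ + toℕ j) % k′                   ≡⟨ cong (_% k′) (+-comm k′ (toℕ j)) ⟩
    (toℕ j + k′) % k′                   ≡⟨ [m+n]%n≡m%n (toℕ j) k′ ⟩
    toℕ j % k′                          ≡⟨ toℕ% j ⟩
    toℕ j                               ∎)
    where open ≡-Reasoning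

  -- Iterating `nxt` from `i` reaches every index, so a property kept by one step holds all round
  -- the cycle, whatever the starting point.
  nxt-induction : (P : Fin k′ → Set) → ∀ i → P i → (∀ j → P j → P (nxt j)) → ∀ j → P j
  nxt-induction P i Pi step j = subst P (⊕-reach i j) (go (k′ ∸ toℕ i + toℕ j))
    where
    go : ∀ n → P (i ⊕ n)
    go zero    = subst P (sym (⊕-identityʳ i)) Pi
    go (suc n) = subst P (sym (⊕-suc i n)) (step (i ⊕ n) (go n))

  -- Since `suc ℓ` is -1 modulo `k′`, the product `c * suc ℓ` represents -c without subtraction.
  ⊕-inverse : ∀ i c → i ⊕ c ⊕ (c * suc ℓ) ≡ i
  ⊕-inverse i c = trans (⊕-⊕ i c (c * suc ℓ)) (trans (cong (i ⊕_) (sym (*-suc c (suc ℓ)))) (⊕-multiple i c))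

  ⊕-inverse′ : ∀ i c → i ⊕ (c * suc ℓ) ⊕ c ≡ i
  ⊕-inverse′ i c = trans (⊕-⊕ i _ c) (trans (cong (i ⊕_) (+-comm _ c)) (trans (sym (⊕-⊕ i c _)) (⊕-inverse i c)))

  prv : Fin k′ → Fin k′
  prv i = i ⊕ suc ℓ

  prv-nxt : ∀ i → prv (nxt i) ≡ i
  prv-nxt i = trans (cong prv (nxt≡⊕1 i)) (trans (⊕-⊕ i 1 (suc ℓ)) (subst (λ x → i ⊕ x ≡ i) (+-identityʳ k′) (⊕-multiple i 1)))

  nxt-prv : ∀ i → nxt (prv i) ≡ i
  nxt-prv i = trans (nxt-⊕ i (suc ℓ)) (prv-nxt i)

  nxt-injective : ∀ {i j} → nxt i ≡ nxt j → i ≡ j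
  nxt-injective {i} {j} eq = trans (sym (prv-nxt i)) (trans (cong prv eq) (prv-nxt j))

  nxt≢id : ∀ i → nxt i ≢ i
  nxt≢id i eq with trans (sym (all zero)) (all (suc zero))
    where
    all : ∀ j → i ≡ j
    all = nxt-induction (i ≡_) i refl (λ j p → trans (sym eq) (cong nxt p))
  ... | ()

  ⊕-injective : ∀ {i j} c → i ⊕ c ≡ j ⊕ c → i ≡ j
  ⊕-injective {i} {j} c eq = trans (sym (⊕-inverse i c)) (trans (cong (_⊕ (c * suc ℓ)) eq) (⊕-inverse j c))

  -- Identifies `revV c` as i ↦ c - i in the cyclic group. Together with `revE-⊕`, which gives i ↦ c
  -- - 1 - i, it replaces the truncated subtractions of the definitions from here on.
  revV-⊕ : ∀ (c i : Fin k′) → revV c i ⊕ toℕ i ≡ c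
  revV-⊕ c i = toℕ-injective (begin
    toℕ (revV c i ⊕ toℕ i)                      ≡⟨ toℕ-⊕ (revV c i) (toℕ i) ⟩
    (toℕ (revV c i) + toℕ i) % k′               ≡⟨ cong (λ x → (x + toℕ i) % k′) (toℕ-mod (toℕ c + (k′ ∸ toℕ i)) k′) ⟩
    ((toℕ c + (k′ ∸ toℕ i)) % k′ + toℕ i) % k′  ≡⟨ [m%k+n]%k (toℕ c + (k′ ∸ toℕ i)) (toℕ i) k′ ⟩
    (toℕ c + (k′ ∸ toℕ i) + toℕ i) % k′         ≡⟨ cong (_% k′) (+-assoc (toℕ c) _ _) ⟩
    (toℕ c + (k′ ∸ toℕ i + toℕ i)) % k′         ≡⟨ cong (λ x → (toℕ c + x) % k′) (m∸n+n≡m (<⇒≤ (toℕ<n i))) ⟩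
    (toℕ c + k′) % k′                           ≡⟨ [m+n]%n≡m%n (toℕ c) k′ ⟩
    toℕ c % k′                                  ≡⟨ toℕ% c ⟩
    toℕ c                                       ∎)
    where open ≡-Reasoning

  revE-⊕ : ∀ (c i : Fin k′) → revE c i ⊕ suc (toℕ i) ≡ c
  revE-⊕ c i = toℕ-injective (begin
    toℕ (revE c i ⊕ suc (toℕ i))                         ≡⟨ toℕ-⊕ (revE c i) (suc (toℕ i)) ⟩
    (toℕ (revE c i) + suc (toℕ i)) % k′                  ≡⟨ cong (λ x → (x + suc (toℕ i)) % k′) (toℕ-mod (toℕ c + (suc ℓ ∸ toℕ i)) k′) ⟩
    ((toℕ c + (suc ℓ ∸ toℕ i)) % k′ + suc (toℕ i)) % k′  ≡⟨ [m%k+n]%k (toℕ c + (suc ℓ ∸ toℕ i)) (suc (toℕ i)) k′ ⟩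
    (toℕ c + (suc ℓ ∸ toℕ i) + suc (toℕ i)) % k′         ≡⟨ cong (_% k′) (+-assoc (toℕ c) _ _) ⟩
    (toℕ c + (suc ℓ ∸ toℕ i + suc (toℕ i))) % k′         ≡⟨ cong (λ x → (toℕ c + x) % k′) (+-suc (suc ℓ ∸ toℕ i) (toℕ i)) ⟩
    (toℕ c + suc (suc ℓ ∸ toℕ i + toℕ i)) % k′           ≡⟨ cong (λ x → (toℕ c + suc x) % k′) (m∸n+n≡m (≤-pred (toℕ<n i))) ⟩
    (toℕ c + k′) % k′                                    ≡⟨ [m+n]%n≡m%n (toℕ c) k′ ⟩
    toℕ c % k′                                           ≡⟨ toℕ% c ⟩
    toℕ c                                                ∎)
    where open ≡-Reasoning

  -- Base arrow i joins the vertices i and i + 1, so its mirror image has to join c - i - 1 and c -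
  -- i. This and `revV-nxt` make `revV` and `revE` fit together.
  nxt-revE : ∀ (c i : Fin k′) → nxt (revE c i) ≡ revV c i
  nxt-revE c i = ⊕-injective (toℕ i) (begin
    nxt (revE c i) ⊕ toℕ i   ≡⟨ nxt-⊕ (revE c i) (toℕ i) ⟨
    nxt (revE c i ⊕ toℕ i)   ≡⟨ ⊕-suc (revE c i) (toℕ i) ⟨
    revE c i ⊕ suc (toℕ i)   ≡⟨ revE-⊕ c i ⟩
    c                        ≡⟨ revV-⊕ c i ⟨
    revV c i ⊕ toℕ i         ∎)
    where open ≡-Reasoning

  ⊕-% : ∀ (i : Fin k′) n → i ⊕ (n % k′) ≡ i ⊕ n
  ⊕-% i n = toℕ-injective (begin
    toℕ (i ⊕ n % k′)      ≡⟨ toℕ-⊕ i (n % k′) ⟩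
    (toℕ i + n % k′) % k′ ≡⟨ cong (_% k′) (+-comm (toℕ i) _) ⟩
    (n % k′ + toℕ i) % k′ ≡⟨ [m%k+n]%k n (toℕ i) k′ ⟩
    (n + toℕ i) % k′      ≡⟨ cong (_% k′) (+-comm n _) ⟩
    (toℕ i + n) % k′      ≡⟨ toℕ-⊕ i n ⟨
    toℕ (i ⊕ n)           ∎)
    where open ≡-Reasoning

  revV-nxt : ∀ (c i : Fin k′) → revV c (nxt i) ≡ revE c i
  revV-nxt c i = ⊕-injective (toℕ (nxt i)) (begin
    revV c (nxt i) ⊕ toℕ (nxt i)    ≡⟨ revV-⊕ c (nxt i) ⟩
    c                               ≡⟨ revE-⊕ c i ⟨
    revE c i ⊕ suc (toℕ i)          ≡⟨ ⊕-% (revE c i) (suc (toℕ i)) ⟨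
    revE c i ⊕ (suc (toℕ i) % k′)   ≡⟨ cong (revE c i ⊕_) (toℕ-nxt i) ⟨
    revE c i ⊕ toℕ (nxt i)          ∎)
    where open ≡-Reasoning

  ⊕-comm : ∀ (i j : Fin k′) → i ⊕ toℕ j ≡ j ⊕ toℕ i
  ⊕-comm i j = cong (_mod k′) (+-comm (toℕ i) (toℕ j))

  revV-involutive : ∀ (c i : Fin k′) → revV c (revV c i) ≡ i
  revV-involutive c i = ⊕-injective (toℕ (revV c i))
    (trans (revV-⊕ c (revV c i)) (trans (sym (revV-⊕ c i)) (⊕-comm (revV c i) i)))

  revE-involutive : ∀ (c i : Fin k′) → revE c (revE c i) ≡ i
  revE-involutive c i = nxt-injective (begin
    nxt (revE c (revE c i))  ≡⟨ nxt-revE c (revE c i) ⟩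
    revV c (revE c i)        ≡⟨ cong (revV c) (revV-nxt c i) ⟨
    revV c (revV c (nxt i))  ≡⟨ revV-involutive c (nxt i) ⟩
    nxt i                    ∎)
    where open ≡-Reasoning

-- The quiver described by a cyclic sequence of letters

-- Isomorphism types of rooted quivers of type A: `stem true` is an arrow leaving the root,
-- `fork t₁ t₂` an oriented triangle root → root of t₁ → root of t₂ → root.
data Shape : Set where
  leaf : Shape
  stem : Bool → Shape → Shape
  fork : Shape → Shape → Shape

data Node : Shape → Set where
  root : ∀ {t} → Node t
  inS  : ∀ {d t} → Node t → Node (stem d t)
  inL  : ∀ {t₁ t₂} → Node t₁ → Node (fork t₁ t₂)
  inR  : ∀ {t₁ t₂} → Node t₂ → Node (fork t₁ t₂)

data Arrow : Shape → Set where
  aS       : ∀ {d t} → Arrow (stem d t)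
  a₁ a₂ a₃ : ∀ {t₁ t₂} → Arrow (fork t₁ t₂)
  inS      : ∀ {d t} → Arrow t → Arrow (stem d t)
  inL      : ∀ {t₁ t₂} → Arrow t₁ → Arrow (fork t₁ t₂)
  inR      : ∀ {t₁ t₂} → Arrow t₂ → Arrow (fork t₁ t₂)

srcT tgtT : ∀ {t} → Arrow t → Node t
srcT (aS {true})  = root
srcT (aS {false}) = inS root
srcT a₁           = root
srcT a₂           = inL root
srcT a₃           = inR root
srcT (inS a)      = inS (srcT a)
srcT (inL a)      = inL (srcT a)
srcT (inR a)      = inR (srcT a)
tgtT (aS {true})  = inS root
tgtT (aS {false}) = root
tgtT a₁           = inL root
tgtT a₂           = inR root
tgtT a₃           = root
tgtT (inS a)      = inS (tgtT a)
tgtT (inL a)      = inL (tgtT a)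
tgtT (inR a)      = inR (tgtT a)

data Triangle : Shape → Set where
  top : ∀ {t₁ t₂} → Triangle (fork t₁ t₂)
  inS : ∀ {d t} → Triangle t → Triangle (stem d t)
  inL : ∀ {t₁ t₂} → Triangle t₁ → Triangle (fork t₁ t₂)
  inR : ∀ {t₁ t₂} → Triangle t₂ → Triangle (fork t₁ t₂)

side₁ side₂ side₃ : ∀ {t} → Triangle t → Arrow t
side₁ top     = a₁
side₁ (inS τ) = inS (side₁ τ)
side₁ (inL τ) = inL (side₁ τ)
side₁ (inR τ) = inR (side₁ τ)
side₂ top     = a₂
side₂ (inS τ) = inS (side₂ τ)
side₂ (inL τ) = inL (side₂ τ)
side₂ (inR τ) = inR (side₂ τ)
side₃ top     = a₃
side₃ (inS τ) = inS (side₃ τ)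
side₃ (inL τ) = inL (side₃ τ)
side₃ (inR τ) = inR (side₃ τ)

-- Adding vertices by increasing rank, each new vertex carries one new arrow or is the apex
-- of one new oriented triangle; the new arrows are those whose higher end it is.
rankT : ∀ {t} → Node t → ℕ
rankT root    = 0
rankT (inS x) = 1 + rankT x
rankT (inL x) = 1 + rankT x
rankT (inR x) = 2 + rankT x

highT : ∀ {t} → Arrow t → Node t
highT aS      = inS root
highT a₁      = inL root
highT a₂      = inR root
highT a₃      = inR root
highT (inS a) = inS (highT a)
highT (inL a) = inL (highT a)
highT (inR a) = inR (highT a)

Descends : ∀ {t} → Arrow t → Set
Descends a = (srcT a ≡ highT a × rankT (tgtT a) < rankT (srcT a))
           ⊎ (tgtT a ≡ highT a × rankT (srcT a) < rankT (tgtT a))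

-- The constants of `rankT` are chosen for this: the 2 for `inR` lifts the root of the second branch
-- above that of the first, so that `a₂` and `a₃` share it as higher end.
descendsT : ∀ {t} (a : Arrow t) → Descends a
descendsT (aS {true})  = inj₂ (refl , s≤s z≤n)
descendsT (aS {false}) = inj₁ (refl , s≤s z≤n)
descendsT a₁ = inj₂ (refl , s≤s z≤n)
descendsT a₂ = inj₂ (refl , s≤s (s≤s z≤n))
descendsT a₃ = inj₁ (refl , s≤s z≤n)
descendsT (inS a) with descendsT a
... | inj₁ (p , q) = inj₁ (cong inS p , s≤s q)
... | inj₂ (p , q) = inj₂ (cong inS p , s≤s q)
descendsT (inL a) with descendsT a
... | inj₁ (p , q) = inj₁ (cong inL p , s≤s q)
... | inj₂ (p , q) = inj₂ (cong inL p , s≤s q)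
descendsT (inR a) with descendsT a
... | inj₁ (p , q) = inj₁ (cong inR p , s≤s (s≤s q))
... | inj₂ (p , q) = inj₂ (cong inR p , s≤s (s≤s q))

highT≢root : ∀ {t} (a : Arrow t) → highT a ≢ root
highT≢root aS ()
highT≢root a₁ ()
highT≢root a₂ ()
highT≢root a₃ ()
highT≢root (inS a) ()
highT≢root (inL a) ()
highT≢root (inR a) ()

inS-injective : ∀ {d t} {x y : Node t} → inS {d} x ≡ inS y → x ≡ y
inS-injective refl = refl

inL-injective : ∀ {t₁ t₂} {x y : Node t₁} → inL {t₁} {t₂} x ≡ inL y → x ≡ y
inL-injective refl = refl

inR-injective : ∀ {t₁ t₂} {x y : Node t₂} → inR {t₁} {t₂} x ≡ inR y → x ≡ y
inR-injective refl = refl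

ApexPair : ∀ {t} → Arrow t → Arrow t → Set
ApexPair a a′ = ∃ λ τ → (a ≡ side₂ τ × a′ ≡ side₃ τ) ⊎ (a ≡ side₃ τ × a′ ≡ side₂ τ)

apexPair-map : ∀ {s t} (h : Arrow s → Arrow t) (h′ : Triangle s → Triangle t) →
  (∀ τ → h (side₂ τ) ≡ side₂ (h′ τ)) → (∀ τ → h (side₃ τ) ≡ side₃ (h′ τ)) →
  ∀ {a a′} → a ≡ a′ ⊎ ApexPair a a′ → h a ≡ h a′ ⊎ ApexPair (h a) (h a′)
apexPair-map h h′ p₂ p₃ (inj₁ refl) = inj₁ refl
apexPair-map h h′ p₂ p₃ (inj₂ (τ , inj₁ (refl , refl))) = inj₂ (h′ τ , inj₁ (p₂ τ , p₃ τ))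
apexPair-map h h′ p₂ p₃ (inj₂ (τ , inj₂ (refl , refl))) = inj₂ (h′ τ , inj₂ (p₃ τ , p₂ τ))

-- Every vertex other than the root is the root of a branch. It is entered from lower rank by one
-- arrow under `inS` and `inL`, and by the two arrows `a₂`, `a₃` under `inR`; arrows inside a branch
-- never have its root as higher end.
highT-fibre : ∀ {t} (a a′ : Arrow t) → highT a ≡ highT a′ → a ≡ a′ ⊎ ApexPair a a′
highT-fibre aS aS eq = inj₁ refl
highT-fibre aS (inS a′) eq = ⊥-elim (highT≢root a′ (sym (inS-injective eq)))
highT-fibre (inS a) aS eq = ⊥-elim (highT≢root a (inS-injective eq))
highT-fibre (inS a) (inS a′) eq =
  apexPair-map inS inS (λ _ → refl) (λ _ → refl) (highT-fibre a a′ (inS-injective eq))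
highT-fibre a₁ a₁ eq = inj₁ refl
highT-fibre a₁ (inL a′) eq = ⊥-elim (highT≢root a′ (sym (inL-injective eq)))
highT-fibre a₂ a₂ eq = inj₁ refl
highT-fibre a₂ a₃ eq = inj₂ (top , inj₁ (refl , refl))
highT-fibre a₂ (inR a′) eq = ⊥-elim (highT≢root a′ (sym (inR-injective eq)))
highT-fibre a₃ a₂ eq = inj₂ (top , inj₂ (refl , refl))
highT-fibre a₃ a₃ eq = inj₁ refl
highT-fibre a₃ (inR a′) eq = ⊥-elim (highT≢root a′ (sym (inR-injective eq)))
highT-fibre (inL a) a₁ eq = ⊥-elim (highT≢root a (inL-injective eq))
highT-fibre (inL a) (inL a′) eq =
  apexPair-map inL inL (λ _ → refl) (λ _ → refl) (highT-fibre a a′ (inL-injective eq))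
highT-fibre (inR a) a₂ eq = ⊥-elim (highT≢root a (inR-injective eq))
highT-fibre (inR a) a₃ eq = ⊥-elim (highT≢root a (inR-injective eq))
highT-fibre (inR a) (inR a′) eq =
  apexPair-map inR inR (λ _ → refl) (λ _ → refl) (highT-fibre a a′ (inR-injective eq))

record IsTriangle {t} (τ : Triangle t) : Set where
  constructor isTriangle
  field
    src₂ : srcT (side₂ τ) ≡ tgtT (side₁ τ)
    src₃ : srcT (side₃ τ) ≡ tgtT (side₂ τ)
    src₁ : srcT (side₁ τ) ≡ tgtT (side₃ τ)
    apex : highT (side₃ τ) ≡ srcT (side₃ τ)

triangleT : ∀ {t} (τ : Triangle t) → IsTriangle τ
triangleT top = isTriangle refl refl refl refl
triangleT (inS τ) with isTriangle p q r s ← triangleT τ =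
  isTriangle (cong inS p) (cong inS q) (cong inS r) (cong inS s)
triangleT (inL τ) with isTriangle p q r s ← triangleT τ =
  isTriangle (cong inL p) (cong inL q) (cong inL r) (cong inL s)
triangleT (inR τ) with isTriangle p q r s ← triangleT τ =
  isTriangle (cong inR p) (cong inR q) (cong inR r) (cong inR s)

side₃≢root : ∀ {t} (τ : Triangle t) → srcT (side₃ τ) ≢ root
side₃≢root τ eq = highT≢root (side₃ τ) (trans (IsTriangle.apex (triangleT τ)) eq)

-- No triangle inside a branch has its apex at the root of the branch (`side₃≢root`), so `inR root`
-- is the apex of `top` alone. Triangles can thus be told apart by their apexes.
apexT-injective : ∀ {t} (τ τ′ : Triangle t) → srcT (side₃ τ) ≡ srcT (side₃ τ′) → τ ≡ τ′
apexT-injective top top eq = refl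
apexT-injective top (inR τ′) eq = ⊥-elim (side₃≢root τ′ (sym (inR-injective eq)))
apexT-injective (inS τ) (inS τ′) eq = cong inS (apexT-injective τ τ′ (inS-injective eq))
apexT-injective (inL τ) (inL τ′) eq = cong inL (apexT-injective τ τ′ (inL-injective eq))
apexT-injective (inR τ) top eq = ⊥-elim (side₃≢root τ (inR-injective eq))
apexT-injective (inR τ) (inR τ′) eq = cong inR (apexT-injective τ τ′ (inR-injective eq))

-- A letter is a base arrow, directed along (`true`) or against the cyclic order, together
-- with the rooted quiver attached to it, if any.
Letter : Set
Letter = Bool × Maybe Shape

dir : Letter → Bool
dir = proj₁

shape : Letter → Maybe Shape
shape = proj₂

-- The shape is tied to `o` by an equation because `o` will be `shape (f i)`, on which one cannot
-- match while `f` is arbitrary; `uip` identifies any two such equations.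
data LocalV (o : Maybe Shape) : Set where
  bs : LocalV o
  nd : ∀ {t} → o ≡ just t → Node t → LocalV o

data LocalE (o : Maybe Shape) : Set where
  ba      : LocalE o
  ent ext : ∀ {t} → o ≡ just t → LocalE o
  sub     : ∀ {t} → o ≡ just t → Arrow t → LocalE o

data LocalT (o : Maybe Shape) : Set where
  top : ∀ {t} → o ≡ just t → LocalT o
  sub : ∀ {t} → o ≡ just t → Triangle t → LocalT o

-- `ent` and `ext` are the arrows y → z_α and z_α → x for a base arrow α : x → y.
module Model {ℓ : ℕ} (f : Fin (suc (suc ℓ)) → Letter) where
  open Cyclic {ℓ}

  V E △ : Set
  V = Σ (Fin k′) (λ i → LocalV (shape (f i)))
  E = Σ (Fin k′) (λ i → LocalE (shape (f i)))
  △ = Σ (Fin k′) (λ i → LocalT (shape (f i)))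

  xEnd yEnd : Fin k′ → Fin k′
  xEnd i = if dir (f i) then i else nxt i
  yEnd i = if dir (f i) then nxt i else i

  source target : E → V
  source (i , ba)       = xEnd i , bs
  source (i , ent p)    = yEnd i , bs
  source (i , ext p)    = i , nd p root
  source (i , sub p a)  = i , nd p (srcT a)
  target (i , ba)       = yEnd i , bs
  target (i , ent p)    = i , nd p root
  target (i , ext p)    = xEnd i , bs
  target (i , sub p a)  = i , nd p (tgtT a)

  edge₁ edge₂ edge₃ : △ → E
  edge₁ (i , top p)   = i , ba
  edge₁ (i , sub p τ) = i , sub p (side₁ τ)
  edge₂ (i , top p)   = i , ent p
  edge₂ (i , sub p τ) = i , sub p (side₂ τ)
  edge₃ (i , top p)   = i , ext p
  edge₃ (i , sub p τ) = i , sub p (side₃ τ)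

  rank : V → ℕ
  rank (i , bs)     = 0
  rank (i , nd _ x) = suc (rankT x)

  high : E → V
  -- A default value: the ends of a base arrow both have rank 0, and the lemmas on `high` set base
  -- arrows aside.
  high (i , ba)      = i , bs
  high (i , ent p)   = i , nd p root
  high (i , ext p)   = i , nd p root
  high (i , sub p a) = i , nd p (highT a)

  bs-injective : ∀ {i j} → _≡_ {A = V} (i , bs) (j , bs) → i ≡ j
  bs-injective = cong proj₁

  nd-injective : ∀ {i j t s} {p : shape (f i) ≡ just t} {q : shape (f j) ≡ just s} {x y} →
    _≡_ {A = V} (i , nd p x) (j , nd q y) →
    Σ (i ≡ j) λ _ → Σ (t ≡ s) λ e → subst Node e x ≡ y
  nd-injective refl = refl , refl , refl

  OnBase : V → Set
  OnBase x = ∃ λ i → x ≡ (i , bs)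

  IsBase : E → Set
  IsBase a = ∃ λ i → a ≡ (i , ba)

  xEnd≢yEnd : ∀ i → xEnd i ≢ yEnd i
  xEnd≢yEnd i eq with dir (f i)
  ... | true  = nxt≢id i (sym eq)
  ... | false = nxt≢id i eq

  descends : ∀ a → IsBase a ⊎ (source a ≡ high a × rank (target a) < rank (source a))
                            ⊎ (target a ≡ high a × rank (source a) < rank (target a))
  descends (i , ba)    = inj₁ (i , refl)
  descends (i , ent p) = inj₂ (inj₂ (refl , s≤s z≤n))
  descends (i , ext p) = inj₂ (inj₁ (refl , s≤s z≤n))
  descends (i , sub p a) with descendsT a
  ... | inj₁ (q , r) = inj₂ (inj₁ (cong (λ x → i , nd p x) q , s≤s r))
  ... | inj₂ (q , r) = inj₂ (inj₂ (cong (λ x → i , nd p x) q , s≤s r))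

  ApexEdges : E → E → Set
  ApexEdges a a′ = ∃ λ τ → (a ≡ edge₂ τ × a′ ≡ edge₃ τ) ⊎ (a ≡ edge₃ τ × a′ ≡ edge₂ τ)

  -- Attached roots follow the pattern of `inR`: `ent` and `ext` meet at the apex of a triangle over
  -- the base arrow.
  high-fibre : ∀ a a′ → ¬ IsBase a → ¬ IsBase a′ → high a ≡ high a′ → a ≡ a′ ⊎ ApexEdges a a′
  high-fibre (i , ba) _ nb _ _ = ⊥-elim (nb (i , refl))
  high-fibre (i , ent _) (j , ba) _ nb _ = ⊥-elim (nb (j , refl))
  high-fibre (i , ext _) (j , ba) _ nb _ = ⊥-elim (nb (j , refl))
  high-fibre (i , sub _ _) (j , ba) _ nb _ = ⊥-elim (nb (j , refl))
  high-fibre (i , ent p) (j , ent q) _ _ refl = inj₁ refl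
  high-fibre (i , ent p) (j , ext q) _ _ refl = inj₂ ((i , top p) , inj₁ (refl , refl))
  high-fibre (i , ext p) (j , ent q) _ _ refl = inj₂ ((i , top p) , inj₂ (refl , refl))
  high-fibre (i , ext p) (j , ext q) _ _ refl = inj₁ refl
  high-fibre (i , ent p) (j , sub q a) _ _ eq with refl , refl , e ← nd-injective eq = ⊥-elim (highT≢root a (sym e))
  high-fibre (i , ext p) (j , sub q a) _ _ eq with refl , refl , e ← nd-injective eq = ⊥-elim (highT≢root a (sym e))
  high-fibre (i , sub p a) (j , ent q) _ _ eq with refl , refl , e ← nd-injective eq = ⊥-elim (highT≢root a e)
  high-fibre (i , sub p a) (j , ext q) _ _ eq with refl , refl , e ← nd-injective eq = ⊥-elim (highT≢root a e)
  high-fibre (i , sub p a) (j , sub q a′) _ _ eq with refl , refl , e ← nd-injective eq | highT-fibre a a′ e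
  ... | inj₁ refl rewrite uip p q = inj₁ refl
  ... | inj₂ (τ , inj₁ (refl , refl)) rewrite uip p q = inj₂ ((i , sub q τ) , inj₁ (refl , refl))
  ... | inj₂ (τ , inj₂ (refl , refl)) rewrite uip p q = inj₂ ((i , sub q τ) , inj₂ (refl , refl))

  source₂ : ∀ τ → source (edge₂ τ) ≡ target (edge₁ τ)
  source₂ (i , top p)   = refl
  source₂ (i , sub p τ) = cong (λ x → i , nd p x) (IsTriangle.src₂ (triangleT τ))

  source₃ : ∀ τ → source (edge₃ τ) ≡ target (edge₂ τ)
  source₃ (i , top p)   = refl
  source₃ (i , sub p τ) = cong (λ x → i , nd p x) (IsTriangle.src₃ (triangleT τ))

  source₁ : ∀ τ → source (edge₁ τ) ≡ target (edge₃ τ)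
  source₁ (i , top p)   = refl
  source₁ (i , sub p τ) = cong (λ x → i , nd p x) (IsTriangle.src₁ (triangleT τ))

  apex : △ → V
  apex τ = source (edge₃ τ)

  apex-high : ∀ τ → high (edge₃ τ) ≡ apex τ
  apex-high (i , top p)   = refl
  apex-high (i , sub p τ) = cong (λ x → i , nd p x) (IsTriangle.apex (triangleT τ))

  apex-injective : ∀ τ τ′ → apex τ ≡ apex τ′ → τ ≡ τ′
  apex-injective (i , top p) (j , top q) refl = refl
  apex-injective (i , top p) (j , sub q τ′) eq with refl , refl , e ← nd-injective eq = ⊥-elim (side₃≢root τ′ (sym e))
  apex-injective (i , sub p τ) (j , top q) eq with refl , refl , e ← nd-injective eq = ⊥-elim (side₃≢root τ e)
  apex-injective (i , sub p τ) (j , sub q τ′) eq with refl , refl , e ← nd-injective eq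
    rewrite uip p q | apexT-injective τ τ′ e = refl

argmax : ∀ {n} (g : Fin (suc n) → ℕ) → ∃ λ j → ∀ i → g i ≤ g j
argmax {zero} g = zero , λ { zero → ≤-refl }
argmax {suc n} g with argmax (λ i → g (suc i))
... | j , max with ≤-total (g zero) (g (suc j))
... | inj₁ le = suc j , λ { zero → le ; (suc i) → max i }
... | inj₂ ge = zero , λ { zero → ≤-refl ; (suc i) → ≤-trans (max i) ge }

nxt²≡id⇒two : ∀ {ℓ} (i : Fin (suc (suc ℓ))) → nxt (nxt i) ≡ i → ∀ j → j ≡ i ⊎ j ≡ nxt i
nxt²≡id⇒two {ℓ} i eq = Cyclic.nxt-induction _ i (inj₁ refl)
  λ { j (inj₁ refl) → inj₂ refl ; j (inj₂ refl) → inj₁ eq }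

nxt³≡id⇒three : ∀ {ℓ} (i : Fin (suc (suc ℓ))) → nxt (nxt (nxt i)) ≡ i →
  ∀ j → j ≡ i ⊎ j ≡ nxt i ⊎ j ≡ nxt (nxt i)
nxt³≡id⇒three {ℓ} i eq = Cyclic.nxt-induction _ i (inj₁ refl)
  λ { j (inj₁ refl) → inj₂ (inj₁ refl) ; j (inj₂ (inj₁ refl)) → inj₂ (inj₂ refl) ; j (inj₂ (inj₂ refl)) → inj₁ eq }

NonOriented : ∀ {ℓ} → (Fin (suc (suc ℓ)) → Letter) → Set
NonOriented f = (∃ λ i → dir (f i) ≡ true) × (∃ λ j → dir (f j) ≡ false)

-- Parallel arrows and non-oriented cycles of the model

module ModelProperties {ℓ : ℕ} (f : Fin (suc (suc ℓ)) → Letter) where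
  open Cyclic {ℓ}
  open Model f public

  Link : E → V → V → Set
  Link a x y = (source a ≡ x × target a ≡ y) ⊎ (source a ≡ y × target a ≡ x)

  source≢target : ∀ a → source a ≢ target a
  source≢target a eq with descends a
  ... | inj₁ (i , refl)       = xEnd≢yEnd i (cong proj₁ eq)
  ... | inj₂ (inj₁ (_ , lt))  = <-irrefl (cong rank (sym eq)) lt
  ... | inj₂ (inj₂ (_ , lt))  = <-irrefl (cong rank eq) lt

  rank0⇒onBase : ∀ x → rank x ≡ 0 → OnBase x
  rank0⇒onBase (i , bs) _ = i , refl

  onBase⇒rank0 : ∀ {x} → OnBase x → rank x ≡ 0
  onBase⇒rank0 (i , refl) = refl

  isBase? : ∀ a → Dec (IsBase a)
  isBase? (i , ba)      = yes (i , refl)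
  isBase? (i , ent _)   = no λ ()
  isBase? (i , ext _)   = no λ ()
  isBase? (i , sub _ _) = no λ ()

  ends-onBase : ∀ a → OnBase (source a) → OnBase (target a) → IsBase a
  ends-onBase a s t with descends a
  ... | inj₁ b = b
  ... | inj₂ (inj₁ (_ , lt)) = ⊥-elim (n≮0 (subst (rank (target a) <_) (onBase⇒rank0 s) lt))
  ... | inj₂ (inj₂ (_ , lt)) = ⊥-elim (n≮0 (subst (rank (source a) <_) (onBase⇒rank0 t) lt))

  isBase⇒ends : ∀ {a} → IsBase a → OnBase (source a) × OnBase (target a)
  isBase⇒ends (i , refl) = (_ , refl) , (_ , refl)

  -- An arrow other than a base arrow joins vertices of different rank, so an end at least as high
  -- as the other one is `high a`. A base arrow is impossible because `x` is off the base.
  link-high : ∀ a {x y} → Link a x y → ¬ OnBase x → rank y ≤ rank x → ¬ IsBase a × high a ≡ x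
  link-high a {x} {y} l off le = nb l , go l (descends a)
    where
    nb : Link a x y → ¬ IsBase a
    nb (inj₁ (refl , _)) b = off (proj₁ (isBase⇒ends b))
    nb (inj₂ (_ , refl)) b = off (proj₂ (isBase⇒ends b))
    go : Link a x y → _ → high a ≡ x
    go l (inj₁ b) = ⊥-elim (nb l b)
    go (inj₁ (refl , refl)) (inj₂ (inj₁ (e , _))) = sym e
    go (inj₁ (refl , refl)) (inj₂ (inj₂ (_ , lt))) = ⊥-elim (<⇒≱ lt le)
    go (inj₂ (refl , refl)) (inj₂ (inj₁ (_ , lt))) = ⊥-elim (<⇒≱ lt le)
    go (inj₂ (refl , refl)) (inj₂ (inj₂ (e , _))) = sym e

  edge₂≢base : ∀ τ → ¬ IsBase (edge₂ τ)
  edge₂≢base (i , top _) ()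
  edge₂≢base (i , sub _ _) ()

  edge₃≢base : ∀ τ → ¬ IsBase (edge₃ τ)
  edge₃≢base (i , top _) ()
  edge₃≢base (i , sub _ _) ()

  ApexEdges-high : ∀ {a a′} → ((τ , _) : ApexEdges a a′) → high a ≡ high a′ → apex τ ≡ high a
  ApexEdges-high (τ , inj₁ (refl , refl)) e = trans (sym (apex-high τ)) (sym e)
  ApexEdges-high (τ , inj₂ (refl , refl)) e = sym (apex-high τ)

  -- The higher end is the one of larger rank, hence it depends only on the unordered pair of ends.
  joined-high : ∀ a b → ¬ IsBase a → ¬ IsBase b → Link a (source b) (target b) → high a ≡ high b
  joined-high a b ¬p ¬q l with descends a | descends b
  ... | inj₁ p | _ = ⊥-elim (¬p p)
  ... | inj₂ _ | inj₁ q = ⊥-elim (¬q q)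
  joined-high a b _ _ (inj₁ (s , t)) | inj₂ (inj₁ (p , _)) | inj₂ (inj₁ (q , _)) = trans (sym p) (trans s q)
  joined-high a b _ _ (inj₁ (s , t)) | inj₂ (inj₂ (p , _)) | inj₂ (inj₂ (q , _)) = trans (sym p) (trans t q)
  joined-high a b _ _ (inj₁ (s , t)) | inj₂ (inj₁ (_ , p)) | inj₂ (inj₂ (_ , q)) = ⊥-elim (<-asym p (subst₂ (λ x y → rank x < rank y) (sym s) (sym t) q))
  joined-high a b _ _ (inj₁ (s , t)) | inj₂ (inj₂ (_ , p)) | inj₂ (inj₁ (_ , q)) = ⊥-elim (<-asym p (subst₂ (λ x y → rank x < rank y) (sym t) (sym s) q))
  joined-high a b _ _ (inj₂ (s , t)) | inj₂ (inj₁ (p , _)) | inj₂ (inj₂ (q , _)) = trans (sym p) (trans s q)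
  joined-high a b _ _ (inj₂ (s , t)) | inj₂ (inj₂ (p , _)) | inj₂ (inj₁ (q , _)) = trans (sym p) (trans t q)
  joined-high a b _ _ (inj₂ (s , t)) | inj₂ (inj₁ (_ , p)) | inj₂ (inj₁ (_ , q)) = ⊥-elim (<-asym p (subst₂ (λ x y → rank x < rank y) (sym s) (sym t) q))
  joined-high a b _ _ (inj₂ (s , t)) | inj₂ (inj₂ (_ , p)) | inj₂ (inj₂ (_ , q)) = ⊥-elim (<-asym p (subst₂ (λ x y → rank x < rank y) (sym t) (sym s) q))

  joined-base : ∀ a b → Link a (source b) (target b) → IsBase b → IsBase a
  joined-base a b (inj₁ (s , t)) q = ends-onBase a (subst OnBase (sym s) (proj₁ (isBase⇒ends q))) (subst OnBase (sym t) (proj₂ (isBase⇒ends q)))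
  joined-base a b (inj₂ (s , t)) q = ends-onBase a (subst OnBase (sym s) (proj₂ (isBase⇒ends q))) (subst OnBase (sym t) (proj₁ (isBase⇒ends q)))

  -- The two arrows at an apex are consecutive, one arriving and one leaving, so they are not
  -- parallel; by `high-fibre` only base arrows remain.
  parallel : ∀ a b → source a ≡ source b → target a ≡ target b → a ≡ b ⊎ (IsBase a × IsBase b)
  parallel a b s t with isBase? a | isBase? b
  ... | yes p | _ = inj₂ (p , joined-base b a (inj₁ (sym s , sym t)) p)
  ... | no ¬p | yes q = ⊥-elim (¬p (joined-base a b (inj₁ (s , t)) q))
  ... | no ¬p | no ¬q with high-fibre a b ¬p ¬q (joined-high a b ¬p ¬q (inj₁ (s , t)))
  ... | inj₁ eq = inj₁ eq
  ... | inj₂ (τ , inj₁ (refl , refl)) = ⊥-elim (source≢target (edge₂ τ) (trans s (source₃ τ)))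
  ... | inj₂ (τ , inj₂ (refl , refl)) = ⊥-elim (source≢target (edge₂ τ) (trans (sym s) (source₃ τ)))

  -- With the same direction the two arrows close up a cycle of length 2, all of whose arrows then
  -- have that direction. With different directions they would be the same arrow.
  base-antiparallel : NonOriented f → ∀ i j → xEnd i ≡ yEnd j → yEnd i ≡ xEnd j → ⊥
  base-antiparallel ((p , dp) , (q , dq)) i j s t with dir (f i) in di | dir (f j) in dj
  ... | true | false rewrite s with () ← trans (sym di) dj
  ... | false | true rewrite t with () ← trans (sym di) dj
  ... | true | true with nxt²≡id⇒two i (trans (cong nxt t) (sym s)) q
  ...   | inj₁ refl with () ← trans (sym di) dq
  ...   | inj₂ refl rewrite t with () ← trans (sym dj) dq
  base-antiparallel ((p , dp) , (q , dq)) i j s t | false | false with nxt²≡id⇒two i (trans (cong nxt s) (sym t)) p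
  ...   | inj₁ refl with () ← trans (sym di) dp
  ...   | inj₂ refl rewrite s with () ← trans (sym dj) dp

  antiparallel : NonOriented f → ∀ a b → source a ≡ target b → target a ≡ source b → ⊥
  antiparallel no₂ a b s t with isBase? a | isBase? b
  ... | yes (i , refl) | yes (j , refl) = base-antiparallel no₂ i j (cong proj₁ s) (cong proj₁ t)
  ... | yes p | no ¬q = ¬q (joined-base b a (inj₂ (sym t , sym s)) p)
  ... | no ¬p | yes q = ¬p (joined-base a b (inj₂ (s , t)) q)
  ... | no ¬p | no ¬q with high-fibre a b ¬p ¬q (joined-high a b ¬p ¬q (inj₂ (s , t)))
  ... | inj₁ refl = source≢target a s
  -- If the two arrows at an apex were antiparallel, the remaining side of the triangle would be a
  -- loop.
  ... | inj₂ (τ , inj₁ (refl , refl)) = source≢target (edge₁ τ) (trans (source₁ τ) (trans (sym s) (source₂ τ)))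
  ... | inj₂ (τ , inj₂ (refl , refl)) = source≢target (edge₁ τ) (trans (source₁ τ) (trans t (source₂ τ)))

  base-link : ∀ i {b y} → Link (i , ba) (b , bs) y → (i ≡ b × y ≡ (nxt b , bs)) ⊎ nxt i ≡ b
  base-link i l with dir (f i)
  base-link i (inj₁ (refl , refl)) | true = inj₁ (refl , refl)
  base-link i (inj₂ (refl , refl)) | true = inj₂ refl
  base-link i (inj₁ (refl , refl)) | false = inj₂ refl
  base-link i (inj₂ (refl , refl)) | false = inj₁ (refl , refl)

  -- At a vertex of maximal rank off the base, the cycle would pass through the apex of an
  -- oriented triangle and, being full, would be that triangle.
  module _ {ℓ′ : ℕ} (v : Fin (suc (suc ℓ′)) → V) (e : Fin (suc (suc ℓ′)) → E)
           (v-inj : ∀ i j → v i ≡ v j → i ≡ j) (e-inj : ∀ i j → e i ≡ e j → i ≡ j)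
           (e-link : ∀ i → Link (e i) (v i) (v (nxt i)))
           (full : ∀ a → (∃ λ i → v i ≡ source a) → (∃ λ j → v j ≡ target a) → ∃ λ i → a ≡ e i)
           (non : (∃ λ i → source (e i) ≡ v i) × (∃ λ j → source (e j) ≡ v (nxt j))) where
    private module K = Cyclic {ℓ′}

    link-prv : ∀ j → Link (e (K.prv j)) (v j) (v (K.prv j))
    link-prv j = swap (subst (λ x → Link (e (K.prv j)) (v (K.prv j)) (v x)) (K.nxt-prv j) (e-link (K.prv j)))

    prv≢id : ∀ j → K.prv j ≢ j
    prv≢id j eq = K.nxt≢id j (trans (sym (cong nxt eq)) (K.nxt-prv j))

    link-from : ∀ {a x y} → Link a x y → source a ≡ x → target a ≡ y
    link-from (inj₁ (_ , t)) _ = t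
    link-from {a} (inj₂ (_ , t)) s = ⊥-elim (source≢target a (trans s (sym t)))

    link-to : ∀ {a x y} → Link a x y → target a ≡ x → source a ≡ y
    link-to (inj₂ (s , _)) _ = s
    link-to {a} (inj₁ (s , _)) t = ⊥-elim (source≢target a (trans s (sym t)))

    max-onBase : ∀ j → (∀ i → rank (v i) ≤ rank (v j)) → OnBase (v j)
    max-onBase j max with rank (v j) ≟ 0
    ... | yes z = rank0⇒onBase _ z
    ... | no nz = ⊥-elim absurd
      where
      h = K.prv j
      off : ¬ OnBase (v j)
      off b = nz (onBase⇒rank0 b)
      H₁ = link-high (e j) (e-link j) off (max (nxt j))
      H₂ = link-high (e h) (link-prv j) off (max h)
      same : high (e j) ≡ high (e h)
      same = trans (proj₂ H₁) (sym (proj₂ H₂))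
      h≢j = prv≢id j
      absurd : ⊥
      absurd with high-fibre (e j) (e h) (proj₁ H₁) (proj₁ H₂) same
      ... | inj₁ eq = h≢j (sym (e-inj _ _ eq))
      ... | inj₂ A@(τ , inj₂ (ej , eh)) = closing (full (edge₁ τ) (nxt j , sym s₁) (h , sym t₁))
        where
        ap : apex τ ≡ v j
        ap = trans (ApexEdges-high A same) (proj₂ H₁)
        sj : source (e j) ≡ v j
        sj = trans (cong source ej) ap
        th : target (e h) ≡ v j
        th = trans (cong target eh) (trans (sym (source₃ τ)) ap)
        s₁ : source (edge₁ τ) ≡ v (nxt j)
        s₁ = trans (source₁ τ) (trans (cong target (sym ej)) (link-from {e j} (e-link j) sj))
        sh : source (e h) ≡ v h
        sh = link-to {e h} (link-prv j) th
        t₁ : target (edge₁ τ) ≡ v h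
        t₁ = trans (sym (source₂ τ)) (trans (cong source (sym eh)) sh)
        closing : (∃ λ i → edge₁ τ ≡ e i) → ⊥
        closing (i , ei) with e-link i
        -- Run backwards, the third side would stand at both positions `j` and `h`.
        ... | inj₂ (s , t) = h≢j (trans (sym (v-inj _ _ (trans (sym t) (trans (cong target (sym ei)) t₁))))
                                        (K.nxt-injective (v-inj _ _ (trans (sym s) (trans (cong source (sym ei)) s₁)))))
        -- Run forwards, it closes the cycle after three steps with every arrow along the cyclic
        -- order, against the second half of `non`.
        ... | inj₁ (s , t) = contra (proj₁ (proj₂ non)) (proj₂ (proj₂ non)) (nxt³≡id⇒three j c₃ (proj₁ (proj₂ non)))
          where
          i≡ : i ≡ nxt j
          i≡ = v-inj _ _ (trans (sym s) (trans (cong source (sym ei)) s₁))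
          ni≡ : nxt i ≡ h
          ni≡ = v-inj _ _ (trans (sym t) (trans (cong target (sym ei)) t₁))
          c₂ : nxt (nxt j) ≡ h
          c₂ = trans (cong nxt (sym i≡)) ni≡
          c₃ : nxt (nxt (nxt j)) ≡ j
          c₃ = trans (cong nxt c₂) (K.nxt-prv j)
          contra : ∀ m → source (e m) ≡ v (nxt m) → m ≡ j ⊎ m ≡ nxt j ⊎ m ≡ nxt (nxt j) → ⊥
          contra m b (inj₁ refl) = K.nxt≢id m (v-inj _ _ (trans (sym b) sj))
          contra m b (inj₂ (inj₁ refl)) = K.nxt≢id m (v-inj _ _ (trans (sym b)
            (trans (cong source (trans (cong e (sym i≡)) (sym ei))) s₁)))
          contra m b (inj₂ (inj₂ refl)) = K.nxt≢id m (v-inj _ _ (trans (sym b)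
            (trans (cong (λ x → source (e x)) c₂) (trans sh (cong v (sym c₂))))))
      ... | inj₂ A@(τ , inj₁ (ej , eh)) = closing (full (edge₁ τ) (h , sym s₁) (nxt j , sym t₁))
        where
        ap : apex τ ≡ v j
        ap = trans (ApexEdges-high A same) (proj₂ H₁)
        tj : target (e j) ≡ v j
        tj = trans (cong target ej) (trans (sym (source₃ τ)) ap)
        shj : source (e h) ≡ v j
        shj = trans (cong source eh) ap
        sj : source (e j) ≡ v (nxt j)
        sj = link-to {e j} (e-link j) tj
        th : target (e h) ≡ v h
        th = link-from {e h} (link-prv j) shj
        s₁ : source (edge₁ τ) ≡ v h
        s₁ = trans (source₁ τ) (trans (cong target (sym eh)) th)
        t₁ : target (edge₁ τ) ≡ v (nxt j)
        t₁ = trans (sym (source₂ τ)) (trans (cong source (sym ej)) sj)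
        closing : (∃ λ i → edge₁ τ ≡ e i) → ⊥
        closing (i , ei) with e-link i
        ... | inj₁ (s , t) = h≢j (trans (sym (v-inj _ _ (trans (sym s) (trans (cong source (sym ei)) s₁))))
                                        (K.nxt-injective (v-inj _ _ (trans (sym t) (trans (cong target (sym ei)) t₁)))))
        ... | inj₂ (s , t) = contra (proj₁ (proj₁ non)) (proj₂ (proj₁ non)) (nxt³≡id⇒three j c₃ (proj₁ (proj₁ non)))
          where
          i≡ : i ≡ nxt j
          i≡ = v-inj _ _ (trans (sym t) (trans (cong target (sym ei)) t₁))
          ni≡ : nxt i ≡ h
          ni≡ = v-inj _ _ (trans (sym s) (trans (cong source (sym ei)) s₁))
          c₂ : nxt (nxt j) ≡ h
          c₂ = trans (cong nxt (sym i≡)) ni≡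
          c₃ : nxt (nxt (nxt j)) ≡ j
          c₃ = trans (cong nxt c₂) (K.nxt-prv j)
          contra : ∀ m → source (e m) ≡ v m → m ≡ j ⊎ m ≡ nxt j ⊎ m ≡ nxt (nxt j) → ⊥
          contra m b (inj₁ refl) = K.nxt≢id m (v-inj _ _ (trans (sym sj) b))
          contra m b (inj₂ (inj₁ refl)) = K.nxt≢id m (v-inj _ _ (trans (cong v c₂)
            (trans (sym s₁) (trans (cong source (trans ei (cong e i≡))) b))))
          contra m b (inj₂ (inj₂ refl)) = K.nxt≢id m (v-inj _ _ (trans (cong v c₃)
            (trans (sym shj) (trans (cong (λ x → source (e x)) (sym c₂)) b))))

    all-onBase : ∀ i → OnBase (v i)
    all-onBase i with argmax (λ i → rank (v i))
    ... | j , max = rank0⇒onBase (v i) (n≤0⇒n≡0 (subst (rank (v i) ≤_) (onBase⇒rank0 (max-onBase j max)) (max i)))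

    arrow-isBase : ∀ i → IsBase (e i)
    arrow-isBase i with e-link i
    ... | inj₁ (s , t) = ends-onBase _ (subst OnBase (sym s) (all-onBase _)) (subst OnBase (sym t) (all-onBase _))
    ... | inj₂ (s , t) = ends-onBase _ (subst OnBase (sym s) (all-onBase _)) (subst OnBase (sym t) (all-onBase _))

    -- The cycle has two different base arrows at each base vertex that it visits. If neither led to
    -- the next vertex of the base, both would be the one base arrow that joins it to the previous
    -- vertex.
    base-covered : ∀ b → ∃ λ j → v j ≡ (b , bs)
    base-covered with all-onBase zero
    ... | b₀ , eq₀ = nxt-induction (λ b → ∃ λ j → v j ≡ (b , bs)) b₀ (zero , eq₀) step
      where
      step : ∀ b → (∃ λ j → v j ≡ (b , bs)) → ∃ λ j → v j ≡ (nxt b , bs)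
      step b (j , vj) with arrow-isBase j | arrow-isBase (K.prv j)
      ... | i₁ , eq₁ | i₂ , eq₂ with base-link i₁ (subst₂ (λ a x → Link a x (v (nxt j))) eq₁ vj (e-link j))
                                   | base-link i₂ (subst₂ (λ a x → Link a x (v (K.prv j))) eq₂ vj (link-prv j))
      ... | inj₁ (_ , y) | _ = nxt j , y
      ... | inj₂ _ | inj₁ (_ , y) = K.prv j , y
      ... | inj₂ p | inj₂ q = ⊥-elim (prv≢id j (e-inj _ _ (trans eq₂ (trans (cong (_, ba) (nxt-injective (trans q (sym p)))) (sym eq₁)))))

-- Quivers realizing a sequence of letters

reach-trans : ∀ {n} {Q : Quiver n} {x y z} → Reach Q x y → Reach Q y z → Reach Q x z
reach-trans here      q = q
reach-trans (fwd a p) q = fwd a (reach-trans p q)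
reach-trans (bwd a p) q = bwd a (reach-trans p q)

reach-sym : ∀ {n} {Q : Quiver n} {x y} → Reach Q x y → Reach Q y x
reach-sym here      = here
reach-sym (fwd a p) = reach-trans (reach-sym p) (bwd a here)
reach-sym (bwd a p) = reach-trans (reach-sym p) (fwd a here)

reach-arrow : ∀ {n} {Q : Quiver n} a {x y} → src Q a ≡ x → tgt Q a ≡ y → Reach Q x y
reach-arrow a refl refl = fwd a here

-- Embedded rooted quivers of type A and their vertex sets

record Embedding {n} (Q : Quiver n) (t : Shape) : Set where
  field
    ν     : Node t → Fin n
    κ     : Arrow t → Fin (m Q)
    ν-inj : ∀ {x y} → ν x ≡ ν y → x ≡ y
    src-κ : ∀ a → src Q (κ a) ≡ ν (srcT a)
    tgt-κ : ∀ a → tgt Q (κ a) ≡ ν (tgtT a)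
open Embedding

module _ {n} {Q : Quiver n} where
  embS : ∀ {d t} → Embedding Q (stem d t) → Embedding Q t
  embS ε = record { ν = ν ε ∘ inS ; κ = κ ε ∘ inS ; ν-inj = λ e → inS-injective (ν-inj ε e)
                  ; src-κ = λ a → src-κ ε (inS a) ; tgt-κ = λ a → tgt-κ ε (inS a) }

  embL : ∀ {s t} → Embedding Q (fork s t) → Embedding Q s
  embL ε = record { ν = ν ε ∘ inL ; κ = κ ε ∘ inL ; ν-inj = λ e → inL-injective (ν-inj ε e)
                  ; src-κ = λ a → src-κ ε (inL a) ; tgt-κ = λ a → tgt-κ ε (inL a) }

  embR : ∀ {s t} → Embedding Q (fork s t) → Embedding Q t
  embR ε = record { ν = ν ε ∘ inR ; κ = κ ε ∘ inR ; ν-inj = λ e → inR-injective (ν-inj ε e)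
                  ; src-κ = λ a → src-κ ε (inR a) ; tgt-κ = λ a → tgt-κ ε (inR a) }

  reach-root : ∀ {t} (ε : Embedding Q t) (x : Node t) → Reach Q (ν ε root) (ν ε x)
  reach-root ε root = here
  reach-root {stem true t} ε (inS x) =
    reach-trans (reach-arrow (κ ε aS) (src-κ ε aS) (tgt-κ ε aS)) (reach-root (embS ε) x)
  reach-root {stem false t} ε (inS x) =
    reach-trans (reach-sym (reach-arrow (κ ε aS) (src-κ ε aS) (tgt-κ ε aS))) (reach-root (embS ε) x)
  reach-root ε (inL x) = reach-trans (reach-arrow (κ ε a₁) (src-κ ε a₁) (tgt-κ ε a₁)) (reach-root (embL ε) x)
  reach-root ε (inR x) =
    reach-trans (reach-sym (reach-arrow (κ ε a₃) (src-κ ε a₃) (tgt-κ ε a₃))) (reach-root (embR ε) x)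

  -- Assembled by the same unions as in `IsRA`, so that the set equations required there hold by
  -- `refl`.
  image : ∀ {t} → (Node t → Fin n) → Subset n
  image {leaf}     ν = ⁅ ν root ⁆
  image {stem d t} ν = ⁅ ν root ⁆ ∪ image (ν ∘ inS)
  image {fork s t} ν = ⁅ ν root ⁆ ∪ (image (ν ∘ inL) ∪ image (ν ∘ inR))

  ∈-image⁺ : ∀ {t} (ν : Node t → Fin n) x → ν x ∈ˢ image ν
  ∈-image⁺ {leaf}     ν root    = x∈⁅x⁆ _
  ∈-image⁺ {stem d t} ν root    = x∈p∪q⁺ (inj₁ (x∈⁅x⁆ _))
  ∈-image⁺ {stem d t} ν (inS x) = x∈p∪q⁺ (inj₂ (∈-image⁺ (ν ∘ inS) x))
  ∈-image⁺ {fork s t} ν root    = x∈p∪q⁺ (inj₁ (x∈⁅x⁆ _))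
  ∈-image⁺ {fork s t} ν (inL x) = x∈p∪q⁺ (inj₂ (x∈p∪q⁺ (inj₁ (∈-image⁺ (ν ∘ inL) x))))
  ∈-image⁺ {fork s t} ν (inR x) = x∈p∪q⁺ (inj₂ (x∈p∪q⁺ (inj₂ (∈-image⁺ (ν ∘ inR) x))))

  ∈-image⁻ : ∀ {t} (ν : Node t → Fin n) {y} → y ∈ˢ image ν → ∃ λ x → ν x ≡ y
  ∈-image⁻ {leaf}     ν y∈ = root , sym (x∈⁅y⁆⇒x≡y _ y∈)
  ∈-image⁻ {stem d t} ν y∈ with x∈p∪q⁻ ⁅ ν root ⁆ (image (ν ∘ inS)) y∈
  ... | inj₁ p = root , sym (x∈⁅y⁆⇒x≡y _ p)
  ... | inj₂ p with ∈-image⁻ (ν ∘ inS) p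
  ...   | x , e = inS x , e
  ∈-image⁻ {fork s t} ν y∈ with x∈p∪q⁻ ⁅ ν root ⁆ (image (ν ∘ inL) ∪ image (ν ∘ inR)) y∈
  ... | inj₁ p = root , sym (x∈⁅y⁆⇒x≡y _ p)
  ... | inj₂ p with x∈p∪q⁻ (image (ν ∘ inL)) (image (ν ∘ inR)) p
  ...   | inj₁ q with ∈-image⁻ (ν ∘ inL) q
  ...     | x , e = inL x , e
  ∈-image⁻ {fork s t} ν y∈ | inj₂ p | inj₂ q with ∈-image⁻ (ν ∘ inR) q
  ...     | x , e = inR x , e

  Full : ∀ {t} → Embedding Q t → Set
  Full ε = ∀ b → src Q b ∈ˢ image (ν ε) → tgt Q b ∈ˢ image (ν ε) → ∃ λ a → b ≡ κ ε a

  full⁻ : ∀ {t} (ε : Embedding Q t) → Full ε → ∀ {b x y} → ν ε x ≡ src Q b → ν ε y ≡ tgt Q b →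
    ∃ λ a → b ≡ κ ε a × srcT a ≡ x × tgtT a ≡ y
  full⁻ ε F {b} {x} {y} p q with F b (subst (_∈ˢ image (ν ε)) p (∈-image⁺ (ν ε) x)) (subst (_∈ˢ image (ν ε)) q (∈-image⁺ (ν ε) y))
  ... | a , refl = a , refl , ν-inj ε (trans (sym (src-κ ε a)) (sym p)) , ν-inj ε (trans (sym (tgt-κ ε a)) (sym q))

  -- Fullness passes to the branches: an arrow with both ends in a branch is none of the newly added
  -- ones, as each of these has an end outside that branch.
  image-isRA : ∀ {t} (ε : Embedding Q t) → Full ε → IsRA Q (image (ν ε)) (ν ε root)
  image-isRA {leaf} ε F = single (ν ε root)
  image-isRA {stem d t} ε F =
    edge (ν ε root) (ν ε (inS root)) refl root∉ (image-isRA (embS ε) F′) (κ ε aS) (ends d refl) cover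
    where
    root∉ : ν ε root ∉ˢ image (ν (embS ε))
    root∉ r with ∈-image⁻ (ν (embS ε)) r
    ... | x , e with () ← ν-inj ε e
    F′ : Full (embS ε)
    F′ b s t with ∈-image⁻ (ν (embS ε)) s | ∈-image⁻ (ν (embS ε)) t
    ... | x , p | y , q with full⁻ ε F p q
    ...   | inS a , e , _ = a , e
    ...   | aS {true} , e , () , _
    ...   | aS {false} , e , _ , ()
    ends : ∀ d′ → d ≡ d′ → (src Q (κ ε aS) ≡ ν ε root × tgt Q (κ ε aS) ≡ ν ε (inS root))
                         ⊎ (src Q (κ ε aS) ≡ ν ε (inS root) × tgt Q (κ ε aS) ≡ ν ε root)
    ends true  refl = inj₁ (src-κ ε aS , tgt-κ ε aS)
    ends false refl = inj₂ (src-κ ε aS , tgt-κ ε aS)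
    cover : ∀ b → src Q b ∈ˢ image (ν ε) → tgt Q b ∈ˢ image (ν ε) →
      (src Q b ∈ˢ image (ν (embS ε)) × tgt Q b ∈ˢ image (ν (embS ε))) ⊎ b ≡ κ ε aS
    cover b s t with F b s t
    ... | aS , e = inj₂ e
    ... | inS a , refl = inj₁ (subst (_∈ˢ image (ν (embS ε))) (sym (src-κ ε (inS a))) (∈-image⁺ (ν (embS ε)) (srcT a))
                              , subst (_∈ˢ image (ν (embS ε))) (sym (tgt-κ ε (inS a))) (∈-image⁺ (ν (embS ε)) (tgtT a)))
  image-isRA {fork t₁ t₂} ε F =
    tri (ν ε root) (ν ε (inL root)) (ν ε (inR root)) refl root∉L root∉R disj
      (image-isRA (embL ε) FL) (image-isRA (embR ε) FR) (κ ε a₁) (κ ε a₂) (κ ε a₃)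
      (src-κ ε a₁) (tgt-κ ε a₁) (src-κ ε a₂) (tgt-κ ε a₂) (src-κ ε a₃) (tgt-κ ε a₃) cover
    where
    root∉L : ν ε root ∉ˢ image (ν (embL ε))
    root∉L r with ∈-image⁻ (ν (embL ε)) r
    ... | x , e with () ← ν-inj ε e
    root∉R : ν ε root ∉ˢ image (ν (embR ε))
    root∉R r with ∈-image⁻ (ν (embR ε)) r
    ... | x , e with () ← ν-inj ε e
    disj : ∀ x → x ∈ˢ image (ν (embL ε)) → x ∉ˢ image (ν (embR ε))
    disj x l r with ∈-image⁻ (ν (embL ε)) l | ∈-image⁻ (ν (embR ε)) r
    ... | y , p | z , q with () ← ν-inj ε (trans p (sym q))
    FL : Full (embL ε)
    FL b s t with ∈-image⁻ (ν (embL ε)) s | ∈-image⁻ (ν (embL ε)) t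
    ... | x , p | y , q with full⁻ ε F p q
    ...   | inL a , e , _ = a , e
    ...   | inR a , e , () , _
    ...   | a₁ , e , () , _
    ...   | a₂ , e , _ , ()
    ...   | a₃ , e , () , _
    FR : Full (embR ε)
    FR b s t with ∈-image⁻ (ν (embR ε)) s | ∈-image⁻ (ν (embR ε)) t
    ... | x , p | y , q with full⁻ ε F p q
    ...   | inR a , e , _ = a , e
    ...   | inL a , e , () , _
    ...   | a₁ , e , () , _
    ...   | a₂ , e , () , _
    ...   | a₃ , e , _ , ()
    cover : ∀ b → src Q b ∈ˢ image (ν ε) → tgt Q b ∈ˢ image (ν ε) →
      (src Q b ∈ˢ image (ν (embL ε)) × tgt Q b ∈ˢ image (ν (embL ε)))
      ⊎ (src Q b ∈ˢ image (ν (embR ε)) × tgt Q b ∈ˢ image (ν (embR ε)))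
      ⊎ b ≡ κ ε a₁ ⊎ b ≡ κ ε a₂ ⊎ b ≡ κ ε a₃
    cover b s t with F b s t
    ... | a₁ , e = inj₂ (inj₂ (inj₁ e))
    ... | a₂ , e = inj₂ (inj₂ (inj₂ (inj₁ e)))
    ... | a₃ , e = inj₂ (inj₂ (inj₂ (inj₂ e)))
    ... | inL a , refl = inj₁ (subst (_∈ˢ image (ν (embL ε))) (sym (src-κ ε (inL a))) (∈-image⁺ (ν (embL ε)) (srcT a))
                              , subst (_∈ˢ image (ν (embL ε))) (sym (tgt-κ ε (inL a))) (∈-image⁺ (ν (embL ε)) (tgtT a)))
    ... | inR a , refl = inj₂ (inj₁ (subst (_∈ˢ image (ν (embR ε))) (sym (src-κ ε (inR a))) (∈-image⁺ (ν (embR ε)) (srcT a))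
                              , subst (_∈ˢ image (ν (embR ε))) (sym (tgt-κ ε (inR a))) (∈-image⁺ (ν (embR ε)) (tgtT a))))

-- The model has its own types of positions, so a realization consists of bijections with them. Two
-- quivers that realize the same `f` are then isomorphic by composition, and a realization can be
-- carried along an isomorphism.
record Real {n} (Q : Quiver n) {ℓ} (f : Fin (suc (suc ℓ)) → Letter) : Set where
  open Model f
  field
    vm     : V ↔ Fin n
    em     : E ↔ Fin (m Q)
    src-ok : ∀ a → src Q (Inverse.to em a) ≡ Inverse.to vm (source a)
    tgt-ok : ∀ a → tgt Q (Inverse.to em a) ≡ Inverse.to vm (target a)

module Realized {n} {Q : Quiver n} {ℓ} {f : Fin (suc (suc ℓ)) → Letter} (R : Real Q f) where
  open Cyclic {ℓ}
  open ModelProperties f public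
  open Real R public

  vt : V → Fin n
  vt = Inverse.to vm
  vf : Fin n → V
  vf = Inverse.from vm
  et : E → Fin (m Q)
  et = Inverse.to em
  ef : Fin (m Q) → E
  ef = Inverse.from em

  vf-vt : ∀ x → vf (vt x) ≡ x
  vf-vt = Inverse.strictlyInverseʳ vm
  vt-vf : ∀ x → vt (vf x) ≡ x
  vt-vf = Inverse.strictlyInverseˡ vm
  ef-et : ∀ x → ef (et x) ≡ x
  ef-et = Inverse.strictlyInverseʳ em
  et-ef : ∀ x → et (ef x) ≡ x
  et-ef = Inverse.strictlyInverseˡ em

  vt-inj : ∀ {x y} → vt x ≡ vt y → x ≡ y
  vt-inj {x} {y} e = trans (sym (vf-vt x)) (trans (cong vf e) (vf-vt y))
  vf-inj : ∀ {x y} → vf x ≡ vf y → x ≡ y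
  vf-inj {x} {y} e = trans (sym (vt-vf x)) (trans (cong vt e) (vt-vf y))
  et-inj : ∀ {x y} → et x ≡ et y → x ≡ y
  et-inj {x} {y} e = trans (sym (ef-et x)) (trans (cong ef e) (ef-et y))
  ef-inj : ∀ {x y} → ef x ≡ ef y → x ≡ y
  ef-inj {x} {y} e = trans (sym (et-ef x)) (trans (cong et e) (et-ef y))

  source-ef : ∀ a → source (ef a) ≡ vf (src Q a)
  source-ef a = trans (sym (vf-vt _)) (cong vf (trans (sym (src-ok (ef a))) (cong (src Q) (et-ef a))))
  target-ef : ∀ a → target (ef a) ≡ vf (tgt Q a)
  target-ef a = trans (sym (vf-vt _)) (cong vf (trans (sym (tgt-ok (ef a))) (cong (tgt Q) (et-ef a))))

  bv : Fin k′ → Fin n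
  bv i = vt (i , bs)
  be : Fin k′ → Fin (m Q)
  be i = et (i , ba)

  embed : ∀ i {t} → shape (f i) ≡ just t → Embedding Q t
  embed i p = record
    { ν = λ x → vt (i , nd p x) ; κ = λ a → et (i , sub p a) ; ν-inj = λ e → nd-inj (vt-inj e)
    ; src-κ = λ a → src-ok (i , sub p a) ; tgt-κ = λ a → tgt-ok (i , sub p a) }
    where
    nd-inj : ∀ {x y} → _≡_ {A = V} (i , nd p x) (i , nd p y) → x ≡ y
    nd-inj e with refl , refl , e′ ← nd-injective e = e′

  base-link-Q : ∀ i → (src Q (be i) ≡ bv i × tgt Q (be i) ≡ bv (nxt i))
                    ⊎ (src Q (be i) ≡ bv (nxt i) × tgt Q (be i) ≡ bv i)
  base-link-Q i with dir (f i) | src-ok (i , ba) | tgt-ok (i , ba)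
  ... | true  | s | t = inj₁ (s , t)
  ... | false | s | t = inj₂ (s , t)

  base-reach : ∀ i → Reach Q (bv zero) (bv i)
  base-reach = nxt-induction (λ i → Reach Q (bv zero) (bv i)) zero here step
    where
    step : ∀ i → Reach Q (bv zero) (bv i) → Reach Q (bv zero) (bv (nxt i))
    step i p with base-link-Q i
    ... | inj₁ (s , t) = reach-trans p (reach-arrow (be i) s t)
    ... | inj₂ (s , t) = reach-trans p (reach-sym (reach-arrow (be i) s t))

  all-reach : ∀ x → Reach Q (bv zero) (vt x)
  all-reach (i , bs)     = base-reach i
  all-reach (i , nd p x) = reach-trans (base-reach (yEnd i))
    (reach-trans (reach-arrow (et (i , ent p)) (src-ok _) (tgt-ok _)) (reach-root (embed i p) x))

  module _ (no₂ : NonOriented f) where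
    valid′ : Valid Q
    valid′ = record
      { noLoops   = λ a e → source≢target (ef a) (trans (source-ef a) (trans (cong vf e) (sym (target-ef a))))
      ; no2Cycles = λ a b s t → antiparallel no₂ (ef a) (ef b)
                      (trans (source-ef a) (trans (cong vf s) (sym (target-ef b))))
                      (trans (target-ef a) (trans (cong vf t) (sym (source-ef b))))
      ; connected = λ x y → subst₂ (Reach Q) (vt-vf x) (vt-vf y)
                      (reach-trans (reach-sym (all-reach (vf x))) (all-reach (vf y))) }

    cycle : NCycle Q
    cycle = record
      { ℓ = ℓ ; v = bv ; e = be
      ; v-inj = λ i j e → bs-injective (vt-inj e)
      ; e-inj = λ i j e → cong proj₁ (et-inj e)
      ; e-link = base-link-Q
      ; full = λ a (i , s) (j , t) → isB a (ends-onBase (ef a)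
                 (i , trans (source-ef a) (trans (cong vf (sym s)) (vf-vt _)))
                 (j , trans (target-ef a) (trans (cong vf (sym t)) (vf-vt _))))
      ; nonOriented = forward (proj₁ no₂) , backward (proj₂ no₂) }
      where
      isB : ∀ a → IsBase (ef a) → ∃ λ i → a ≡ be i
      isB a (i , e) = i , trans (sym (et-ef a)) (cong et e)
      forward : (∃ λ i → dir (f i) ≡ true) → ∃ λ i → src Q (be i) ≡ bv i
      forward (i , d) = i , trans (src-ok (i , ba)) (cong (λ b → vt ((if b then i else nxt i) , bs)) d)
      backward : (∃ λ i → dir (f i) ≡ false) → ∃ λ i → src Q (be i) ≡ bv (nxt i)
      backward (i , d) = i , trans (src-ok (i , ba)) (cong (λ b → vt ((if b then i else nxt i) , bs)) d)

  module AnyCycle (Γ : NCycle Q) where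
    private
      v′ : Fin (k Γ) → V
      v′ i = vf (v Γ i)
      e′ : Fin (k Γ) → E
      e′ i = ef (e Γ i)
      l′ : ∀ i → Link (e′ i) (v′ i) (v′ (nxt i))
      l′ i with e-link Γ i
      ... | inj₁ (s , t) = inj₁ (trans (source-ef _) (cong vf s) , trans (target-ef _) (cong vf t))
      ... | inj₂ (s , t) = inj₂ (trans (source-ef _) (cong vf s) , trans (target-ef _) (cong vf t))
      f′ : ∀ a → (∃ λ i → v′ i ≡ source a) → (∃ λ j → v′ j ≡ target a) → ∃ λ i → a ≡ e′ i
      f′ a (i , s) (j , t) with full Γ (et a) (i , trans (sym (vt-vf _)) (trans (cong vt s) (sym (src-ok a))))
                                             (j , trans (sym (vt-vf _)) (trans (cong vt t) (sym (tgt-ok a))))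
      ... | h , e = h , trans (sym (ef-et a)) (cong ef e)
      n′ : (∃ λ i → source (e′ i) ≡ v′ i) × (∃ λ j → source (e′ j) ≡ v′ (nxt j))
      n′ with nonOriented Γ
      ... | (i , s) , (j , t) = (i , trans (source-ef _) (cong vf s)) , (j , trans (source-ef _) (cong vf t))
      vi : ∀ i j → v′ i ≡ v′ j → i ≡ j
      vi i j e = v-inj Γ i j (vf-inj e)
      ei : ∀ i j → e′ i ≡ e′ j → i ≡ j
      ei i j e = e-inj Γ i j (ef-inj e)

    abstract
      -- The argument at a vertex of maximal rank, transported from the model to `Q`. It applies to
      -- any non-oriented cycle of `Q`, which makes the cycle unique as a set of vertices.
      on-base : ∀ i → ∃ λ b → v Γ i ≡ bv b
      on-base i = map₂ back (all-onBase v′ e′ vi ei l′ f′ n′ i)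
        where
        back : ∀ {b} → v′ i ≡ (b , bs) → v Γ i ≡ bv b
        back eq = trans (sym (vt-vf (v Γ i))) (cong vt eq)

      covers : ∀ b → ∃ λ j → v Γ j ≡ bv b
      covers b = map₂ back (base-covered v′ e′ vi ei l′ f′ n′ b)
        where
        back : ∀ {j} → v′ j ≡ (b , bs) → v Γ j ≡ bv b
        back {j} eq = trans (sym (vt-vf (v Γ j))) (cong vt eq)

  unique-cycle : ∀ (Γ Γ′ : NCycle Q) → ∀ i → ∃ λ j → v Γ′ j ≡ v Γ i
  unique-cycle Γ Γ′ i = map₂ (λ eq → trans eq (sym (proj₂ (AnyCycle.on-base Γ i))))
    (AnyCycle.covers Γ′ (proj₁ (AnyCycle.on-base Γ i)))

  -- The shape is passed as a variable `o` with an equation, so that it can be matched on while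
  -- `f i` stays in place in the types.
  attAt : ∀ i o → shape (f i) ≡ o → Maybe (Triple n (m Q))
  attAt i nothing  _ = nothing
  attAt i (just t) p = just (vt (i , nd p root) , et (i , ent p) , et (i , ext p))

  treeAt : ∀ i o → shape (f i) ≡ o → Subset n
  treeAt i nothing  _ = ∅
  treeAt i (just t) p = image {Q = Q} (ν (embed i p))

  attAt-just : ∀ i {t} (p : shape (f i) ≡ just t) o q →
    attAt i o q ≡ just (vt (i , nd p root) , et (i , ent p) , et (i , ext p))
  attAt-just i p nothing q with () ← trans (sym q) p
  attAt-just i p (just t) q with refl ← just-injective (trans (sym q) p) rewrite uip p q = refl

  attAt-inv : ∀ i o q {z b c} → attAt i o q ≡ just (z , b , c) →
    Σ Shape λ t → Σ (shape (f i) ≡ just t) λ p →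
      (vt (i , nd p root) , et (i , ent p) , et (i , ext p)) ≡ (z , b , c)
        × treeAt i o q ≡ image {Q = Q} (ν (embed i p))
  attAt-inv i (just t) q refl = t , q , refl , refl

  ∈-treeAt⁻ : ∀ i o q {x} → x ∈ˢ treeAt i o q →
    Σ Shape λ t → Σ (shape (f i) ≡ just t) λ p → ∃ λ y → x ≡ vt (i , nd p y)
  ∈-treeAt⁻ i nothing q x∈ = ⊥-elim (∉⊥ x∈)
  ∈-treeAt⁻ i (just t) q x∈ with ∈-image⁻ {Q = Q} (ν (embed i q)) x∈
  ... | y , e = t , q , y , sym e

  ∈-treeAt⁺ : ∀ i o q {t} (p : shape (f i) ≡ just t) y → vt (i , nd p y) ∈ˢ treeAt i o q
  ∈-treeAt⁺ i nothing q p y with () ← trans (sym q) p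
  ∈-treeAt⁺ i (just t) q p y with refl ← just-injective (trans (sym q) p) rewrite uip p q =
    ∈-image⁺ {Q = Q} (ν (embed i q)) y

  embed-full : ∀ i {t} (p : shape (f i) ≡ just t) → Full (embed i p)
  embed-full i p b s t with ∈-image⁻ {Q = Q} (ν (embed i p)) s | ∈-image⁻ {Q = Q} (ν (embed i p)) t
  ... | x , ex | y , ey = go (ef b) refl (trans (source-ef b) (trans (cong vf (sym ex)) (vf-vt _)))
                                         (trans (target-ef b) (trans (cong vf (sym ey)) (vf-vt _)))
    where
    go : ∀ a → ef b ≡ a → source (ef b) ≡ (i , nd p x) → target (ef b) ≡ (i , nd p y) → ∃ λ a → b ≡ et (i , sub p a)
    go (j , ba) eq s t with () ← trans (cong source (sym eq)) s
    go (j , ent q) eq s t with () ← trans (cong source (sym eq)) s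
    go (j , ext q) eq s t with () ← trans (cong target (sym eq)) t
    go (j , sub q a) eq s t with refl , refl , _ ← nd-injective (trans (cong source (sym eq)) s) rewrite uip q p =
      a , trans (sym (et-ef b)) (cong et eq)

  module _ (no₂ : NonOriented f) where
    attachment : Attach Q (cycle no₂)
    attachment = record
      { att = λ i → attAt i _ refl
      ; att-ok = ok
      ; incident = inc
      ; tree = λ i → treeAt i _ refl
      ; tree-RA = ra
      ; tree-none = λ i → none i _ refl
      ; tree-off = off
      ; tree-disj = disj
      ; tree-cover = cover
      ; tree-sep = sep }
      where
      ok : ∀ i z b c → attAt i _ refl ≡ just (z , b , c) →
           src Q b ≡ tgt Q (be i) × tgt Q b ≡ z × src Q c ≡ z × tgt Q c ≡ src Q (be i)
      ok i z b c eq with attAt-inv i _ refl eq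
      ... | t , p , refl , _ = trans (src-ok _) (sym (tgt-ok _)) , tgt-ok _ , src-ok _ , trans (tgt-ok _) (sym (src-ok _))
      inc : ∀ a → (OnCycle (cycle no₂) (src Q a) ⊎ OnCycle (cycle no₂) (tgt Q a)) →
            (∃ λ i → a ≡ be i) ⊎
            (∃ λ i → Σ (Fin n) λ z → Σ (Fin (m Q)) λ b → Σ (Fin (m Q)) λ c →
               attAt i _ refl ≡ just (z , b , c) × (a ≡ b ⊎ a ≡ c))
      inc a o with ef a in eq
      ... | i , ba = inj₁ (i , trans (sym (et-ef a)) (cong et eq))
      ... | i , ent p = inj₂ (i , _ , _ , _ , attAt-just i p _ refl , inj₁ (trans (sym (et-ef a)) (cong et eq)))
      ... | i , ext p = inj₂ (i , _ , _ , _ , attAt-just i p _ refl , inj₂ (trans (sym (et-ef a)) (cong et eq)))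
      inc a (inj₁ (j , o)) | i , sub p x
        with () ← trans (trans (cong source (sym eq)) (source-ef a)) (trans (cong vf (sym o)) (vf-vt (j , bs)))
      inc a (inj₂ (j , o)) | i , sub p x
        with () ← trans (trans (cong target (sym eq)) (target-ef a)) (trans (cong vf (sym o)) (vf-vt (j , bs)))
      ra : ∀ i z b c → attAt i _ refl ≡ just (z , b , c) → IsRA Q (treeAt i _ refl) z
      ra i z b c eq with attAt-inv i _ refl eq
      ... | t , p , refl , e = subst (λ S → IsRA Q S z) (sym e) (image-isRA (embed i p) (embed-full i p))
      none : ∀ i o q → attAt i o q ≡ nothing → treeAt i o q ≡ ∅
      none i nothing q _ = refl
      off : ∀ i x → x ∈ˢ treeAt i _ refl → ¬ OnCycle (cycle no₂) x
      off i x x∈ (j , e) with ∈-treeAt⁻ i _ refl x∈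
      ... | t , p , y , e′ with () ← vt-inj (trans e e′)
      disj : ∀ i j x → x ∈ˢ treeAt i _ refl → x ∈ˢ treeAt j _ refl → i ≡ j
      disj i j x x∈ x∈′ with ∈-treeAt⁻ i _ refl x∈ | ∈-treeAt⁻ j _ refl x∈′
      ... | t , p , y , e | t′ , p′ , y′ , e′ = cong proj₁ (vt-inj (trans (sym e) e′))
      cover : ∀ x → ¬ OnCycle (cycle no₂) x → ∃ λ i → x ∈ˢ treeAt i _ refl
      cover x ¬o with vf x in eq
      ... | i , bs = ⊥-elim (¬o (i , trans (cong vt (sym eq)) (vt-vf x)))
      ... | i , nd p y = i , subst (_∈ˢ treeAt i _ refl) (trans (cong vt (sym eq)) (vt-vf x)) (∈-treeAt⁺ i _ refl p y)
      sep : ∀ a i j → src Q a ∈ˢ treeAt i _ refl → tgt Q a ∈ˢ treeAt j _ refl → i ≡ j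
      sep a i j s t with ∈-treeAt⁻ i _ refl s | ∈-treeAt⁻ j _ refl t
      ... | _ , p , y , e | _ , p′ , y′ , e′ =
        go (ef a) (trans (source-ef a) (trans (cong vf e) (vf-vt _))) (trans (target-ef a) (trans (cong vf e′) (vf-vt _)))
        where
        go : ∀ α → source α ≡ (i , nd p y) → target α ≡ (j , nd p′ y′) → i ≡ j
        go (h , ba) () _
        go (h , ent _) () _
        go (h , ext _) _ ()
        go (h , sub _ _) s t = trans (sym (cong proj₁ s)) (cong proj₁ t)

    inQ : InQ Q
    inQ = record { valid = valid′ no₂ ; cyc = cycle no₂ ; attach = attachment ; uniqueCyc = unique-cycle }

-- Isomorphisms, rotations and reflections of realizations

flip : Letter → Letter
flip (d , o) = not d , o

Real-≅ : ∀ {n} {Q Q′ : Quiver n} {ℓ} {f : Fin (suc (suc ℓ)) → Letter} → Real Q f → Real Q′ f → Q ≅ Q′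
Real-≅ {Q = Q} {Q′} R R′ = record
  { vmap = Real.vm R′ ↔-∘ ↔-sym (Real.vm R)
  ; amap = Real.em R′ ↔-∘ ↔-sym (Real.em R)
  ; src-pres = λ a → trans (Real.src-ok R′ (A.ef a)) (cong B.vt (A.source-ef a))
  ; tgt-pres = λ a → trans (Real.tgt-ok R′ (A.ef a)) (cong B.vt (A.target-ef a)) }
  where
  module A = Realized R
  module B = Realized R′

≅-Real : ∀ {n} {Q Q′ : Quiver n} {ℓ} {f : Fin (suc (suc ℓ)) → Letter} → Q ≅ Q′ → Real Q f → Real Q′ f
≅-Real I R = record
  { vm = _≅_.vmap I ↔-∘ Real.vm R
  ; em = _≅_.amap I ↔-∘ Real.em R
  ; src-ok = λ a → trans (_≅_.src-pres I _) (cong (Inverse.to (_≅_.vmap I)) (Real.src-ok R a))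
  ; tgt-ok = λ a → trans (_≅_.tgt-pres I _) (cong (Inverse.to (_≅_.vmap I)) (Real.tgt-ok R a)) }

-- Maps between models induced by a relabelling of the base vertices (σ) and of the base
-- arrows together with what is attached to them (π).
module Relabel {ℓ} (f g : Fin (suc (suc ℓ)) → Letter)
  (σ π : Fin (suc (suc ℓ)) → Fin (suc (suc ℓ))) (same : ∀ i → shape (f (π i)) ≡ shape (g i)) where
  private
    module F = Model f
    module G = Model g

  mapV : G.V → F.V
  mapV (i , bs)     = σ i , bs
  mapV (i , nd p x) = π i , nd (trans (same i) p) x

  mapE : G.E → F.E
  mapE (i , ba)      = π i , ba
  mapE (i , ent p)   = π i , ent (trans (same i) p)
  mapE (i , ext p)   = π i , ext (trans (same i) p)
  mapE (i , sub p a) = π i , sub (trans (same i) p) a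

  module _ (x-ok : ∀ i → F.xEnd (π i) ≡ σ (G.xEnd i)) (y-ok : ∀ i → F.yEnd (π i) ≡ σ (G.yEnd i)) where
    source-map : ∀ a → F.source (mapE a) ≡ mapV (G.source a)
    source-map (i , ba)      = cong (_, bs) (x-ok i)
    source-map (i , ent p)   = cong (_, bs) (y-ok i)
    source-map (i , ext p)   = refl
    source-map (i , sub p a) = refl

    target-map : ∀ a → F.target (mapE a) ≡ mapV (G.target a)
    target-map (i , ba)      = cong (_, bs) (y-ok i)
    target-map (i , ent p)   = refl
    target-map (i , ext p)   = cong (_, bs) (x-ok i)
    target-map (i , sub p a) = refl

module _ {ℓ} (f g : Fin (suc (suc ℓ)) → Letter)
  (σ π σ⁻ π⁻ : Fin (suc (suc ℓ)) → Fin (suc (suc ℓ)))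
  (same : ∀ i → shape (f (π i)) ≡ shape (g i)) (same⁻ : ∀ i → shape (g (π⁻ i)) ≡ shape (f i))
  (σσ⁻ : ∀ i → σ (σ⁻ i) ≡ i) (ππ⁻ : ∀ i → π (π⁻ i) ≡ i) where
  private
    module A = Relabel f g σ π same
    module B = Relabel g f σ⁻ π⁻ same⁻
    module F = Model f

    nd-cong : ∀ {i j t} {p : shape (f i) ≡ just t} {q : shape (f j) ≡ just t} {x} → i ≡ j →
      _≡_ {A = F.V} (i , nd p x) (j , nd q x)
    nd-cong {p = p} {q} refl rewrite uip p q = refl
    ent-cong : ∀ {i j t} {p : shape (f i) ≡ just t} {q : shape (f j) ≡ just t} → i ≡ j →
      _≡_ {A = F.E} (i , ent p) (j , ent q)
    ent-cong {p = p} {q} refl rewrite uip p q = refl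
    ext-cong : ∀ {i j t} {p : shape (f i) ≡ just t} {q : shape (f j) ≡ just t} → i ≡ j →
      _≡_ {A = F.E} (i , ext p) (j , ext q)
    ext-cong {p = p} {q} refl rewrite uip p q = refl
    sub-cong : ∀ {i j t} {p : shape (f i) ≡ just t} {q : shape (f j) ≡ just t} {a} → i ≡ j →
      _≡_ {A = F.E} (i , sub p a) (j , sub q a)
    sub-cong {p = p} {q} refl rewrite uip p q = refl

  mapV-mapV : ∀ x → A.mapV (B.mapV x) ≡ x
  mapV-mapV (i , bs)     = cong (_, bs) (σσ⁻ i)
  mapV-mapV (i , nd p x) = nd-cong (ππ⁻ i)

  mapE-mapE : ∀ a → A.mapE (B.mapE a) ≡ a
  mapE-mapE (i , ba)      = cong (_, ba) (ππ⁻ i)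
  mapE-mapE (i , ent p)   = ent-cong (ππ⁻ i)
  mapE-mapE (i , ext p)   = ext-cong (ππ⁻ i)
  mapE-mapE (i , sub p a) = sub-cong (ππ⁻ i)

module _ {n} {Q : Quiver n} {ℓ} {f : Fin (suc (suc ℓ)) → Letter} (R : Real Q f) where
  open Cyclic {ℓ}

  rotate : ∀ (g : Fin k′ → Letter) c → (∀ i → f (i ⊕ c) ≡ g i) → Real Q g
  rotate g c eq = record
    { vm = Real.vm R ↔-∘ mk↔ₛ′ A.mapV B.mapV
             (mapV-mapV f g π π π⁻ π⁻ same same⁻ ππ⁻ ππ⁻)
             (mapV-mapV g f π⁻ π⁻ π π same⁻ same π⁻π π⁻π)
    ; em = Real.em R ↔-∘ mk↔ₛ′ A.mapE B.mapE
             (mapE-mapE f g π π π⁻ π⁻ same same⁻ ππ⁻ ππ⁻)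
             (mapE-mapE g f π⁻ π⁻ π π same⁻ same π⁻π π⁻π)
    ; src-ok = λ a → trans (Real.src-ok R _) (cong (Inverse.to (Real.vm R)) (A.source-map x-ok y-ok a))
    ; tgt-ok = λ a → trans (Real.tgt-ok R _) (cong (Inverse.to (Real.vm R)) (A.target-map x-ok y-ok a)) }
    where
    π π⁻ : Fin k′ → Fin k′
    π i = i ⊕ c
    π⁻ i = i ⊕ (c * suc ℓ)
    ππ⁻ : ∀ i → π (π⁻ i) ≡ i
    ππ⁻ i = ⊕-inverse′ i c
    π⁻π : ∀ i → π⁻ (π i) ≡ i
    π⁻π i = ⊕-inverse i c
    same : ∀ i → shape (f (π i)) ≡ shape (g i)
    same i = cong shape (eq i)
    same⁻ : ∀ i → shape (g (π⁻ i)) ≡ shape (f i)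
    same⁻ i = cong shape (trans (sym (eq (π⁻ i))) (cong f (ππ⁻ i)))
    module A = Relabel f g π π same
    module B = Relabel g f π⁻ π⁻ same⁻
    x-ok : ∀ i → Model.xEnd f (π i) ≡ π (Model.xEnd g i)
    x-ok i rewrite eq i with dir (g i)
    ... | true  = refl
    ... | false = nxt-⊕ i c
    y-ok : ∀ i → Model.yEnd f (π i) ≡ π (Model.yEnd g i)
    y-ok i rewrite eq i with dir (g i)
    ... | true  = nxt-⊕ i c
    ... | false = refl

  -- The reflection moves base vertices by `revV c`, and base arrows with what hangs on them by
  -- `revE c`. It reverses the cyclic order, and the flip of directions in `eq` is what makes it
  -- respect sources and targets.
  symmetric : NonOriented f → (c : Fin k′) → (∀ i → f (revE c i) ≡ flip (f i)) → Symmetric Q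
  symmetric no₂ c eq = record
    { cyc = cycle no₂ ; attach = attachment no₂
    ; aut = record
        { vmap = vm ↔-∘ (mk↔ₛ′ M.mapV M.mapV invV invV ↔-∘ ↔-sym vm)
        ; amap = em ↔-∘ (mk↔ₛ′ M.mapE M.mapE invE invE ↔-∘ ↔-sym em)
        ; src-pres = λ a → trans (src-ok _) (cong vt (trans (M.source-map x-ok y-ok _) (cong M.mapV (source-ef a))))
        ; tgt-pres = λ a → trans (tgt-ok _) (cong vt (trans (M.target-map x-ok y-ok _) (cong M.mapV (target-ef a)))) }
    ; shift = c
    ; rev-v = λ i → cong (vt ∘ M.mapV) (vf-vt (i , bs))
    ; rev-e = λ i → cong (et ∘ M.mapE) (ef-et (i , ba))
    ; rev-att = λ i → rev i _ refl }
    where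
    open Realized R
    same : ∀ i → shape (f (revE c i)) ≡ shape (f i)
    same i = cong shape (eq i)
    module M = Relabel f f (revV c) (revE c) same
    invV = mapV-mapV f f (revV c) (revE c) (revV c) (revE c) same same (revV-involutive c) (revE-involutive c)
    invE = mapE-mapE f f (revV c) (revE c) (revV c) (revE c) same same (revV-involutive c) (revE-involutive c)
    x-ok : ∀ i → xEnd (revE c i) ≡ revV c (xEnd i)
    x-ok i rewrite eq i with dir (f i)
    ... | true  = nxt-revE c i
    ... | false = sym (revV-nxt c i)
    y-ok : ∀ i → yEnd (revE c i) ≡ revV c (yEnd i)
    y-ok i rewrite eq i with dir (f i)
    ... | true  = sym (revV-nxt c i)
    ... | false = nxt-revE c i
    rev : ∀ i o q → attAt (revE c i) (shape (f (revE c i))) refl ≡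
      mapMaybe (λ t → vt (M.mapV (vf (proj₁ t))) , et (M.mapE (ef (proj₁ (proj₂ t)))) , et (M.mapE (ef (proj₂ (proj₂ t)))))
               (attAt i o q)
    rev i nothing q = none _ refl
      where
      none : ∀ o p → attAt (revE c i) o p ≡ nothing
      none nothing p = refl
      none (just t) p with () ← trans (sym p) (trans (same i) q)
    rev i (just t) q = trans (attAt-just (revE c i) (trans (same i) q) _ refl)
      (cong just (cong₂ _,_ (cong (vt ∘ M.mapV) (sym (vf-vt (i , nd q root))))
        (cong₂ _,_ (cong (et ∘ M.mapE) (sym (ef-et (i , ent q)))) (cong (et ∘ M.mapE) (sym (ef-et (i , ext q)))))))

-- Uniqueness of the letters

Incident : ∀ {n} (Q : Quiver n) → Fin (m Q) → Fin n → Set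
Incident Q a x = src Q a ≡ x ⊎ tgt Q a ≡ x

-- `At Q p q x t`: entering x through p and q (p ≡ q is allowed), the quiver looks locally
-- like the rooted quiver of shape t.  No vertex sets are involved, so that the relation is
-- visibly invariant under isomorphism.
data At {n} (Q : Quiver n) (p q : Fin (m Q)) (x : Fin n) : Shape → Set where
  leafᴬ : (∀ a → Incident Q a x → a ≡ p ⊎ a ≡ q) → At Q p q x leaf
  stemᴬ : ∀ {d t} a w →
    (if d then src Q a else tgt Q a) ≡ x → (if d then tgt Q a else src Q a) ≡ w →
    a ≢ p → a ≢ q →
    (∀ b → Incident Q b x → (b ≡ p ⊎ b ≡ q) ⊎ b ≡ a) →
    At Q a a w t → At Q p q x (stem d t)
  forkᴬ : ∀ {t₁ t₂} b₁ b₂ b₃ u w →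
    src Q b₁ ≡ x → tgt Q b₁ ≡ u → src Q b₂ ≡ u → tgt Q b₂ ≡ w → src Q b₃ ≡ w → tgt Q b₃ ≡ x →
    b₁ ≢ p → b₁ ≢ q → b₃ ≢ p → b₃ ≢ q →
    (∀ b → Incident Q b x → (b ≡ p ⊎ b ≡ q) ⊎ (b ≡ b₁ ⊎ b ≡ b₃)) →
    (∀ b → src Q b ≡ u → tgt Q b ≡ w → b ≡ b₂) →
    At Q b₁ b₂ u t₁ → At Q b₂ b₃ w t₂ → At Q p q x (fork t₁ t₂)

module _ {n} {Q : Quiver n} (noLoop : ∀ a → src Q a ≢ tgt Q a) where
  private
    old : ∀ {p q a : Fin (m Q)} → a ≡ p ⊎ a ≡ q → a ≢ p → a ≢ q → ⊥
    old (inj₁ e) np nq = np e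
    old (inj₂ e) np nq = nq e

    new : ∀ {p q a : Fin (m Q)} {B : Set} → (a ≡ p ⊎ a ≡ q) ⊎ B → a ≢ p → a ≢ q → B
    new (inj₁ o) np nq = ⊥-elim (old o np nq)
    new (inj₂ b) _ _ = b

    stem-incident : ∀ {x a} d → (if d then src Q a else tgt Q a) ≡ x → Incident Q a x
    stem-incident true  e = inj₁ e
    stem-incident false e = inj₂ e

  -- The arrows at `x` other than `p` and `q` decide the constructor: none, one, or one leaving and
  -- one arriving. Directions then fix the role of each arrow, and the uniqueness clause of `forkᴬ`
  -- fixes `b₂`, so that the branches are entered through the same arrows.
  At-functional : ∀ {p q x t t′} → At Q p q x t → At Q p q x t′ → t ≡ t′
  At-functional (leafᴬ _) (leafᴬ _) = refl
  At-functional (leafᴬ c) (stemᴬ {d} a w s t np nq _ _) = ⊥-elim (old (c a (stem-incident d s)) np nq)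
  At-functional (leafᴬ c) (forkᴬ b₁ _ _ _ _ s _ _ _ _ _ np nq _ _ _ _ _ _) = ⊥-elim (old (c b₁ (inj₁ s)) np nq)
  At-functional (stemᴬ {d} a w s t np nq _ _) (leafᴬ c) = ⊥-elim (old (c a (stem-incident d s)) np nq)
  At-functional (forkᴬ b₁ _ _ _ _ s _ _ _ _ _ np nq _ _ _ _ _ _) (leafᴬ c) = ⊥-elim (old (c b₁ (inj₁ s)) np nq)
  At-functional (stemᴬ {d} a w s t np nq c A) (stemᴬ {d′} a′ w′ s′ t′ np′ nq′ c′ A′)
    with refl ← new (c′ a (stem-incident d s)) np nq with d | d′
  ... | true  | true  with refl ← trans (sym t) t′ = cong (stem true) (At-functional A A′)
  ... | false | false with refl ← trans (sym t) t′ = cong (stem false) (At-functional A A′)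
  ... | true  | false = ⊥-elim (noLoop a (trans s (sym s′)))
  ... | false | true  = ⊥-elim (noLoop a (trans s′ (sym s)))
  At-functional (stemᴬ a w s t np nq c A) (forkᴬ b₁ _ b₃ _ _ s₁ _ _ _ _ t₃ n₁ n₂ n₃ n₄ _ _ _ _)
    with refl ← new (c b₁ (inj₁ s₁)) n₁ n₂ with refl ← new (c b₃ (inj₂ t₃)) n₃ n₄ = ⊥-elim (noLoop b₁ (trans s₁ (sym t₃)))
  At-functional (forkᴬ b₁ _ b₃ _ _ s₁ _ _ _ _ t₃ n₁ n₂ n₃ n₄ _ _ _ _) (stemᴬ a w s t np nq c A)
    with refl ← new (c b₁ (inj₁ s₁)) n₁ n₂ with refl ← new (c b₃ (inj₂ t₃)) n₃ n₄ = ⊥-elim (noLoop b₁ (trans s₁ (sym t₃)))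
  At-functional (forkᴬ b₁ b₂ b₃ u w s₁ t₁ s₂ t₂ s₃ t₃ n₁ n₂ n₃ n₄ c o A B)
                (forkᴬ b₁′ b₂′ b₃′ u′ w′ s₁′ t₁′ s₂′ t₂′ s₃′ t₃′ n₁′ n₂′ n₃′ n₄′ c′ o′ A′ B′)
    with new (c′ b₁ (inj₁ s₁)) n₁ n₂ | new (c′ b₃ (inj₂ t₃)) n₃ n₄
  ... | inj₂ refl | _ = ⊥-elim (noLoop b₁ (trans s₁ (sym t₃′)))
  ... | inj₁ _ | inj₁ refl = ⊥-elim (noLoop b₃ (trans s₁′ (sym t₃)))
  ... | inj₁ refl | inj₂ refl with refl ← trans (sym t₁) t₁′ with refl ← trans (sym s₃) s₃′
    with refl ← o′ b₂ s₂ t₂ = cong₂ fork (At-functional A A′) (At-functional B B′)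

module _ {n} {Q : Quiver n} where
  IncidentT : ∀ {t} → Arrow t → Node t → Set
  IncidentT a x = srcT a ≡ x ⊎ tgtT a ≡ x

  Closed : ∀ {t} → Embedding Q t → Fin (m Q) → Fin (m Q) → Set
  Closed ε p q = ∀ x a → Incident Q a (ν ε x) →
    (∃ λ b → a ≡ κ ε b × IncidentT b x) ⊎ (x ≡ root × (a ≡ p ⊎ a ≡ q))

  incident⁻ : ∀ {t} (ε : Embedding Q t) {b x} → Incident Q (κ ε b) (ν ε x) → IncidentT b x
  incident⁻ ε {b} (inj₁ e) = inj₁ (ν-inj ε (trans (sym (src-κ ε b)) e))
  incident⁻ ε {b} (inj₂ e) = inj₂ (ν-inj ε (trans (sym (tgt-κ ε b)) e))

  -- Closedness passes to a branch, with the arrows at its root that come from outside as the new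
  -- `p` and `q`: the stem taken twice, or two sides of the triangle.
  embedding-At : ∀ {t} (ε : Embedding Q t) {p q} → Closed ε p q →
    (∀ a → κ ε a ≢ p) → (∀ a → κ ε a ≢ q) → At Q p q (ν ε root) t
  embedding-At {leaf} ε Γ np nq = leafᴬ go
    where
    go : ∀ a → Incident Q a (ν ε root) → _
    go a i with Γ root a i
    ... | inj₁ (() , _)
    ... | inj₂ (_ , o) = o
  embedding-At {stem d t} ε {p} {q} Γ np nq =
    stemᴬ (κ ε aS) (ν ε (inS root)) (s d refl) (w d refl) (np aS) (nq aS) go
      (embedding-At (embS ε) Γ′ (λ a e → distinct a e) (λ a e → distinct a e))
    where
    s : ∀ d′ → d ≡ d′ → (if d then src Q (κ ε aS) else tgt Q (κ ε aS)) ≡ ν ε root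
    s true  refl = src-κ ε aS
    s false refl = tgt-κ ε aS
    w : ∀ d′ → d ≡ d′ → (if d then tgt Q (κ ε aS) else src Q (κ ε aS)) ≡ ν ε (inS root)
    w true  refl = tgt-κ ε aS
    w false refl = src-κ ε aS
    go : ∀ a → Incident Q a (ν ε root) → (a ≡ p ⊎ a ≡ q) ⊎ a ≡ κ ε aS
    go a i with Γ root a i
    ... | inj₁ (aS , e , _) = inj₂ e
    ... | inj₁ (inS b , e , inj₁ ())
    ... | inj₁ (inS b , e , inj₂ ())
    ... | inj₂ (_ , o) = inj₁ o
    distinct : ∀ a → κ ε (inS a) ≢ κ ε aS
    distinct a e with incident⁻ ε {inS a} {root} (subst (λ b → Incident Q b (ν ε root)) (sym e) (inc d refl))
      where
      inc : ∀ d′ → d ≡ d′ → Incident Q (κ ε aS) (ν ε root)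
      inc true  refl = inj₁ (src-κ ε aS)
      inc false refl = inj₂ (tgt-κ ε aS)
    ... | inj₁ ()
    ... | inj₂ ()
    Γ′ : Closed (embS ε) (κ ε aS) (κ ε aS)
    Γ′ x a i with Γ (inS x) a i
    ... | inj₁ (inS b , e , inj₁ j) = inj₁ (b , e , inj₁ (inS-injective j))
    ... | inj₁ (inS b , e , inj₂ j) = inj₁ (b , e , inj₂ (inS-injective j))
    ... | inj₁ (aS {true} , e , inj₂ refl) = inj₂ (refl , inj₁ e)
    ... | inj₁ (aS {false} , e , inj₁ refl) = inj₂ (refl , inj₁ e)
    ... | inj₂ (() , _)
  embedding-At {fork t₁ t₂} ε {p} {q} Γ np nq =
    forkᴬ (κ ε a₁) (κ ε a₂) (κ ε a₃) (ν ε (inL root)) (ν ε (inR root))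
      (src-κ ε a₁) (tgt-κ ε a₁) (src-κ ε a₂) (tgt-κ ε a₂) (src-κ ε a₃) (tgt-κ ε a₃)
      (np a₁) (nq a₁) (np a₃) (nq a₃) go only
      (embedding-At (embL ε) CL
        (λ a e → distinctL root a (subst (λ b → Incident Q b (ν ε root)) (sym e) (inj₁ (src-κ ε a₁))) (λ _ ()))
        (λ a e → distinctL (inR root) a (subst (λ b → Incident Q b (ν ε (inR root))) (sym e) (inj₂ (tgt-κ ε a₂))) (λ _ ())))
      (embedding-At (embR ε) CR
        (λ a e → distinctR (inL root) a (subst (λ b → Incident Q b (ν ε (inL root))) (sym e) (inj₁ (src-κ ε a₂))) (λ _ ()))
        (λ a e → distinctR root a (subst (λ b → Incident Q b (ν ε root)) (sym e) (inj₂ (tgt-κ ε a₃))) (λ _ ())))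
    where
    go : ∀ a → Incident Q a (ν ε root) → (a ≡ p ⊎ a ≡ q) ⊎ (a ≡ κ ε a₁ ⊎ a ≡ κ ε a₃)
    go a i with Γ root a i
    ... | inj₁ (a₁ , e , _) = inj₂ (inj₁ e)
    ... | inj₁ (a₃ , e , _) = inj₂ (inj₂ e)
    ... | inj₁ (a₂ , e , inj₁ ())
    ... | inj₁ (a₂ , e , inj₂ ())
    ... | inj₁ (inL b , e , inj₁ ())
    ... | inj₁ (inL b , e , inj₂ ())
    ... | inj₁ (inR b , e , inj₁ ())
    ... | inj₁ (inR b , e , inj₂ ())
    ... | inj₂ (_ , o) = inj₁ o
    only : ∀ b → src Q b ≡ ν ε (inL root) → tgt Q b ≡ ν ε (inR root) → b ≡ κ ε a₂
    only b s t with Γ (inL root) b (inj₁ s)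
    ... | inj₂ (() , _)
    ... | inj₁ (c , refl , _) with c | ν-inj ε (trans (sym (src-κ ε c)) s) | ν-inj ε (trans (sym (tgt-κ ε c)) t)
    ...   | a₂ | _ | _ = refl
    ...   | a₁ | () | _
    ...   | a₃ | () | _
    ...   | inL _ | _ | ()
    ...   | inR _ | () | _
    distinctL : ∀ y a → Incident Q (κ ε (inL a)) (ν ε y) → (∀ x → inL x ≢ y) → ⊥
    distinctL y a i ne with incident⁻ ε {inL a} {y} i
    ... | inj₁ e = ne _ e
    ... | inj₂ e = ne _ e
    distinctR : ∀ y a → Incident Q (κ ε (inR a)) (ν ε y) → (∀ x → inR x ≢ y) → ⊥
    distinctR y a i ne with incident⁻ ε {inR a} {y} i
    ... | inj₁ e = ne _ e
    ... | inj₂ e = ne _ e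
    CL : Closed (embL ε) (κ ε a₁) (κ ε a₂)
    CL x a i with Γ (inL x) a i
    ... | inj₁ (inL b , e , inj₁ j) = inj₁ (b , e , inj₁ (inL-injective j))
    ... | inj₁ (inL b , e , inj₂ j) = inj₁ (b , e , inj₂ (inL-injective j))
    ... | inj₁ (a₁ , e , inj₂ refl) = inj₂ (refl , inj₁ e)
    ... | inj₁ (a₂ , e , inj₁ refl) = inj₂ (refl , inj₂ e)
    ... | inj₁ (a₃ , e , inj₁ ())
    ... | inj₁ (a₃ , e , inj₂ ())
    ... | inj₁ (inR b , e , inj₁ ())
    ... | inj₁ (inR b , e , inj₂ ())
    ... | inj₂ (() , _)
    CR : Closed (embR ε) (κ ε a₂) (κ ε a₃)
    CR x a i with Γ (inR x) a i
    ... | inj₁ (inR b , e , inj₁ j) = inj₁ (b , e , inj₁ (inR-injective j))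
    ... | inj₁ (inR b , e , inj₂ j) = inj₁ (b , e , inj₂ (inR-injective j))
    ... | inj₁ (a₂ , e , inj₂ refl) = inj₂ (refl , inj₁ e)
    ... | inj₁ (a₃ , e , inj₁ refl) = inj₂ (refl , inj₂ e)
    ... | inj₁ (a₁ , e , inj₁ ())
    ... | inj₁ (a₁ , e , inj₂ ())
    ... | inj₁ (inL b , e , inj₁ ())
    ... | inj₁ (inL b , e , inj₂ ())
    ... | inj₂ (() , _)

module _ {n} {Q : Quiver n} {ℓ} {f : Fin (suc (suc ℓ)) → Letter} (R : Real Q f) where
  open Realized R

  attached-At : ∀ i {t} (p : shape (f i) ≡ just t) → At Q (et (i , ent p)) (et (i , ext p)) (vt (i , nd p root)) t
  attached-At i p = embedding-At (embed i p) closed (λ a e → no₁ (et-inj e)) (λ a e → no₂ (et-inj e))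
    where
    no₁ : ∀ {a} → _≡_ {A = E} (i , sub p a) (i , ent p) → ⊥
    no₁ ()
    no₂ : ∀ {a} → _≡_ {A = E} (i , sub p a) (i , ext p) → ⊥
    no₂ ()
    go : ∀ x α → source α ≡ (i , nd p x) ⊎ target α ≡ (i , nd p x) →
      (∃ λ b → α ≡ (i , sub p b) × IncidentT {Q = Q} b x) ⊎ (x ≡ root × (α ≡ (i , ent p) ⊎ α ≡ (i , ext p)))
    go x (j , ba) (inj₁ ())
    go x (j , ba) (inj₂ ())
    go x (j , ent q) (inj₁ ())
    go x (j , ent q) (inj₂ refl) = inj₂ (refl , inj₁ refl)
    go x (j , ext q) (inj₁ refl) = inj₂ (refl , inj₂ refl)
    go x (j , ext q) (inj₂ ())
    go x (j , sub q b) (inj₁ e) with refl , refl , e′ ← nd-injective e rewrite uip q p = inj₁ (b , refl , inj₁ e′)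
    go x (j , sub q b) (inj₂ e) with refl , refl , e′ ← nd-injective e rewrite uip q p = inj₁ (b , refl , inj₂ e′)
    inc : ∀ x a → Incident Q a (vt (i , nd p x)) → source (ef a) ≡ (i , nd p x) ⊎ target (ef a) ≡ (i , nd p x)
    inc x a (inj₁ e) = inj₁ (trans (source-ef a) (trans (cong vf e) (vf-vt _)))
    inc x a (inj₂ e) = inj₂ (trans (target-ef a) (trans (cong vf e) (vf-vt _)))
    closed : Closed (embed i p) (et (i , ent p)) (et (i , ext p))
    closed x a o with go x (ef a) (inc x a o)
    ... | inj₁ (b , e , j) = inj₁ (b , trans (sym (et-ef a)) (cong et e) , j)
    ... | inj₂ (r , inj₁ e) = inj₂ (r , inj₁ (trans (sym (et-ef a)) (cong et e)))
    ... | inj₂ (r , inj₂ e) = inj₂ (r , inj₂ (trans (sym (et-ef a)) (cong et e)))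

-- Only the two arrows of a double arrow can be parallel, and an attached rooted quiver does
-- not determine which of the two it belongs to.
ParallelEqual : ∀ {ℓ} → (Fin (suc (suc ℓ)) → Letter) → Set
ParallelEqual f = ∀ i j → xEnd i ≡ xEnd j → yEnd i ≡ yEnd j → shape (f i) ≡ shape (f j)
  where open Model f

-- Comparison of two realizations of one quiver

module Compare {n} {Q : Quiver n} {ℓ ℓ′} {f : Fin (suc (suc ℓ)) → Letter} {g : Fin (suc (suc ℓ′)) → Letter}
  (R : Real Q f) (S : Real Q g) (nf : NonOriented f) (ng : NonOriented g) where
  private
    module R = Realized R
    module S = Realized S

  abstract
    -- The base of `R` is a non-oriented cycle of `Q`, hence lies on the base of `S`. This matches
    -- base vertices by `pv` and then, through their ends, base arrows by `pe`.
    pv : Fin (suc (suc ℓ)) → Fin (suc (suc ℓ′))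
    pv i = proj₁ (S.AnyCycle.on-base (R.cycle nf) i)

    pv-ok : ∀ i → R.bv i ≡ S.bv (pv i)
    pv-ok i = proj₂ (S.AnyCycle.on-base (R.cycle nf) i)

  pv-inj : ∀ {i j} → pv i ≡ pv j → i ≡ j
  pv-inj e = R.bs-injective (R.vt-inj (trans (pv-ok _) (trans (cong S.bv e) (sym (pv-ok _)))))

  private
    src-be : ∀ i → S.source (S.ef (R.be i)) ≡ (pv (R.xEnd i) , bs)
    src-be i = trans (S.source-ef _) (trans (cong S.vf (trans (R.src-ok _) (pv-ok _))) (S.vf-vt _))
    tgt-be : ∀ i → S.target (S.ef (R.be i)) ≡ (pv (R.yEnd i) , bs)
    tgt-be i = trans (S.target-ef _) (trans (cong S.vf (trans (R.tgt-ok _) (pv-ok _))) (S.vf-vt _))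
    be-base : ∀ i → S.IsBase (S.ef (R.be i))
    be-base i = S.ends-onBase _ (_ , src-be i) (_ , tgt-be i)

  abstract
    pe : Fin (suc (suc ℓ)) → Fin (suc (suc ℓ′))
    pe i = proj₁ (be-base i)

    ef-be : ∀ i → S.ef (R.be i) ≡ (pe i , ba)
    ef-be i = proj₂ (be-base i)

  pe-ok : ∀ i → R.be i ≡ S.be (pe i)
  pe-ok i = trans (sym (S.et-ef _)) (cong S.et (ef-be i))

  pe-inj : ∀ {i j} → pe i ≡ pe j → i ≡ j
  pe-inj e = cong proj₁ (R.et-inj (trans (pe-ok _) (trans (cong S.be e) (sym (pe-ok _)))))

  x-pe : ∀ i → S.xEnd (pe i) ≡ pv (R.xEnd i)
  x-pe i = S.bs-injective (trans (cong S.source (sym (ef-be i))) (src-be i))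

  y-pe : ∀ i → S.yEnd (pe i) ≡ pv (R.yEnd i)
  y-pe i = S.bs-injective (trans (cong S.target (sym (ef-be i))) (tgt-be i))

  off-base : ∀ i {t} (p : shape (f i) ≡ just t) x j → S.vf (R.vt (i , nd p x)) ≢ (j , bs)
  off-base i p x j e with R.AnyCycle.on-base (S.cycle ng) j
  ... | b , e′ with () ← R.vt-inj (trans (sym (S.vt-vf _)) (trans (cong S.vt e) e′))

  -- The two arrows at an attached root join it to base vertices, so in `S` they can only be `ent`
  -- and `ext`, and they share a position since they share the root. Only the ends of the base arrow
  -- `j` are recovered, not `j` itself, because of double arrows.
  attached : ∀ i {t} → shape (f i) ≡ just t →
    ∃ λ j → shape (g j) ≡ just t × S.xEnd j ≡ S.xEnd (pe i) × S.yEnd j ≡ S.yEnd (pe i)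
  attached i {t} p = go (S.ef b) (S.ef c) refl refl sb tb sc tc
    where
    b = R.et (i , ent p)
    c = R.et (i , ext p)
    z = S.vf (R.vt (i , nd p root))
    sb : S.source (S.ef b) ≡ (pv (R.yEnd i) , bs)
    sb = trans (S.source-ef _) (trans (cong S.vf (trans (R.src-ok _) (pv-ok _))) (S.vf-vt _))
    tb : S.target (S.ef b) ≡ z
    tb = trans (S.target-ef _) (cong S.vf (R.tgt-ok _))
    sc : S.source (S.ef c) ≡ z
    sc = trans (S.source-ef _) (cong S.vf (R.src-ok _))
    tc : S.target (S.ef c) ≡ (pv (R.xEnd i) , bs)
    tc = trans (S.target-ef _) (trans (cong S.vf (trans (R.tgt-ok _) (pv-ok _))) (S.vf-vt _))
    go : ∀ β γ → S.ef b ≡ β → S.ef c ≡ γ →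
      S.source (S.ef b) ≡ (pv (R.yEnd i) , bs) → S.target (S.ef b) ≡ z →
      S.source (S.ef c) ≡ z → S.target (S.ef c) ≡ (pv (R.xEnd i) , bs) →
      ∃ λ j → shape (g j) ≡ just t × S.xEnd j ≡ S.xEnd (pe i) × S.yEnd j ≡ S.yEnd (pe i)
    go (j , ba) γ eb ec sb tb sc tc = ⊥-elim (off-base i p root _ (trans (sym tb) (cong S.target eb)))
    go (j , ext q) γ eb ec sb tb sc tc with () ← trans (sym sb) (cong S.source eb)
    go (j , sub q a) γ eb ec sb tb sc tc with () ← trans (sym sb) (cong S.source eb)
    go (j , ent q) (h , ba) eb ec sb tb sc tc = ⊥-elim (off-base i p root _ (trans (sym sc) (cong S.source ec)))
    go (j , ent q) (h , ent r) eb ec sb tb sc tc with () ← trans (sym tc) (cong S.target ec)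
    go (j , ent q) (h , sub r a) eb ec sb tb sc tc with () ← trans (sym tc) (cong S.target ec)
    go (j , ent q) (h , ext r) eb ec sb tb sc tc
      with refl , refl , _ ← S.nd-injective (trans (cong S.target (sym eb)) (trans tb (trans (sym sc) (cong S.source ec))))
      rewrite uip r q =
      j , trans q (cong just same)
        , trans (S.bs-injective (trans (cong S.target (sym ec)) tc)) (sym (x-pe i))
        , trans (S.bs-injective (trans (cong S.source (sym eb)) sb)) (sym (y-pe i))
      where
      -- Both realizations describe what hangs at one vertex of `Q` behind the same two arrows.
      same = At-functional (Valid.noLoops (R.valid′ nf))
        (subst₂ (λ b c → At Q b c _ _) (trans (cong S.et (sym eb)) (S.et-ef b)) (trans (cong S.et (sym ec)) (S.et-ef c))
          (subst (λ x → At Q (S.et (j , ent q)) (S.et (j , ext q)) x _)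
            (trans (cong S.vt (trans (cong S.target (sym eb)) tb)) (S.vt-vf _))
            (attached-At S j q)))
        (attached-At R i p)

  module _ (par : ParallelEqual g) where
    shape-pe : ∀ i {t} → shape (f i) ≡ just t → shape (g (pe i)) ≡ just t
    shape-pe i p with attached i p
    ... | j , q , x , y = trans (sym (par j (pe i) x y)) q

compare-length : ∀ {n} {Q : Quiver n} {ℓ ℓ′} {f : Fin (suc (suc ℓ)) → Letter} {g : Fin (suc (suc ℓ′)) → Letter} →
  Real Q f → Real Q g → NonOriented f → NonOriented g → ℓ ≡ ℓ′
compare-length R S nf ng = cong (pred ∘ pred)
  (≤-antisym (injective⇒≤ (Compare.pv-inj R S nf ng)) (injective⇒≤ (Compare.pv-inj S R ng nf)))

module _ {n} {Q : Quiver n} {ℓ} {f g : Fin (suc (suc ℓ)) → Letter}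
  (R : Real Q f) (S : Real Q g) (nf : NonOriented f) (ng : NonOriented g)
  (pf : ParallelEqual f) (pg : ParallelEqual g) where
  private
    module RS = Compare R S nf ng
    module SR = Compare S R ng nf
    module F = Model f
    module G = Model g
    open RS using (pv; pe)
    open Cyclic {ℓ}

    pe-inverse : ∀ i → SR.pe (pe i) ≡ i
    pe-inverse i = cong proj₁ (Realized.et-inj R (trans (sym (SR.pe-ok (pe i))) (sym (RS.pe-ok i))))

    same-shape : ∀ i → shape (g (pe i)) ≡ shape (f i)
    same-shape i = go (shape (f i)) (shape (g (pe i))) refl refl
      where
      go : ∀ o o′ → shape (f i) ≡ o → shape (g (pe i)) ≡ o′ → shape (g (pe i)) ≡ shape (f i)
      go (just t) _ e _ = trans (RS.shape-pe pg i e) (sym e)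
      go nothing nothing e e′ = trans e′ (sym e)
      go nothing (just t) e e′ with () ← trans (sym e) (trans (cong (shape ∘ f) (sym (pe-inverse i))) (SR.shape-pe pf (pe i) e′))

    Fwd Bwd : Fin k′ → Set
    Fwd i = pe i ≡ pv i × nxt (pe i) ≡ pv (nxt i) × dir (g (pe i)) ≡ dir (f i)
    Bwd i = pe i ≡ pv (nxt i) × nxt (pe i) ≡ pv i × dir (g (pe i)) ≡ not (dir (f i))

    align : ∀ i → Fwd i ⊎ Bwd i
    align i with dir (f i) | dir (g (pe i)) | RS.x-pe i | RS.y-pe i
    ... | true  | true  | x | y = inj₁ (x , y , refl)
    ... | false | false | x | y = inj₁ (y , x , refl)
    ... | true  | false | x | y = inj₂ (y , x , refl)
    ... | false | true  | x | y = inj₂ (x , y , refl)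

    -- The matching cannot turn round between neighbours: `nxt (pe i)` and `nxt (pe (nxt i))` would
    -- both be `pv (nxt i)`, and two base arrows would have the same image.
    all-fwd : Fwd zero → ∀ i → Fwd i
    all-fwd z = nxt-induction Fwd zero z step
      where
      step : ∀ i → Fwd i → Fwd (nxt i)
      step i (p , q , _) with align (nxt i)
      ... | inj₁ F = F
      ... | inj₂ (_ , r , _) = ⊥-elim (nxt≢id i (RS.pe-inj (nxt-injective (trans r (sym q)))))

    all-bwd : Bwd zero → ∀ i → Bwd i
    all-bwd z = nxt-induction Bwd zero z step
      where
      step : ∀ i → Bwd i → Bwd (nxt i)
      step i (p , q , _) with align (nxt i)
      ... | inj₁ (r , _) = ⊥-elim (nxt≢id i (RS.pe-inj (trans r (sym p))))
      ... | inj₂ B = B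

  dihedral : (∃ λ π → (∀ i → π (nxt i) ≡ nxt (π i)) × (∀ i → g (π i) ≡ f i))
           ⊎ (∃ λ π → (∀ i → nxt (π (nxt i)) ≡ π i) × (∀ i → g (π i) ≡ flip (f i)))
  dihedral with align zero
  ... | inj₁ z = inj₁ (pe , (λ i → trans (proj₁ (all-fwd z (nxt i))) (sym (proj₁ (proj₂ (all-fwd z i)))))
                          , (λ i → cong₂ _,_ (proj₂ (proj₂ (all-fwd z i))) (same-shape i)))
  ... | inj₂ z = inj₂ (pe , (λ i → trans (proj₁ (proj₂ (all-bwd z (nxt i)))) (sym (proj₁ (all-bwd z i))))
                          , (λ i → cong₂ _,_ (proj₂ (proj₂ (all-bwd z i))) (same-shape i)))

-- Existence of the letters

bijection⇒↔ : ∀ {A B : Set} (h : A → B) → (∀ {x y} → h x ≡ h y → x ≡ y) → (∀ y → ∃ λ x → h x ≡ y) → A ↔ B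
bijection⇒↔ h inj surj = mk↔ₛ′ h (proj₁ ∘ surj) (proj₂ ∘ surj) (λ x → inj (proj₂ (surj (h x))))

record Fills {n} (Q : Quiver n) (S : Subset n) (z : Fin n) (t : Shape) : Set where
  field
    emb     : Embedding Q t
    at-root : ν emb root ≡ z
    inside  : ∀ x → ν emb x ∈ˢ S
    onto    : ∀ {y} → y ∈ˢ S → ∃ λ x → ν emb x ≡ y
    fullᶠ   : ∀ b → src Q b ∈ˢ S → tgt Q b ∈ˢ S → ∃ λ a → b ≡ κ emb a
open Fills

module _ {n} {Q : Quiver n} (noLoop : ∀ a → src Q a ≢ tgt Q a) where
  -- The shape is the skeleton of the derivation, the direction of a stem recording which
  -- alternative of `ends` was used. The vertex set is kept so that disjointness of branches gives
  -- injectivity.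
  isRA-fills : ∀ {S z} → IsRA Q S z → ∃ λ t → Fills Q S z t
  isRA-fills (single ρ) = leaf , record
    { emb = record { ν = λ _ → ρ ; κ = λ () ; ν-inj = λ { {root} {root} _ → refl } ; src-κ = λ () ; tgt-κ = λ () }
    ; at-root = refl
    ; inside = λ _ → x∈⁅x⁆ ρ
    ; onto = λ y∈ → root , sym (x∈⁅y⁆⇒x≡y _ y∈)
    ; fullᶠ = λ b s t → ⊥-elim (noLoop b (trans (x∈⁅y⁆⇒x≡y _ s) (sym (x∈⁅y⁆⇒x≡y _ t)))) }
  isRA-fills (edge {S} {S′} ρ w refl ρ∉ ra a ends cov) with isRA-fills ra
  ... | t , F = stem d t , record
    { emb = record { ν = ν′ ; κ = κ′ ; ν-inj = inj ; src-κ = sκ ; tgt-κ = tκ }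
    ; at-root = refl
    ; inside = ins
    ; onto = on
    ; fullᶠ = fu }
    where
    dirOf : _ → Bool
    dirOf (inj₁ (_ , _)) = true
    dirOf (inj₂ (_ , _)) = false
    d = dirOf ends
    ε = emb F
    ν′ : Node (stem d t) → Fin n
    ν′ root = ρ
    ν′ (inS x) = ν ε x
    κ′ : Arrow (stem d t) → Fin (m Q)
    κ′ aS = a
    κ′ (inS b) = κ ε b
    inj : ∀ {x y} → ν′ x ≡ ν′ y → x ≡ y
    inj {root} {root} _ = refl
    inj {root} {inS y} e = ⊥-elim (ρ∉ (subst (_∈ˢ S′) (sym e) (inside F y)))
    inj {inS x} {root} e = ⊥-elim (ρ∉ (subst (_∈ˢ S′) e (inside F x)))
    inj {inS x} {inS y} e = cong inS (ν-inj ε e)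
    sS : ∀ es → ends ≡ es → src Q a ≡ ν′ (srcT (aS {d} {t}))
    sS (inj₁ (s , _)) refl = s
    sS (inj₂ (s , _)) refl = trans s (sym (at-root F))
    tS : ∀ es → ends ≡ es → tgt Q a ≡ ν′ (tgtT (aS {d} {t}))
    tS (inj₁ (_ , t)) refl = trans t (sym (at-root F))
    tS (inj₂ (_ , t)) refl = t
    sκ : ∀ b → src Q (κ′ b) ≡ ν′ (srcT b)
    sκ aS = sS ends refl
    sκ (inS b) = src-κ ε b
    tκ : ∀ b → tgt Q (κ′ b) ≡ ν′ (tgtT b)
    tκ aS = tS ends refl
    tκ (inS b) = tgt-κ ε b
    ins : ∀ x → ν′ x ∈ˢ ⁅ ρ ⁆ ∪ S′
    ins root = x∈p∪q⁺ (inj₁ (x∈⁅x⁆ ρ))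
    ins (inS x) = x∈p∪q⁺ (inj₂ (inside F x))
    on : ∀ {y} → y ∈ˢ ⁅ ρ ⁆ ∪ S′ → ∃ λ x → ν′ x ≡ y
    on y∈ with x∈p∪q⁻ ⁅ ρ ⁆ S′ y∈
    ... | inj₁ p = root , sym (x∈⁅y⁆⇒x≡y _ p)
    ... | inj₂ p with onto F p
    ...   | x , e = inS x , e
    fu : ∀ b → src Q b ∈ˢ ⁅ ρ ⁆ ∪ S′ → tgt Q b ∈ˢ ⁅ ρ ⁆ ∪ S′ → ∃ λ a → b ≡ κ′ a
    fu b s t with cov b s t
    ... | inj₂ e = aS , e
    ... | inj₁ (s′ , t′) with fullᶠ F b s′ t′
    ...   | a , e = inS a , e
  isRA-fills (tri {S} {S₁} {S₂} ρ u w refl ρ∉₁ ρ∉₂ disj ra₁ ra₂ b₁ b₂ b₃ s₁ t₁ s₂ t₂ s₃ t₃ cov)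
    with isRA-fills ra₁ | isRA-fills ra₂
  ... | l , F | r , G = fork l r , record
    { emb = record { ν = ν′ ; κ = κ′ ; ν-inj = inj ; src-κ = sκ ; tgt-κ = tκ }
    ; at-root = refl
    ; inside = ins
    ; onto = on
    ; fullᶠ = fu }
    where
    ν′ : Node (fork l r) → Fin n
    ν′ root = ρ
    ν′ (inL x) = ν (emb F) x
    ν′ (inR x) = ν (emb G) x
    κ′ : Arrow (fork l r) → Fin (m Q)
    κ′ a₁ = b₁
    κ′ a₂ = b₂
    κ′ a₃ = b₃
    κ′ (inL b) = κ (emb F) b
    κ′ (inR b) = κ (emb G) b
    inj : ∀ {x y} → ν′ x ≡ ν′ y → x ≡ y
    inj {root} {root} _ = refl
    inj {root} {inL y} e = ⊥-elim (ρ∉₁ (subst (_∈ˢ S₁) (sym e) (inside F y)))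
    inj {inL x} {root} e = ⊥-elim (ρ∉₁ (subst (_∈ˢ S₁) e (inside F x)))
    inj {root} {inR y} e = ⊥-elim (ρ∉₂ (subst (_∈ˢ S₂) (sym e) (inside G y)))
    inj {inR x} {root} e = ⊥-elim (ρ∉₂ (subst (_∈ˢ S₂) e (inside G x)))
    inj {inL x} {inL y} e = cong inL (ν-inj (emb F) e)
    inj {inR x} {inR y} e = cong inR (ν-inj (emb G) e)
    inj {inL x} {inR y} e = ⊥-elim (disj _ (inside F x) (subst (_∈ˢ S₂) (sym e) (inside G y)))
    inj {inR x} {inL y} e = ⊥-elim (disj _ (inside F y) (subst (_∈ˢ S₂) e (inside G x)))
    sκ : ∀ b → src Q (κ′ b) ≡ ν′ (srcT b)
    sκ a₁ = s₁
    sκ a₂ = trans s₂ (sym (at-root F))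
    sκ a₃ = trans s₃ (sym (at-root G))
    sκ (inL b) = src-κ (emb F) b
    sκ (inR b) = src-κ (emb G) b
    tκ : ∀ b → tgt Q (κ′ b) ≡ ν′ (tgtT b)
    tκ a₁ = trans t₁ (sym (at-root F))
    tκ a₂ = trans t₂ (sym (at-root G))
    tκ a₃ = t₃
    tκ (inL b) = tgt-κ (emb F) b
    tκ (inR b) = tgt-κ (emb G) b
    ins : ∀ x → ν′ x ∈ˢ ⁅ ρ ⁆ ∪ (S₁ ∪ S₂)
    ins root = x∈p∪q⁺ (inj₁ (x∈⁅x⁆ ρ))
    ins (inL x) = x∈p∪q⁺ (inj₂ (x∈p∪q⁺ (inj₁ (inside F x))))
    ins (inR x) = x∈p∪q⁺ (inj₂ (x∈p∪q⁺ (inj₂ (inside G x))))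
    on : ∀ {y} → y ∈ˢ ⁅ ρ ⁆ ∪ (S₁ ∪ S₂) → ∃ λ x → ν′ x ≡ y
    on y∈ with x∈p∪q⁻ ⁅ ρ ⁆ (S₁ ∪ S₂) y∈
    ... | inj₁ p = root , sym (x∈⁅y⁆⇒x≡y _ p)
    ... | inj₂ p with x∈p∪q⁻ S₁ S₂ p
    ...   | inj₁ q = inL (proj₁ (onto F q)) , proj₂ (onto F q)
    ...   | inj₂ q = inR (proj₁ (onto G q)) , proj₂ (onto G q)
    fu : ∀ b → src Q b ∈ˢ ⁅ ρ ⁆ ∪ (S₁ ∪ S₂) → tgt Q b ∈ˢ ⁅ ρ ⁆ ∪ (S₁ ∪ S₂) → ∃ λ a → b ≡ κ′ a
    fu b s t with cov b s t
    ... | inj₁ (s′ , t′) = inL (proj₁ (fullᶠ F b s′ t′)) , proj₂ (fullᶠ F b s′ t′)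
    ... | inj₂ (inj₁ (s′ , t′)) = inR (proj₁ (fullᶠ G b s′ t′)) , proj₂ (fullᶠ G b s′ t′)
    ... | inj₂ (inj₂ (inj₁ e)) = a₁ , e
    ... | inj₂ (inj₂ (inj₂ (inj₁ e))) = a₂ , e
    ... | inj₂ (inj₂ (inj₂ (inj₂ e))) = a₃ , e

  -- Letters read off a cycle and its attachment

  module Recognize (Γ : NCycle Q) (A : Attach Q Γ) where
    private
      data Local (i : Fin (k Γ)) : Maybe Shape → Set where
        none : att A i ≡ nothing → Local i nothing
        some : ∀ {t z b c} → att A i ≡ just (z , b , c) → Fills Q (tree A i) z t → Local i (just t)

      localize : ∀ i → ∃ (Local i)
      localize i = go (att A i) refl
        where
        go : ∀ o → att A i ≡ o → ∃ (Local i)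
        go nothing e = nothing , none e
        go (just (z , b , c)) e with isRA-fills (tree-RA A i z b c e)
        ... | t , F = just t , some e F

    abstract
      shapeAt : Fin (k Γ) → Maybe Shape
      shapeAt i = proj₁ (localize i)

      local : ∀ i → Local i (shapeAt i)
      local i = proj₂ (localize i)

    dirAt : Fin (k Γ) → Bool
    dirAt i with e-link Γ i
    ... | inj₁ _ = true
    ... | inj₂ _ = false

    letters : Fin (k Γ) → Letter
    letters i = dirAt i , shapeAt i

    open Cyclic {ℓ Γ}
    open ModelProperties letters

    private
      record Attached (i : Fin (k Γ)) (t : Shape) : Set where
        constructor attached
        field
          {zᵃ}    : Fin n
          {bᵃ cᵃ} : Fin (m Q)
          att-eq  : att A i ≡ just (zᵃ , bᵃ , cᵃ)
          fills   : Fills Q (tree A i) zᵃ t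
      open Attached

      attachedAt : ∀ i {t} → shapeAt i ≡ just t → Attached i t
      attachedAt i p = go (local i) p
        where
        go : ∀ {o t} → Local i o → o ≡ just t → Attached i t
        go (some e F) refl = attached e F

      toV : V → Fin n
      toV (i , bs) = v Γ i
      toV (i , nd p x) = ν (emb (fills (attachedAt i p))) x

      toE : E → Fin (m Q)
      toE (i , ba) = e Γ i
      toE (i , ent p) = bᵃ (attachedAt i p)
      toE (i , ext p) = cᵃ (attachedAt i p)
      toE (i , sub p a) = κ (emb (fills (attachedAt i p))) a

      src-base : ∀ i → src Q (e Γ i) ≡ v Γ (xEnd i)
      src-base i with e-link Γ i
      ... | inj₁ (s , _) = s
      ... | inj₂ (s , _) = s
      tgt-base : ∀ i → tgt Q (e Γ i) ≡ v Γ (yEnd i)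
      tgt-base i with e-link Γ i
      ... | inj₁ (_ , t) = t
      ... | inj₂ (_ , t) = t

      toV-root : ∀ i {t} (p : shapeAt i ≡ just t) → toV (i , nd p root) ≡ zᵃ (attachedAt i p)
      toV-root i p = at-root (fills (attachedAt i p))

      ok : ∀ i {t} (p : shapeAt i ≡ just t) → _
      ok i p = att-ok A i _ _ _ (att-eq (attachedAt i p))

      src-toE : ∀ a → src Q (toE a) ≡ toV (source a)
      src-toE (i , ba) = src-base i
      src-toE (i , ent p) = trans (proj₁ (ok i p)) (tgt-base i)
      src-toE (i , ext p) = trans (proj₁ (proj₂ (proj₂ (ok i p)))) (sym (toV-root i p))
      src-toE (i , sub p a) = src-κ (emb (fills (attachedAt i p))) a

      tgt-toE : ∀ a → tgt Q (toE a) ≡ toV (target a)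
      tgt-toE (i , ba) = tgt-base i
      tgt-toE (i , ent p) = trans (proj₁ (proj₂ (ok i p))) (sym (toV-root i p))
      tgt-toE (i , ext p) = trans (proj₂ (proj₂ (proj₂ (ok i p)))) (src-base i)
      tgt-toE (i , sub p a) = tgt-κ (emb (fills (attachedAt i p))) a

      toV-tree : ∀ i {t} (p : shapeAt i ≡ just t) x → toV (i , nd p x) ∈ˢ tree A i
      toV-tree i p x = inside (fills (attachedAt i p)) x

      toV-inj : ∀ {x y} → toV x ≡ toV y → x ≡ y
      toV-inj {i , bs} {j , bs} e = cong (_, bs) (v-inj Γ i j e)
      toV-inj {i , bs} {j , nd q y} e = ⊥-elim (tree-off A j _ (toV-tree j q y) (i , e))
      toV-inj {i , nd p x} {j , bs} e = ⊥-elim (tree-off A i _ (toV-tree i p x) (j , sym e))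
      toV-inj {i , nd p x} {j , nd q y} e = go (tree-disj A i j _ (toV-tree i p x) (subst (_∈ˢ tree A j) (sym e) (toV-tree j q y))) p q e
        where
        go : ∀ {i j t s x y} → i ≡ j → (p : shapeAt i ≡ just t) (q : shapeAt j ≡ just s) →
          toV (i , nd p x) ≡ toV (j , nd q y) → _≡_ {A = V} (i , nd p x) (j , nd q y)
        go {i} refl p q e with refl ← just-injective (trans (sym p) q) rewrite uip p q =
          cong (λ x → i , nd q x) (ν-inj (emb (fills (attachedAt i q))) e)

      inTree : ∀ i {y} → y ∈ˢ tree A i → Σ Shape λ t → shapeAt i ≡ just t
      inTree i {y} y∈ = go (local i)
        where
        go : ∀ {o} → Local i o → Σ Shape λ t → o ≡ just t
        go (none e) = ⊥-elim (∉⊥ (subst (y ∈ˢ_) (tree-none A i e) y∈))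
        go (some _ _) = _ , refl

      toV-surj : ∀ y → ∃ λ x → toV x ≡ y
      toV-surj y with any? (λ i → v Γ i ≟ᶠ y)
      ... | yes (i , e) = (i , bs) , e
      ... | no ¬on with tree-cover A y ¬on
      ...   | i , y∈ with inTree i y∈
      ...     | t , p with onto (fills (attachedAt i p)) y∈
      ...       | x , e = (i , nd p x) , e

      -- In the model the ends determine an arrow unless it is a base arrow (`parallel`). So
      -- injectivity on vertices suffices, and `e-inj` separates the base arrows.
      toE-inj : ∀ {a b} → toE a ≡ toE b → a ≡ b
      toE-inj {a} {b} eq with parallel a b (toV-inj (trans (sym (src-toE a)) (trans (cong (src Q) eq) (src-toE b))))
                                           (toV-inj (trans (sym (tgt-toE a)) (trans (cong (tgt Q) eq) (tgt-toE b))))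
      ... | inj₁ r = r
      ... | inj₂ ((i , refl) , (j , refl)) = cong (_, ba) (e-inj Γ i j eq)

      attached-unique : ∀ i {z b c} → att A i ≡ just (z , b , c) → Σ Shape λ t → Σ (shapeAt i ≡ just t) λ p →
        (zᵃ (attachedAt i p) , bᵃ (attachedAt i p) , cᵃ (attachedAt i p)) ≡ (z , b , c)
      attached-unique i {z} {b} {c} eq = go (local i) refl
        where
        go : ∀ {o} → Local i o → shapeAt i ≡ o → Σ Shape λ t → Σ (shapeAt i ≡ just t) λ p →
          (zᵃ (attachedAt i p) , bᵃ (attachedAt i p) , cᵃ (attachedAt i p)) ≡ (z , b , c)
        go (none e) _ with () ← trans (sym e) eq
        go (some _ _) p = _ , p , just-injective (trans (sym (att-eq (attachedAt i p))) eq)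

      toE-cycle : ∀ a → OnCycle Γ (src Q a) ⊎ OnCycle Γ (tgt Q a) → ∃ λ x → toE x ≡ a
      toE-cycle a o with incident A a o
      ... | inj₁ (i , e) = (i , ba) , sym e
      ... | inj₂ (i , z , b , c , eq , which) with attached-unique i eq
      toE-cycle a o | inj₂ (i , z , b , c , eq , inj₁ e) | t , p , r = (i , ent p) , trans (cong (proj₁ ∘ proj₂) r) (sym e)
      toE-cycle a o | inj₂ (i , z , b , c , eq , inj₂ e) | t , p , r = (i , ext p) , trans (cong (proj₂ ∘ proj₂) r) (sym e)

      -- An arrow that meets the cycle is covered by `incident`. One that avoids it stays within a
      -- single tree by `tree-sep`, and there fullness applies.
      toE-surj : ∀ a → ∃ λ x → toE x ≡ a
      toE-surj a with any? (λ i → v Γ i ≟ᶠ src Q a) | any? (λ i → v Γ i ≟ᶠ tgt Q a)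
      ... | yes s | _ = toE-cycle a (inj₁ s)
      ... | no _ | yes t = toE-cycle a (inj₂ t)
      ... | no ¬s | no ¬t with tree-cover A (src Q a) ¬s | tree-cover A (tgt Q a) ¬t
      ...   | i , s∈ | j , t∈ with tree-sep A a i j s∈ t∈
      ...     | refl with inTree i s∈
      ...       | t , p with fullᶠ (fills (attachedAt i p)) a s∈ t∈
      ...         | b , e = (i , sub p b) , sym e

    realization : Real Q letters
    realization = record
      { vm = bijection⇒↔ toV toV-inj toV-surj ; em = bijection⇒↔ toE toE-inj toE-surj
      ; src-ok = src-toE ; tgt-ok = tgt-toE }

    open Realized realization using (vt; et)

    att-just⁺ : ∀ i {t} (p : shapeAt i ≡ just t) → att A i ≡ just (vt (i , nd p root) , et (i , ent p) , et (i , ext p))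
    att-just⁺ i p = trans (att-eq (attachedAt i p)) (cong (λ z → just (z , et (i , ent p) , et (i , ext p))) (sym (toV-root i p)))

    att-just⁻ : ∀ i {z b c} → att A i ≡ just (z , b , c) → Σ Shape λ t → Σ (shapeAt i ≡ just t) λ p →
      (vt (i , nd p root) , et (i , ent p) , et (i , ext p)) ≡ (z , b , c)
    att-just⁻ i eq with attached-unique i eq
    ... | t , p , _ = t , p , just-injective (trans (sym (att-just⁺ i p)) eq)

    att-nothing⁺ : ∀ i → shapeAt i ≡ nothing → att A i ≡ nothing
    att-nothing⁺ i = go (local i)
      where
      go : ∀ {o} → Local i o → o ≡ nothing → att A i ≡ nothing
      go (none e) _ = e

    att-nothing⁻ : ∀ i → att A i ≡ nothing → shapeAt i ≡ nothing
    att-nothing⁻ i eq = go (local i)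
      where
      go : ∀ {o} → Local i o → o ≡ nothing
      go (none _) = refl
      go (some e _) with () ← trans (sym e) eq

-- Letters of a symmetric quiver

module _ {n} {Q : Quiver n} (noLoop : ∀ a → src Q a ≢ tgt Q a) (S : Symmetric Q) where
  open Symmetric S
  open Recognize noLoop cyc attach
  open Cyclic {ℓ cyc}
  private
    R : Real Q letters
    R = realization
    module R = Realized R
    module R′ = Realized (≅-Real aut R)
    σv : Fin n → Fin n
    σv = Inverse.to (_≅_.vmap aut)
    σe : Fin (m Q) → Fin (m Q)
    σe = Inverse.to (_≅_.amap aut)

    x-rev : ∀ i → R.xEnd (revE shift i) ≡ revV shift (R.xEnd i)
    x-rev i = v-inj cyc _ _ (begin
      v cyc (R.xEnd (revE shift i))   ≡⟨ R.src-ok (revE shift i , ba) ⟨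
      src Q (e cyc (revE shift i))    ≡⟨ cong (src Q) (rev-e i) ⟨
      src Q (σe (e cyc i))            ≡⟨ _≅_.src-pres aut (e cyc i) ⟩
      σv (src Q (e cyc i))            ≡⟨ cong σv (R.src-ok (i , ba)) ⟩
      σv (v cyc (R.xEnd i))           ≡⟨ rev-v (R.xEnd i) ⟩
      v cyc (revV shift (R.xEnd i))   ∎)
      where open ≡-Reasoning

    -- Sources go to sources (`x-rev`). With equal directions the source of the reflected arrow
    -- would be the other one of its two ends.
    flip-dir : ∀ i → dirAt (revE shift i) ≡ not (dirAt i)
    flip-dir i with dirAt i | dirAt (revE shift i) | x-rev i
    ... | true  | false | _ = refl
    ... | false | true  | _ = refl
    ... | true  | true  | x = ⊥-elim (nxt≢id _ (trans (nxt-revE shift i) (sym x)))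
    ... | false | false | x = ⊥-elim (nxt≢id _ (trans x (revV-nxt shift i)))

    -- `≅-Real aut R` is `R` followed by the automorphism. It reaches through its position `i` the
    -- same root and the same two arrows as `R` through `revE shift i`, so `At-functional` compares
    -- the shapes.
    same-shape : ∀ i → shapeAt (revE shift i) ≡ shapeAt i
    same-shape i = go (shapeAt i) refl
      where
      go : ∀ o → shapeAt i ≡ o → shapeAt (revE shift i) ≡ shapeAt i
      go nothing p = trans (att-nothing⁻ _ (trans (rev-att i) (cong (mapMaybe _) (att-nothing⁺ i p)))) (sym p)
      go (just t) p with att-just⁻ (revE shift i) (trans (rev-att i) (cong (mapMaybe _) (att-just⁺ i p)))
      ... | t′ , q , eq = trans q (trans (cong just same) (sym p))
        where
        same : t′ ≡ t
        same = At-functional noLoop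
          (subst (λ (z , b , c) → At Q b c z t′) eq (attached-At R (revE shift i) q))
          (attached-At (≅-Real aut R) i p)

  symmetric-letters : ∀ i → letters (revE shift i) ≡ flip (letters i)
  symmetric-letters i = cong₂ _,_ (flip-dir i) (same-shape i)

-- Mirror-symmetric sequences

infix 4 _≟ˢ_ _≟ˡ_
_≟ˢ_ : DecidableEquality Shape
leaf ≟ˢ leaf = yes refl
leaf ≟ˢ stem _ _ = no λ ()
leaf ≟ˢ fork _ _ = no λ ()
stem _ _ ≟ˢ leaf = no λ ()
stem d s ≟ˢ stem d′ s′ with d ≟ᵇ d′ | s ≟ˢ s′
... | yes refl | yes refl = yes refl
... | no ne    | _        = no λ { refl → ne refl }
... | yes _    | no ne    = no λ { refl → ne refl }
stem _ _ ≟ˢ fork _ _ = no λ ()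
fork _ _ ≟ˢ leaf = no λ ()
fork _ _ ≟ˢ stem _ _ = no λ ()
fork s t ≟ˢ fork s′ t′ with s ≟ˢ s′ | t ≟ˢ t′
... | yes refl | yes refl = yes refl
... | no ne    | _        = no λ { refl → ne refl }
... | yes _    | no ne    = no λ { refl → ne refl }

_≟ˡ_ : DecidableEquality Letter
_≟ˡ_ = ≡-decᵖ _≟ᵇ_ (≡-decᵐ _≟ˢ_)

flip-involutive : ∀ x → flip (flip x) ≡ x
flip-involutive (d , o) = cong (_, o) (not-involutive d)

flip≢id : ∀ x → x ≢ flip x
flip≢id (true  , o) ()
flip≢id (false , o) ()

-- Read around a cycle of length 2t starting from a vertex on the axis of a reflection,
-- letters at mirror positions i, j (i + j ≡ −1 mod 2t) are flips of each other.
Mirror : ℕ → (ℕ → Letter) → Set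
Mirror t u = ∀ i j q → suc (i + j) ≡ q * (t + t) → u i ≡ flip (u j)

-- Only even periods matter: the composite of the reflections about two points at distance d is the
-- shift by 2d.
HalfPeriod : ℕ → (ℕ → Letter) → Set
HalfPeriod d u = ∀ i → u (i + (d + d)) ≡ u i

-- Any large enough multiple of `t + t` would do; the factor `suc i` ensures that the subtraction is
-- not cut off at 0.
mirror-point : ∀ t → 1 ≤ t → ∀ i → ∃ λ j → suc (i + j) ≡ suc i * (t + t)
mirror-point t@(suc _) _ i = suc i * (t + t) ∸ suc i , m+[n∸m]≡n (m≤m*n (suc i) (t + t))

-- The positions i and i + 2t mirror the same position j, so both letters are the flip of the one at
-- j.
mirror⇒halfPeriod : ∀ {t u} → 1 ≤ t → Mirror t u → HalfPeriod t u
mirror⇒halfPeriod {t} {u} t≥1 M i with mirror-point t t≥1 i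
... | j , e = trans (M (i + (t + t)) j (suc (suc i)) (trans (shuffle i (t + t) j) (cong (t + t +_) e)))
                    (sym (M i j (suc i) e))
  where
  open +-*-Solver
  shuffle : ∀ i T j → suc (i + T + j) ≡ T + suc (i + j)
  shuffle = solve 3 (λ i T j → con 1 :+ (i :+ T :+ j) := T :+ (con 1 :+ (i :+ j))) refl

private
  double-+ : ∀ i a b → i + (a + b + (a + b)) ≡ i + (a + a) + (b + b)
  double-+ = solve 3 (λ i a b → i :+ (a :+ b :+ (a :+ b)) := i :+ (a :+ a) :+ (b :+ b)) refl
    where open +-*-Solver

  +-swapʳ : ∀ a b c → a + b + c ≡ a + c + b
  +-swapʳ a b c = trans (+-assoc a b c) (trans (cong (a +_) (+-comm b c)) (sym (+-assoc a c b)))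

halfPeriod-+ : ∀ {a b u} → HalfPeriod a u → HalfPeriod b u → HalfPeriod (a + b) u
halfPeriod-+ {a} {b} {u} A B i = trans (cong u (double-+ i a b)) (trans (B (i + (a + a))) (A i))

halfPeriod-cancel : ∀ {a b u} → HalfPeriod (a + b) u → HalfPeriod b u → HalfPeriod a u
halfPeriod-cancel {a} {b} {u} AB B i =
  trans (sym (B (i + (a + a)))) (trans (cong u (sym (double-+ i a b))) (AB i))

halfPeriod-* : ∀ {a u} q → HalfPeriod a u → HalfPeriod (q * a) u
halfPeriod-* {u = u} zero A i = cong u (+-identityʳ i)
halfPeriod-* {a} (suc q) A = halfPeriod-+ {a} {q * a} A (halfPeriod-* q A)

period-* : ∀ {a u} q → HalfPeriod a u → ∀ i → u (i + q * (a + a)) ≡ u i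
period-* {a} {u} q A i = trans (cong (λ x → u (i + x)) (*-distribˡ-+ q a a)) (halfPeriod-* q A i)

reduce-period : ∀ {t u} .{{_ : NonZero (t + t)}} → HalfPeriod t u → ∀ i → u i ≡ u (i % (t + t))
reduce-period {t} {u} H i = trans (cong u (m≡m%n+[m/n]*n i (t + t))) (period-* {t} (i / (t + t)) H (i % (t + t)))

-- Since `u` has period 2t, it suffices to test the positions below 2t.
halfPeriod? : ∀ {t u} → 1 ≤ t → HalfPeriod t u → ∀ d → Dec (HalfPeriod d u)
halfPeriod? {t@(suc _)} {u} t≥1 H d = map′ extend (λ P {i} _ → P i) (allUpTo? (λ i → u (i + (d + d)) ≟ˡ u i) (t + t))
  where
  extend : (∀ {i} → i < t + t → u (i + (d + d)) ≡ u i) → HalfPeriod d u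
  extend P i = begin
    u (i + (d + d))                               ≡⟨ cong (λ x → u (x + (d + d))) (m≡m%n+[m/n]*n i (t + t)) ⟩
    u (i % (t + t) + i / (t + t) * (t + t) + (d + d)) ≡⟨ cong u (+-swapʳ (i % (t + t)) (i / (t + t) * (t + t)) (d + d)) ⟩
    u (i % (t + t) + (d + d) + i / (t + t) * (t + t)) ≡⟨ period-* {t} (i / (t + t)) H (i % (t + t) + (d + d)) ⟩
    u (i % (t + t) + (d + d))                     ≡⟨ P (m%n<n i (t + t)) ⟩
    u (i % (t + t))                               ≡⟨ reduce-period {t} H i ⟨
    u i                                           ∎
    where open ≡-Reasoning

-- Least half periods

record Least (u : ℕ → Letter) (h : ℕ) : Set where
  field
    positive : 1 ≤ h
    holds    : HalfPeriod h u
    minimal  : ∀ d → 1 ≤ d → HalfPeriod d u → h ≤ d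
open Least

least : ∀ {t u} → 1 ≤ t → HalfPeriod t u → ∃ (Least u)
least {t@(suc s)} {u} t≥1 H = go s 1 ≤-refl refl (λ { d d≥1 (s≤s d<1) _ → <⇒≱ d≥1 d<1 })
  where
  go : ∀ fuel d → 1 ≤ d → d + fuel ≡ t → (∀ e → 1 ≤ e → e < d → ¬ HalfPeriod e u) → ∃ (Least u)
  go fuel d d≥1 eq below with halfPeriod? t≥1 H d
  ... | yes P = d , record { positive = d≥1 ; holds = P ; minimal = λ e e≥1 Pe → ≮⇒≥ (λ e<d → below e e≥1 e<d Pe) }
  go zero d d≥1 eq below | no ¬P = ⊥-elim (¬P (subst (λ x → HalfPeriod x u) (sym (trans (sym (+-identityʳ d)) eq)) H))
  go (suc fuel) d d≥1 eq below | no ¬P = go fuel (suc d) (s≤s z≤n) (trans (sym (+-suc d fuel)) eq) below′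
    where
    below′ : ∀ e → 1 ≤ e → e < suc d → ¬ HalfPeriod e u
    below′ e e≥1 (s≤s e≤d) with m≤n⇒m<n∨m≡n e≤d
    ... | inj₁ e<d  = below e e≥1 e<d
    ... | inj₂ refl = ¬P

-- The remainder of `d` by `h` is again a half period and smaller than `h`, so it is 0.
least-divides : ∀ {u h d} → Least u h → HalfPeriod d u → h ∣ d
least-divides {u} {h@(suc _)} {d} L D = m%n≡0⇒n∣m d h (zero′ (d % h) (m%n<n d h) rem)
  where
  rem : HalfPeriod (d % h) u
  rem = halfPeriod-cancel {d % h} {d / h * h} (subst (λ x → HalfPeriod x u) (m≡m%n+[m/n]*n d h) D) (halfPeriod-* (d / h) (holds L))
  zero′ : ∀ r → r < h → HalfPeriod r u → r ≡ 0
  zero′ zero _ _ = refl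
  zero′ (suc r) r<h P = ⊥-elim (<⇒≱ r<h (minimal L (suc r) (s≤s z≤n) P))
least-divides {h = zero} L with () ← positive L

shift : ℕ → (ℕ → Letter) → ℕ → Letter
shift c u i = u (i + c)

mirror-least : ∀ {t u h} → 1 ≤ t → Mirror t u → Least u h → Mirror h u
mirror-least {t} {u} {h} t≥1 M L i j q e with least-divides {d = t} L (mirror⇒halfPeriod t≥1 M)
... | divides zero refl with () ← t≥1
... | divides (suc s) refl =
  -- Here t is `suc s * h`. Moving j by `q * s` periods turns q times 2h into q times 2t, where `M`
  -- applies.
  trans (M i (j + q * s * (h + h)) q eq) (cong flip (period-* {h} (q * s) (holds L) j))
  where
  open +-*-Solver
  eq : suc (i + (j + q * s * (h + h))) ≡ q * ((h + s * h) + (h + s * h))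
  eq = trans (cong suc (sym (+-assoc i j _))) (trans (cong (_+ q * s * (h + h)) e)
    (solve 3 (λ q s h → q :* (h :+ h) :+ q :* s :* (h :+ h) := q :* ((h :+ s :* h) :+ (h :+ s :* h))) refl q s h))

-- Moving both positions by `h` adds 2h to their sum, so they still mirror each other modulo 2h.
mirror-shift : ∀ {t u h} → 1 ≤ t → Mirror t u → Least u h → Mirror t (shift h u)
mirror-shift {t} {u} {h} t≥1 M L i j q e with least-divides {d = t} L (mirror⇒halfPeriod t≥1 M)
... | divides s refl = mirror-least t≥1 M L (i + h) (j + h) (suc (q * s))
  (trans (solve 3 (λ i j h → con 1 :+ (i :+ h :+ (j :+ h)) := h :+ h :+ (con 1 :+ (i :+ j))) refl i j h)
    (cong (h + h +_) (trans e (solve 3 (λ q s h → q :* (s :* h :+ s :* h) := q :* s :* (h :+ h)) refl q s h))))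
  where open +-*-Solver

least-shift : ∀ {u h} → Least u h → Least (shift h u) h
least-shift {u} {h} L = record
  { positive = positive L
  ; holds    = λ i → trans (cong u (+-swapʳ i (h + h) h)) (holds L (i + h))
  ; minimal  = λ d d≥1 D → minimal L d d≥1 (λ i → begin
      u (i + (d + d))               ≡⟨ holds L (i + (d + d)) ⟨
      u (i + (d + d) + (h + h))     ≡⟨ cong u (solve 3 (λ i d h → i :+ (d :+ d) :+ (h :+ h) := i :+ h :+ (d :+ d) :+ h) refl i d h) ⟩
      u (i + h + (d + d) + h)       ≡⟨ D (i + h) ⟩
      u (i + h + h)                 ≡⟨ cong u (+-assoc i h h) ⟩
      u (i + (h + h))               ≡⟨ holds L i ⟩
      u i                           ∎) }
  where
  open ≡-Reasoning
  open +-*-Solver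

least-unique : ∀ {u u′ h h′} → (∀ i → u i ≡ u′ i) → Least u h → Least u′ h′ → h ≡ h′
least-unique eq L L′ = ≤-antisym
  (minimal L _ (positive L′) (λ i → trans (eq _) (trans (holds L′ i) (sym (eq i)))))
  (minimal L′ _ (positive L) (λ i → trans (sym (eq _)) (trans (holds L i) (eq i))))

even⊎odd : ∀ n → ∃ λ d → n ≡ d + d ⊎ n ≡ suc (d + d)
even⊎odd zero = 0 , inj₁ refl
even⊎odd (suc n) with even⊎odd n
... | d , inj₁ refl = d , inj₂ refl
... | d , inj₂ refl = suc d , inj₁ (cong suc (sym (+-suc d d)))

-- An even h would make h/2 a half period; an odd one puts an arrow on the axis.
shift-least≢ : ∀ {t u h} → 1 ≤ t → Mirror t u → Least u h → ¬ (∀ i → shift h u i ≡ u i)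
shift-least≢ {t} {u} {h} t≥1 M L eq with even⊎odd h
... | zero , inj₁ refl with () ← positive L
... | suc d , inj₁ refl = <⇒≱ (m<m+n (suc d) (s≤s z≤n)) (minimal L (suc d) (s≤s z≤n) eq)
... | d , inj₂ refl = flip≢id (u d) (trans (mirror-least t≥1 M L d (d + h) 1 mid) (cong flip (eq d)))
  where
  open +-*-Solver
  mid : suc (d + (d + suc (d + d))) ≡ 1 * (suc (d + d) + suc (d + d))
  mid = solve 1 (λ d → con 1 :+ (d :+ (d :+ (con 1 :+ (d :+ d)))) := con 1 :* ((con 1 :+ (d :+ d)) :+ (con 1 :+ (d :+ d)))) refl d

-- Mirror axes of `u′` pass through both 0 and `c`. Composing the two reflections shifts by 2c, and
-- the two flips cancel.
mirror-rotation : ∀ {t u u′} → 1 ≤ t → Mirror t u → Mirror t u′ → ∀ c → (∀ i → u′ (i + c) ≡ u i) → HalfPeriod c u′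
mirror-rotation {t} {u} {u′} t≥1 M M′ c rot i with mirror-point t t≥1 (i + c)
... | j , e = begin
  u′ (i + (c + c))   ≡⟨ cong u′ (sym (+-assoc i c c)) ⟩
  u′ (i + c + c)     ≡⟨ rot (i + c) ⟩
  u (i + c)          ≡⟨ M (i + c) j (suc (i + c)) e ⟩
  flip (u j)         ≡⟨ cong flip (rot j) ⟨
  flip (u′ (j + c))  ≡⟨ M′ i (j + c) (suc (i + c)) (trans (cong suc (shuffle i j c)) e) ⟨
  u′ i               ∎
  where
  open ≡-Reasoning
  shuffle : ∀ i j c → i + (j + c) ≡ i + c + j
  shuffle i j c = trans (cong (i +_) (+-comm j c)) (sym (+-assoc i c j))

-- The shift `c` is a multiple of `h`. An even multiple is a period, and an odd one differs from `h`
-- by a period.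
rotation-dichotomy : ∀ {t u u′ h} → 1 ≤ t → Mirror t u → Mirror t u′ → Least u′ h →
  ∀ c → (∀ i → u′ (i + c) ≡ u i) → (∀ i → u i ≡ u′ i) ⊎ (∀ i → u i ≡ shift h u′ i)
rotation-dichotomy {t} {u} {u′} {h} t≥1 M M′ L c rot with least-divides {d = c} L (mirror-rotation t≥1 M M′ c rot)
... | divides q refl with even⊎odd q
...   | d , inj₁ refl = inj₁ λ i → trans (sym (rot i))
        (trans (cong (λ x → u′ (i + x)) (*-distribʳ-+ h d d)) (halfPeriod-* d (holds L) i))
...   | d , inj₂ refl = inj₂ λ i → trans (sym (rot i))
        (trans (cong u′ (trans (cong (λ x → i + (h + x)) (*-distribʳ-+ h d d)) (sym (+-assoc i h _)))) (halfPeriod-* d (holds L) (i + h)))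

mirror-agree : ∀ {t u u′} → 1 ≤ t → Mirror t u → Mirror t u′ → (∀ i → i < t → u i ≡ u′ i) → ∀ i → u i ≡ u′ i
mirror-agree {t@(suc _)} {u} {u′} t≥1 M M′ eq i = begin
  u i              ≡⟨ reduce-period {t} (mirror⇒halfPeriod t≥1 M) i ⟩
  u (i % (t + t))  ≡⟨ go (i % (t + t)) (m%n<n i (t + t)) ⟩
  u′ (i % (t + t)) ≡⟨ reduce-period {t} (mirror⇒halfPeriod t≥1 M′) i ⟨
  u′ i             ∎
  where
  open ≡-Reasoning
  go : ∀ r → r < t + t → u r ≡ u′ r
  go r r<k with r <? t
  ... | yes r<t = eq r r<t
  ... | no r≮t = trans (M r j 1 rj) (trans (cong flip (eq j j<t)) (sym (M′ r j 1 rj)))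
    where
    j = t + t ∸ suc r
    rj : suc (r + j) ≡ 1 * (t + t)
    rj = trans (m+[n∸m]≡n r<k) (sym (*-identityˡ (t + t)))
    j<t : j < t
    j<t = +-cancelˡ-< t j t (≤-<-trans (+-monoˡ-≤ j (≮⇒≥ r≮t)) (≤-reflexive (trans rj (*-identityˡ _))))

-- The number `suc (i % k + j % k)` is a multiple of `k` that lies strictly between 0 and 2k.
mirror-% : ∀ k .{{_ : NonZero k}} i j q → suc (i + j) ≡ q * k → suc (i % k + j % k) ≡ k
mirror-% k i j q e = one (m%n≡0⇒n∣m (suc (i % k + j % k)) k zero′)
  where
  open ≡-Reasoning
  zero′ : suc (i % k + j % k) % k ≡ 0
  zero′ = begin
    suc (i % k + j % k) % k     ≡⟨ cong (_% k) (sym (+-suc (i % k) (j % k))) ⟩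
    (i % k + suc (j % k)) % k   ≡⟨ [m%k+n]%k i (suc (j % k)) k ⟩
    (i + suc (j % k)) % k       ≡⟨ cong (_% k) (trans (+-suc i (j % k)) (+-comm (suc i) (j % k))) ⟩
    (j % k + suc i) % k         ≡⟨ [m%k+n]%k j (suc i) k ⟩
    (j + suc i) % k             ≡⟨ cong (_% k) (trans (+-comm j (suc i)) e) ⟩
    q * k % k                   ≡⟨ m*n%n≡0 q k ⟩
    0                           ∎
  one : k ∣ suc (i % k + j % k) → suc (i % k + j % k) ≡ k
  one (divides (suc zero) eq) = trans eq (+-identityʳ k)
  one (divides (suc (suc p)) eq) = ⊥-elim (<⇒≱ (+-mono-≤-< (m%n<n i k) (m%n<n j k))
    (≤-trans (+-monoʳ-≤ k (m≤m+n k (p * k))) (≤-reflexive (sym eq))))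

reflect-% : ∀ k .{{_ : NonZero k}} i j q → suc (i + j) ≡ q * k → i % k ≡ k ∸ suc (j % k)
reflect-% k i j q e = sym (trans (cong (_∸ suc (j % k)) (sym (trans (+-suc (i % k) (j % k)) (mirror-% k i j q e))))
  (m+n∸n≡m (i % k) (suc (j % k))))

-- Half words and the cyclic sequences they generate

letterAt : List Letter → ℕ → Letter
-- An arbitrary default: `around` reads a nonempty word only at positions below its length.
letterAt []       _       = true , nothing
letterAt (x ∷ xs) zero    = x
letterAt (x ∷ xs) (suc i) = letterAt xs i

-- The letters met when going round the symmetric cycle with half w.
around : List Letter → ℕ → Letter
around []         _ = true , nothing
around w@(x ∷ xs) n = if ⌊r<t⌋ then letterAt w r else flip (letterAt w (length w + length w ∸ suc r))
  where
  r = n % (length w + length w)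
  ⌊r<t⌋ = r <ᵇ length w

module _ (x : Letter) (xs : List Letter) where
  private
    w = x ∷ xs
    t = length w

  around-low : ∀ n → n % (t + t) < t → around w n ≡ letterAt w (n % (t + t))
  around-low n lt with n % (t + t) <ᵇ t | <⇒<ᵇ lt
  ... | true | _ = refl

  around-high : ∀ n → t ≤ n % (t + t) → around w n ≡ flip (letterAt w (t + t ∸ suc (n % (t + t))))
  around-high n ge with n % (t + t) <ᵇ t in eq
  ... | false = refl
  ... | true = ⊥-elim (<⇒≱ (<ᵇ⇒< (n % (t + t)) t (subst T (sym eq) _)) ge)

  around-start : ∀ i → i < t → around w i ≡ letterAt w i
  around-start i i<t = trans (around-low i (subst (_< t) (sym r) i<t)) (cong (letterAt w) r)
    where
    r : i % (t + t) ≡ i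
    r = m<n⇒m%n≡m (<-≤-trans i<t (m≤m+n t t))

  around-mirror : Mirror t (around w)
  around-mirror i j q e with i % (t + t) <? t
  ... | yes i<t = begin
    around w i                                            ≡⟨ around-low i i<t ⟩
    letterAt w (i % (t + t))                              ≡⟨ cong (letterAt w) (reflect-% (t + t) i j q e) ⟩
    letterAt w (t + t ∸ suc (j % (t + t)))                ≡⟨ flip-involutive _ ⟨
    flip (flip (letterAt w (t + t ∸ suc (j % (t + t)))))  ≡⟨ cong flip (around-high j j≥t) ⟨
    flip (around w j)                                     ∎
    where
    open ≡-Reasoning
    j≥t : t ≤ j % (t + t)
    j≥t = +-cancelˡ-≤ t t (j % (t + t))
      (≤-trans (≤-reflexive (sym (mirror-% (t + t) i j q e))) (+-monoˡ-≤ (j % (t + t)) i<t))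
  ... | no i≮t = begin
    around w i                                     ≡⟨ around-high i (≮⇒≥ i≮t) ⟩
    flip (letterAt w (t + t ∸ suc (i % (t + t))))  ≡⟨ cong (flip ∘ letterAt w) (reflect-% (t + t) j i q (trans (cong suc (+-comm j i)) e)) ⟨
    flip (letterAt w (j % (t + t)))                ≡⟨ cong flip (around-low j j<t) ⟨
    flip (around w j)                              ∎
    where
    open ≡-Reasoning
    j<t : j % (t + t) < t
    j<t = +-cancelˡ-< t (j % (t + t)) t
      (≤-<-trans (+-monoˡ-≤ (j % (t + t)) (≮⇒≥ i≮t)) (≤-reflexive (mirror-% (t + t) i j q e)))

applyUpTo-cong : ∀ {A : Set} {f g : ℕ → A} n → (∀ i → i < n → f i ≡ g i) → applyUpTo f n ≡ applyUpTo g n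
applyUpTo-cong zero    eq = refl
applyUpTo-cong (suc n) eq = cong₂ _∷_ (eq 0 (s≤s z≤n)) (applyUpTo-cong n (λ i i<n → eq (suc i) (s≤s i<n)))

letterAt-applyUpTo : ∀ (u : ℕ → Letter) n i → i < n → letterAt (applyUpTo u n) i ≡ u i
letterAt-applyUpTo u (suc n) zero    _         = refl
letterAt-applyUpTo u (suc n) (suc i) (s≤s i<n) = letterAt-applyUpTo (u ∘ suc) n i i<n

applyUpTo-letterAt : ∀ w → applyUpTo (letterAt w) (length w) ≡ w
applyUpTo-letterAt []      = refl
applyUpTo-letterAt (x ∷ w) = cong (x ∷_) (applyUpTo-letterAt w)

around-half : ∀ x xs → applyUpTo (around (x ∷ xs)) (suc (length xs)) ≡ x ∷ xs
around-half x xs = trans (applyUpTo-cong _ (around-start x xs)) (applyUpTo-letterAt (x ∷ xs))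

around-injective : ∀ w w′ → 1 ≤ length w → length w ≡ length w′ → (∀ i → around w i ≡ around w′ i) → w ≡ w′
around-injective (x ∷ xs) (y ∷ ys) _ len eq = begin
  x ∷ xs                                                ≡⟨ around-half x xs ⟨
  applyUpTo (around (x ∷ xs)) (suc (length xs))         ≡⟨ applyUpTo-cong _ (λ i _ → eq i) ⟩
  applyUpTo (around (y ∷ ys)) (suc (length xs))         ≡⟨ cong (applyUpTo (around (y ∷ ys))) len ⟩
  applyUpTo (around (y ∷ ys)) (suc (length ys))         ≡⟨ around-half y ys ⟩
  y ∷ ys                                                ∎
  where open ≡-Reasoning

around-mirror′ : ∀ w → 1 ≤ length w → Mirror (length w) (around w)
around-mirror′ (x ∷ xs) _ = around-mirror x xs

around-applyUpTo : ∀ {t u} → 1 ≤ t → Mirror t u → ∀ i → around (applyUpTo u t) i ≡ u i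
around-applyUpTo {t@(suc s)} {u} t≥1 M = mirror-agree t≥1
  (subst (λ n → Mirror n (around w)) len (around-mirror′ w (≤-trans t≥1 (≤-reflexive (sym len))))) M
  (λ i i<t → trans (around-start (u 0) (applyUpTo (u ∘ suc) s) i (subst (i <_) (sym len) i<t)) (letterAt-applyUpTo u t i i<t))
  where
  w = applyUpTo u t
  len : length w ≡ t
  len = length-applyUpTo u t

-- The other word with the same cycle: read from the next point where a reflection axis
-- meets the cycle.
abstract
  partnerShift : List Letter → ℕ
  partnerShift []       = 0
  partnerShift (x ∷ xs) = proj₁ (least (s≤s z≤n) (mirror⇒halfPeriod (s≤s z≤n) (around-mirror x xs)))

  partnerShift-least : ∀ w → 1 ≤ length w → Least (around w) (partnerShift w)
  partnerShift-least (x ∷ xs) _ = proj₂ (least (s≤s z≤n) (mirror⇒halfPeriod (s≤s z≤n) (around-mirror x xs)))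

  partner : List Letter → List Letter
  partner w = applyUpTo (shift (partnerShift w) (around w)) (length w)

  length-partner : ∀ w → length (partner w) ≡ length w
  length-partner w = length-applyUpTo _ (length w)

  around-partner : ∀ w → 1 ≤ length w → ∀ i → around (partner w) i ≡ shift (partnerShift w) (around w) i
  around-partner w ne = around-applyUpTo ne (mirror-shift ne (around-mirror′ w ne) (partnerShift-least w ne))

-- The partner has the same least half period h, as its sequence is a shift of the first one.
-- Shifting by h twice is a shift by the period 2h.
partner-involutive : ∀ w → 1 ≤ length w → partner (partner w) ≡ w
partner-involutive w ne = around-injective (partner (partner w)) w ne″ (trans (length-partner (partner w)) (length-partner w)) λ i → begin
  around (partner (partner w)) i                          ≡⟨ around-partner (partner w) ne′ i ⟩
  around (partner w) (i + partnerShift (partner w))       ≡⟨ around-partner w ne _ ⟩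
  around w (i + partnerShift (partner w) + partnerShift w) ≡⟨ cong (λ h → around w (i + h + partnerShift w)) same ⟩
  around w (i + partnerShift w + partnerShift w)          ≡⟨ cong (around w) (+-assoc i _ _) ⟩
  around w (i + (partnerShift w + partnerShift w))        ≡⟨ Least.holds (partnerShift-least w ne) i ⟩
  around w i                                              ∎
  where
  open ≡-Reasoning
  ne′ : 1 ≤ length (partner w)
  ne′ = ≤-trans ne (≤-reflexive (sym (length-partner w)))
  ne″ : 1 ≤ length (partner (partner w))
  ne″ = ≤-trans ne′ (≤-reflexive (sym (length-partner (partner w))))
  same : partnerShift (partner w) ≡ partnerShift w
  same = least-unique (around-partner w ne) (partnerShift-least (partner w) ne′) (least-shift (partnerShift-least w ne))

partner≢id : ∀ w → 1 ≤ length w → partner w ≢ w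
partner≢id w ne eq = shift-least≢ ne (around-mirror′ w ne) (partnerShift-least w ne)
  (λ i → trans (sym (around-partner w ne i)) (cong (λ x → around x i) eq))

around-rotation : ∀ w w′ → 1 ≤ length w → length w ≡ length w′ → ∀ c → (∀ i → around w′ (i + c) ≡ around w i) →
  w ≡ w′ ⊎ w ≡ partner w′
around-rotation w w′ ne len c rot
  with rotation-dichotomy ne (around-mirror′ w ne) (subst (λ n → Mirror n (around w′)) (sym len) (around-mirror′ w′ ne′))
         (partnerShift-least w′ ne′) c rot
  where
  ne′ : 1 ≤ length w′
  ne′ = ≤-trans ne (≤-reflexive len)
... | inj₁ eq = inj₁ (around-injective w w′ ne len eq)
... | inj₂ eq = inj₂ (around-injective w (partner w′) ne (trans len (sym (length-partner w′)))
                  (λ i → trans (eq i) (sym (around-partner w′ (≤-trans ne (≤-reflexive len)) i))))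

-- Oriented 3-cycles

module _ {A : Set} where
  rot : A × A × A → A × A × A
  rot (x , y , z) = y , z , x

  data Rot (a : A × A × A) : A × A × A → Set where
    rot⁰ : Rot a a
    rot¹ : Rot a (rot a)
    rot² : Rot a (rot (rot a))

  Rot-rot : ∀ {a b} → Rot a (rot b) → Rot a b
  Rot-rot r = go r refl
    where
    go : ∀ {a b c} → Rot a c → c ≡ rot b → Rot a b
    go rot⁰ refl = rot²
    go rot¹ refl = rot⁰
    go rot² refl = rot¹

  Mem : A → A × A × A → Set
  Mem v (x , y , z) = v ≡ x ⊎ v ≡ y ⊎ v ≡ z

  Rot-Mem : ∀ {a b v} → Rot a b → Mem v a → Mem v b
  Rot-Mem rot⁰ m = m
  Rot-Mem rot¹ (inj₁ e) = inj₂ (inj₂ e)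
  Rot-Mem rot¹ (inj₂ (inj₁ e)) = inj₁ e
  Rot-Mem rot¹ (inj₂ (inj₂ e)) = inj₂ (inj₁ e)
  Rot-Mem rot² (inj₁ e) = inj₂ (inj₁ e)
  Rot-Mem rot² (inj₂ (inj₁ e)) = inj₂ (inj₂ e)
  Rot-Mem rot² (inj₂ (inj₂ e)) = inj₁ e

  Rot-Mem⁻ : ∀ {a b v} → Rot a b → Mem v b → Mem v a
  Rot-Mem⁻ rot⁰ m = m
  Rot-Mem⁻ rot¹ (inj₁ e) = inj₂ (inj₁ e)
  Rot-Mem⁻ rot¹ (inj₂ (inj₁ e)) = inj₂ (inj₂ e)
  Rot-Mem⁻ rot¹ (inj₂ (inj₂ e)) = inj₁ e
  Rot-Mem⁻ rot² (inj₁ e) = inj₂ (inj₂ e)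
  Rot-Mem⁻ rot² (inj₂ (inj₁ e)) = inj₁ e
  Rot-Mem⁻ rot² (inj₂ (inj₂ e)) = inj₂ (inj₁ e)

map₃ : ∀ {A B : Set} → (A → B) → A × A × A → B × B × B
map₃ h (x , y , z) = h x , h y , h z

Rot-map : ∀ {A B : Set} (h : A → B) {a b} → Rot a b → Rot (map₃ h a) (map₃ h b)
Rot-map h rot⁰ = rot⁰
Rot-map h rot¹ = rot¹
Rot-map h rot² = rot²

-- The representative under rotation that `isTri` selects.
MinFirst : ∀ {n} → Fin n × Fin n × Fin n → Set
MinFirst (x , y , z) = toℕ x < toℕ y × toℕ x < toℕ z

minFirst-unique : ∀ {n} {a b : Fin n × Fin n × Fin n} → Rot a b → MinFirst a → MinFirst b → a ≡ b
minFirst-unique rot⁰ _ _ = refl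
minFirst-unique rot¹ (p , _) (_ , q) = ⊥-elim (<-asym p q)
minFirst-unique rot² (_ , p) (q , _) = ⊥-elim (<-asym p q)

minFirst-exists : ∀ {n} (x y z : Fin n) → x ≢ y → y ≢ z → z ≢ x → ∃ λ b → Rot (x , y , z) b × MinFirst b
minFirst-exists x y z xy yz zx with <-cmp (toℕ x) (toℕ y) | <-cmp (toℕ y) (toℕ z) | <-cmp (toℕ z) (toℕ x)
... | tri≈ _ e _ | _ | _ = ⊥-elim (xy (toℕ-injective e))
... | _ | tri≈ _ e _ | _ = ⊥-elim (yz (toℕ-injective e))
... | _ | _ | tri≈ _ e _ = ⊥-elim (zx (toℕ-injective e))
... | tri< p _ _ | _ | tri> _ _ q = _ , rot⁰ , p , q
... | tri> _ _ p | tri< q _ _ | _ = _ , rot¹ , q , p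
... | tri< p _ _ | tri> _ _ q | tri< r _ _ = _ , rot² , r , q
... | tri< p _ _ | tri< q _ _ | tri< r _ _ = ⊥-elim (<-irrefl refl (<-trans p (<-trans q r)))
... | tri> _ _ p | tri> _ _ q | tri< r _ _ = _ , rot² , r , q
... | tri> _ _ p | tri> _ _ q | tri> _ _ r = ⊥-elim (<-irrefl refl (<-trans r (<-trans q p)))

-- The number of 3-cycles as the size of an enumeration

count : ∀ {A : Set} → (A → Bool) → List A → ℕ
count p xs = length (filter (λ a → T? (p a)) xs)

count-++ : ∀ {A : Set} (p : A → Bool) xs ys → count p (xs ++ ys) ≡ count p xs + count p ys
count-++ p xs ys = trans (cong length (filter-++ (λ a → T? (p a)) xs ys)) (length-++ (filter (λ a → T? (p a)) xs))

count-map : ∀ {A B : Set} (p : B → Bool) (h : A → B) xs → count p (map h xs) ≡ count (p ∘ h) xs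
count-map p h [] = refl
count-map p h (x ∷ xs) with p (h x)
... | true  = cong suc (count-map p h xs)
... | false = count-map p h xs

count-indicator : ∀ {A : Set} (p : A → Bool) xs → sum (map (λ a → if p a then 1 else 0) xs) ≡ count p xs
count-indicator p [] = refl
count-indicator p (x ∷ xs) with p x
... | true  = cong suc (count-indicator p xs)
... | false = count-indicator p xs

count-product : ∀ {A B : Set} (p : A × B → Bool) (h : A → List ℕ) xs ys →
  (∀ x → sum (h x) ≡ count (λ y → p (x , y)) ys) → sum (concatMap h xs) ≡ count p (cartesianProduct xs ys)
count-product p h [] ys eq = refl
count-product p h (x ∷ xs) ys eq = begin
  sum (h x ++ concatMap h xs)                                ≡⟨ sum-++ (h x) (concatMap h xs) ⟩
  sum (h x) + sum (concatMap h xs)                           ≡⟨ cong₂ _+_ (eq x) (count-product p h xs ys eq) ⟩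
  count (λ y → p (x , y)) ys + count p (cartesianProduct xs ys) ≡⟨ cong (_+ _) (count-map p (x ,_) ys) ⟨
  count p (map (x ,_) ys) + count p (cartesianProduct xs ys) ≡⟨ count-++ p (map (x ,_) ys) _ ⟨
  count p (map (x ,_) ys ++ cartesianProduct xs ys)          ∎
  where open ≡-Reasoning

HasArrow : ∀ {n} → Quiver n → Fin n → Fin n → Set
HasArrow Q x y = ∃ λ a → src Q a ≡ x × tgt Q a ≡ y

Cyclic₃ : ∀ {n} → Quiver n → Fin n × Fin n × Fin n → Set
Cyclic₃ Q (x , y , z) = HasArrow Q x y × HasArrow Q y z × HasArrow Q z x

cyclic₃-rot : ∀ {n} {Q : Quiver n} {a b} → Rot a b → Cyclic₃ Q a → Cyclic₃ Q b
cyclic₃-rot rot⁰ c = c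
cyclic₃-rot rot¹ (p , q , r) = q , r , p
cyclic₃-rot rot² (p , q , r) = r , p , q

module _ {n} (Q : Quiver n) where
  private
    test : Fin n → Fin n → Fin (m Q) → Bool
    test x y a = ⌊ src Q a ≟ᶠ x ⌋ ∧ ⌊ tgt Q a ≟ᶠ y ⌋

  arr⁻ : ∀ x y → T (arr Q x y) → HasArrow Q x y
  arr⁻ x y t with find (any⁻ (test x y) (allFin (m Q)) t)
  ... | a , _ , ta with Equivalence.to (T-∧ {⌊ src Q a ≟ᶠ x ⌋}) ta
  ...   | s , g = a , toWitness s , toWitness g

  arr⁺ : ∀ x y → HasArrow Q x y → T (arr Q x y)
  arr⁺ x y (a , s , g) = any⁺ (test x y) (lose (∈-allFin a)
    (Equivalence.from (T-∧ {⌊ src Q a ≟ᶠ x ⌋}) (fromWitness s , fromWitness g)))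

  isTri⁻ : ∀ x y z → T (isTri Q x y z) → MinFirst (x , y , z) × Cyclic₃ Q (x , y , z)
  isTri⁻ x y z t with Equivalence.to (T-∧ {toℕ x <ᵇ toℕ y}) t
  ... | t₁ , u₁ with Equivalence.to (T-∧ {toℕ x <ᵇ toℕ z}) u₁
  ... | t₂ , u₂ with Equivalence.to (T-∧ {arr Q x y}) u₂
  ... | t₃ , u₃ with Equivalence.to (T-∧ {arr Q y z}) u₃
  ... | t₄ , t₅ = (<ᵇ⇒< _ _ t₁ , <ᵇ⇒< _ _ t₂) , arr⁻ x y t₃ , arr⁻ y z t₄ , arr⁻ z x t₅

  isTri⁺ : ∀ x y z → MinFirst (x , y , z) → Cyclic₃ Q (x , y , z) → T (isTri Q x y z)
  isTri⁺ x y z (p , q) (a , b , c) =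
    Equivalence.from T-∧ (<⇒<ᵇ p , Equivalence.from T-∧ (<⇒<ᵇ q ,
      Equivalence.from T-∧ (arr⁺ x y a , Equivalence.from T-∧ (arr⁺ y z b , arr⁺ z x c))))

  private
    isTri′ : Fin n × Fin n × Fin n → Bool
    isTri′ (x , y , z) = isTri Q x y z

    triples : List (Fin n × Fin n × Fin n)
    triples = cartesianProduct (allFin n) (cartesianProduct (allFin n) (allFin n))

    num3Cycles≡count : num3Cycles Q ≡ count isTri′ triples
    num3Cycles≡count = count-product isTri′ _ (allFin n) _ λ x →
      count-product (λ yz → isTri′ (x , yz)) _ (allFin n) _ λ y →
      count-indicator (λ z → isTri′ (x , y , z)) (allFin n)

  -- Filtering all triples and listing the values of `h` give two lists without repetition and with
  -- the same members, hence of the same length.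
  num3Cycles-enumerated : ∀ N (h : Fin N → Fin n × Fin n × Fin n) → (∀ {i j} → h i ≡ h j → i ≡ j) →
    (∀ i → MinFirst (h i) × Cyclic₃ Q (h i)) →
    (∀ a → MinFirst a → Cyclic₃ Q a → ∃ λ i → a ≡ h i) → num3Cycles Q ≡ N
  num3Cycles-enumerated N h inj sound complete = begin
    num3Cycles Q              ≡⟨ num3Cycles≡count ⟩
    count isTri′ triples      ≡⟨ ↭-length (∼bag⇒↭ (unique∧set⇒bag unique (tabulate⁺ inj) (mk⇔ to from))) ⟩
    length (tabulate h)       ≡⟨ length-tabulate h ⟩
    N                         ∎
    where
    open ≡-Reasoning
    unique : Unique (filter (λ a → T? (isTri′ a)) triples)
    unique = unique-filter⁺ (λ a → T? (isTri′ a)) (cartesianProduct⁺ (allFin⁺ n) (cartesianProduct⁺ (allFin⁺ n) (allFin⁺ n)))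
    to : ∀ {a} → a ∈ filter (λ a → T? (isTri′ a)) triples → a ∈ tabulate h
    to {a} a∈ with ∈-filter⁻ (λ a → T? (isTri′ a)) {xs = triples} a∈
    ... | _ , t with isTri⁻ _ _ _ t
    ...   | mf , cy with complete a mf cy
    ...     | i , refl = ∈-tabulate⁺ i
    from : ∀ {a} → a ∈ tabulate h → a ∈ filter (λ a → T? (isTri′ a)) triples
    from a∈ with ∈-tabulate⁻ a∈
    ... | i , refl = ∈-filter⁺ (λ a → T? (isTri′ a))
      (∈-cartesianProduct⁺ (∈-allFin _) (∈-cartesianProduct⁺ (∈-allFin _) (∈-allFin _)))
      (isTri⁺ _ _ _ (proj₁ (sound i)) (proj₂ (sound i)))

high₂≡high₃ : ∀ {t} (τ : Triangle t) → highT (side₂ τ) ≡ highT (side₃ τ)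
high₂≡high₃ top     = refl
high₂≡high₃ (inS τ) = cong inS (high₂≡high₃ τ)
high₂≡high₃ (inL τ) = cong inL (high₂≡high₃ τ)
high₂≡high₃ (inR τ) = cong inR (high₂≡high₃ τ)

-- Oriented triangles of the model

module ModelTriangles {ℓ : ℕ} (f : Fin (suc (suc ℓ)) → Letter) where
  open Cyclic {ℓ}
  open ModelProperties f

  corners : △ → V × V × V
  corners τ = source (edge₁ τ) , source (edge₂ τ) , source (edge₃ τ)

  apex-high₂ : ∀ τ → high (edge₂ τ) ≡ apex τ
  apex-high₂ (i , top p)   = refl
  apex-high₂ (i , sub p τ) = trans (cong (λ x → i , nd p x) (high₂≡high₃ τ)) (apex-high (i , sub p τ))

  corner₁-low : ∀ τ → rank (source (edge₁ τ)) < rank (apex τ)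
  corner₁-low τ with descends (edge₃ τ)
  ... | inj₁ b = ⊥-elim (edge₃≢base τ b)
  ... | inj₂ (inj₁ (_ , lt)) = subst (λ x → rank x < rank (apex τ)) (sym (source₁ τ)) lt
  ... | inj₂ (inj₂ (e , _)) = ⊥-elim (source≢target (edge₃ τ) (sym (trans e (apex-high τ))))

  corner₂-low : ∀ τ → rank (source (edge₂ τ)) < rank (apex τ)
  corner₂-low τ with descends (edge₂ τ)
  ... | inj₁ b = ⊥-elim (edge₂≢base τ b)
  ... | inj₂ (inj₂ (_ , lt)) = subst (λ x → rank (source (edge₂ τ)) < rank x) (sym (source₃ τ)) lt
  ... | inj₂ (inj₁ (e , _)) = ⊥-elim (source≢target (edge₂ τ) (trans (trans e (apex-high₂ τ)) (source₃ τ)))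

  corner-low : ∀ τ {x} → Mem x (corners τ) → x ≡ apex τ ⊎ rank x < rank (apex τ)
  corner-low τ (inj₁ refl) = inj₂ (corner₁-low τ)
  corner-low τ (inj₂ (inj₁ refl)) = inj₂ (corner₂-low τ)
  corner-low τ (inj₂ (inj₂ e)) = inj₁ e

  -- Within a triangle the apex has strictly the largest rank. If each apex is a corner of the other
  -- triangle, neither is higher, so the apexes coincide.
  corners-injective : ∀ τ τ′ → Mem (apex τ) (corners τ′) → Mem (apex τ′) (corners τ) → τ ≡ τ′
  corners-injective τ τ′ p q with corner-low τ′ p | corner-low τ q
  ... | inj₁ e | _ = apex-injective τ τ′ e
  ... | inj₂ _ | inj₁ e = apex-injective τ τ′ (sym e)
  ... | inj₂ lt | inj₂ gt = ⊥-elim (<-asym lt gt)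

  -- Two base arrows of different directions that met head to tail would be one and the same arrow.
  same-direction : ∀ i j → yEnd i ≡ xEnd j → dir (f i) ≡ dir (f j)
  same-direction i j e with dir (f i) in di | dir (f j) in dj
  ... | true  | true  = refl
  ... | false | false = refl
  ... | true  | false = trans (sym di) (trans (cong (dir ∘ f) (nxt-injective e)) dj)
  ... | false | true  = trans (sym di) (trans (cong (dir ∘ f) e) dj)

  ends : ∀ {i d} → dir (f i) ≡ d → xEnd i ≡ (if d then i else nxt i) × yEnd i ≡ (if d then nxt i else i)
  ends {i} e = cong (λ b → if b then i else nxt i) e , cong (λ b → if b then nxt i else i) e

  -- Head to tail, the three arrows have one direction, so three steps around the base return to the
  -- start. The base would consist of these arrows and be oriented.
  no-base-triangle : NonOriented f → ∀ i j h → yEnd i ≡ xEnd j → yEnd j ≡ xEnd h → yEnd h ≡ xEnd i → ⊥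
  no-base-triangle ((p , dp) , (q , dq)) i j h ij jh hi =
    go (dir (f i)) refl (sym (same-direction i j ij)) (sym (trans (same-direction i j ij) (same-direction j h jh)))
    where
    go : ∀ d → dir (f i) ≡ d → dir (f j) ≡ dir (f i) → dir (f h) ≡ dir (f i) → ⊥
    go true di ji hi′ = contra (nxt³≡id⇒three i (trans (cong nxt (trans (cong nxt i→j) j→h)) h→i) q)
      where
      dj = trans ji di
      dh = trans hi′ di
      i→j : nxt i ≡ j
      i→j = trans (sym (proj₂ (ends di))) (trans ij (proj₁ (ends dj)))
      j→h : nxt j ≡ h
      j→h = trans (sym (proj₂ (ends dj))) (trans jh (proj₁ (ends dh)))
      h→i : nxt h ≡ i
      h→i = trans (sym (proj₂ (ends dh))) (trans hi (proj₁ (ends di)))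
      contra : q ≡ i ⊎ q ≡ nxt i ⊎ q ≡ nxt (nxt i) → ⊥
      contra (inj₁ e) with () ← trans (sym di) (trans (cong (dir ∘ f) (sym e)) dq)
      contra (inj₂ (inj₁ e)) with () ← trans (sym dj) (trans (cong (dir ∘ f) (sym (trans e i→j))) dq)
      contra (inj₂ (inj₂ e)) with () ← trans (sym dh) (trans (cong (dir ∘ f) (sym (trans e (trans (cong nxt i→j) j→h)))) dq)
    go false di ji hi′ = contra (nxt³≡id⇒three i (trans (cong nxt (trans (cong nxt i→h) h→j)) j→i) p)
      where
      dj = trans ji di
      dh = trans hi′ di
      i→h : nxt i ≡ h
      i→h = sym (trans (sym (proj₂ (ends dh))) (trans hi (proj₁ (ends di))))
      h→j : nxt h ≡ j
      h→j = sym (trans (sym (proj₂ (ends dj))) (trans jh (proj₁ (ends dh))))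
      j→i : nxt j ≡ i
      j→i = sym (trans (sym (proj₂ (ends di))) (trans ij (proj₁ (ends dj))))
      contra : p ≡ i ⊎ p ≡ nxt i ⊎ p ≡ nxt (nxt i) → ⊥
      contra (inj₁ e) with () ← trans (sym di) (trans (cong (dir ∘ f) (sym e)) dp)
      contra (inj₂ (inj₁ e)) with () ← trans (sym dh) (trans (cong (dir ∘ f) (sym (trans e i→h))) dp)
      contra (inj₂ (inj₂ e)) with () ← trans (sym dj) (trans (cong (dir ∘ f) (sym (trans e (trans (cong nxt i→h) h→j)))) dp)

  module _ (no₂ : NonOriented f) where
    -- If the corner of largest rank is off the base, the arrows leaving and entering it both have
    -- it as higher end, so they are `edge₃` and `edge₂` of one triangle. If its rank is 0, all
    -- three arrows are base arrows.
    triangle-at-max : ∀ a b c → target a ≡ source b → target b ≡ source c → target c ≡ source a →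
      rank (source b) ≤ rank (source a) → rank (source c) ≤ rank (source a) →
      ∃ λ τ → Rot (corners τ) (source a , source b , source c)
    triangle-at-max a b c ab bc ca b≤a c≤a with rank (source a) ≟ 0
    ... | yes z = ⊥-elim (contra
            (ends-onBase a (rank0⇒onBase _ z) (subst OnBase (sym ab) ob))
            (ends-onBase b ob (subst OnBase (sym bc) oc))
            (ends-onBase c oc (subst OnBase (sym ca) (rank0⇒onBase _ z))))
      where
      ob = rank0⇒onBase (source b) (n≤0⇒n≡0 (subst (rank (source b) ≤_) z b≤a))
      oc = rank0⇒onBase (source c) (n≤0⇒n≡0 (subst (rank (source c) ≤_) z c≤a))
      contra : IsBase a → IsBase b → IsBase c → ⊥
      contra (i , refl) (j , refl) (h , refl) =
        no-base-triangle no₂ i j h (bs-injective ab) (bs-injective bc) (bs-injective ca)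
    ... | no nz = go (high-fibre a c (proj₁ H₁) (proj₁ H₂) same)
      where
      off : ¬ OnBase (source a)
      off o = nz (onBase⇒rank0 o)
      H₁ = link-high a (inj₁ (refl , ab)) off b≤a
      H₂ = link-high c (inj₂ (refl , ca)) off c≤a
      same : high a ≡ high c
      same = trans (proj₂ H₁) (sym (proj₂ H₂))
      go : a ≡ c ⊎ ApexEdges a c → ∃ λ τ → Rot (corners τ) (source a , source b , source c)
      go (inj₁ e) = ⊥-elim (source≢target a (sym (trans (cong target e) ca)))
      go (inj₂ A@(τ , inj₁ (ea , ec))) = ⊥-elim (source≢target c (sym (trans ca (trans (sym (proj₂ H₁))
        (trans (sym (ApexEdges-high A same)) (cong source (sym ec)))))))
      go (inj₂ (τ , inj₂ (refl , refl))) = τ , subst (λ y → Rot (corners τ) (apex τ , y , source (edge₂ τ)))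
        (trans (source₁ τ) ab) rot²

    triangle-complete : ∀ a b c → target a ≡ source b → target b ≡ source c → target c ≡ source a →
      ∃ λ τ → Rot (corners τ) (source a , source b , source c)
    triangle-complete a b c ab bc ca
      with ≤-total (rank (source b)) (rank (source a)) | ≤-total (rank (source c)) (rank (source a)) | ≤-total (rank (source c)) (rank (source b))
    ... | inj₁ b≤a | inj₁ c≤a | _ = triangle-at-max a b c ab bc ca b≤a c≤a
    ... | inj₂ a≤b | _ | inj₁ c≤b with triangle-at-max b c a bc ca ab c≤b a≤b
    ...   | τ , r = τ , Rot-rot r
    triangle-complete a b c ab bc ca | _ | inj₂ a≤c | inj₂ b≤c with triangle-at-max c a b ca ab bc a≤c b≤c
    ...   | τ , r = τ , Rot-rot (Rot-rot r)
    triangle-complete a b c ab bc ca | inj₁ b≤a | inj₂ a≤c | inj₁ c≤b with triangle-at-max c a b ca ab bc a≤c (≤-trans b≤a a≤c)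
    ...   | τ , r = τ , Rot-rot (Rot-rot r)
    triangle-complete a b c ab bc ca | inj₂ a≤b | inj₁ c≤a | inj₂ b≤c with triangle-at-max b c a bc ca ab (≤-trans c≤a a≤b) a≤b
    ...   | τ , r = τ , Rot-rot r

module _ {n} {Q : Quiver n} {ℓ} {f : Fin (suc (suc ℓ)) → Letter} (R : Real Q f) (no₂ : NonOriented f) where
  open Realized R
  open ModelTriangles f
  private
    triple : △ → Fin n × Fin n × Fin n
    triple τ = map₃ vt (corners τ)

    corners-cyclic : ∀ τ → Cyclic₃ Q (triple τ)
    corners-cyclic τ = (et (edge₁ τ) , src-ok _ , trans (tgt-ok _) (cong vt (sym (source₂ τ))))
                     , (et (edge₂ τ) , src-ok _ , trans (tgt-ok _) (cong vt (sym (source₃ τ))))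
                     , (et (edge₃ τ) , src-ok _ , trans (tgt-ok _) (cong vt (sym (source₁ τ))))

    distinct : ∀ {x y} → HasArrow Q x y → x ≢ y
    distinct (a , s , t) e = Valid.noLoops (valid′ no₂) a (trans s (trans e (sym t)))

    abstract
      first : ∀ τ → ∃ λ b → Rot (triple τ) b × MinFirst b
      first τ with corners-cyclic τ
      ... | p , q , r = minFirst-exists _ _ _ (distinct p) (distinct q) (distinct r)

    mem-vt : ∀ {x c} → Mem (vt x) (map₃ vt c) → Mem x c
    mem-vt (inj₁ e) = inj₁ (vt-inj e)
    mem-vt (inj₂ (inj₁ e)) = inj₂ (inj₁ (vt-inj e))
    mem-vt (inj₂ (inj₂ e)) = inj₂ (inj₂ (vt-inj e))

    shared : ∀ τ τ′ {b} → Rot (triple τ) b → Rot (triple τ′) b → Mem (apex τ) (corners τ′)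
    shared τ τ′ r r′ = mem-vt (Rot-Mem⁻ r′ (Rot-Mem r (inj₂ (inj₂ refl))))

    first-injective : ∀ τ τ′ → proj₁ (first τ) ≡ proj₁ (first τ′) → τ ≡ τ′
    first-injective τ τ′ e = corners-injective τ τ′ (shared τ τ′ r r′) (shared τ′ τ r′ r)
      where
      r = subst (Rot (triple τ)) e (proj₁ (proj₂ (first τ)))
      r′ = proj₁ (proj₂ (first τ′))

    complete : ∀ a → MinFirst a → Cyclic₃ Q a → ∃ λ τ → a ≡ proj₁ (first τ)
    complete (x , y , z) mf ((a , sa , ta) , (b , sb , tb) , (c , sc , tc))
      with triangle-complete no₂ (ef a) (ef b) (ef c) (join ta sb) (join tb sc) (join tc sa)
      where
      join : ∀ {a b y} → tgt Q a ≡ y → src Q b ≡ y → target (ef a) ≡ source (ef b)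
      join p q = trans (target-ef _) (trans (cong vf (trans p (sym q))) (sym (source-ef _)))
    ... | τ , r = τ , minFirst-unique (align (Rot-map vt r) (proj₁ (proj₂ (first τ)))) mf (proj₂ (proj₂ (first τ)))
      where
      vt-source : ∀ a {x} → src Q a ≡ x → vt (source (ef a)) ≡ x
      vt-source a e = trans (cong vt (source-ef a)) (trans (vt-vf _) e)
      eq : map₃ vt (source (ef a) , source (ef b) , source (ef c)) ≡ (x , y , z)
      eq = cong₂ _,_ (vt-source a sa) (cong₂ _,_ (vt-source b sb) (vt-source c sc))
      both : ∀ {t d e : Fin n × Fin n × Fin n} → Rot t d → Rot t e → Rot d e
      both rot⁰ r = r
      both rot¹ rot⁰ = rot²
      both rot¹ rot¹ = rot⁰
      both rot¹ rot² = rot¹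
      both rot² rot⁰ = rot¹
      both rot² rot¹ = rot²
      both rot² rot² = rot⁰
      align : ∀ {e} → Rot (triple τ) (map₃ vt (source (ef a) , source (ef b) , source (ef c))) → Rot (triple τ) e → Rot (x , y , z) e
      align r s = both (subst (Rot (triple τ)) eq r) s

  num3Cycles-triangles : ∀ {N} → △ ↔ Fin N → num3Cycles Q ≡ N
  num3Cycles-triangles {N} B = num3Cycles-enumerated Q N (λ i → proj₁ (first (Inverse.from B i)))
    (λ {i} {j} e → trans (sym (Inverse.strictlyInverseˡ B i)) (trans (cong (Inverse.to B) (first-injective _ _ e)) (Inverse.strictlyInverseˡ B j)))
    (λ i → proj₂ (proj₂ (first (Inverse.from B i))) , cyclic₃-rot (proj₁ (proj₂ (first (Inverse.from B i)))) (corners-cyclic (Inverse.from B i)))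
    (λ a mf cy → let (τ , e) = complete a mf cy in Inverse.to B τ , trans e (cong (proj₁ ∘ first) (sym (Inverse.strictlyInverseʳ B τ))))

-- Enumeration of words

size triangles : Shape → ℕ
size leaf       = 1
size (stem _ t) = 1 + size t
size (fork s t) = 1 + (size s + size t)
triangles leaf       = 0
triangles (stem _ t) = triangles t
triangles (fork s t) = 1 + (triangles s + triangles t)

weight weight△ : Letter → ℕ
weight (_ , nothing) = 1
weight (_ , just t)  = 1 + size t
weight△ (_ , nothing) = 0
weight△ (_ , just t)  = 1 + triangles t

_+↔_ : ∀ {A B : Set} {a b} → A ↔ Fin a → B ↔ Fin b → (A ⊎ B) ↔ Fin (a + b)
p +↔ q = ↔-sym +↔⊎ ↔-∘ (p ⊎-↔ q)

node↔ : ∀ t → Node t ↔ Fin (size t)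
node↔ leaf = mk↔ₛ′ (λ _ → zero) (λ _ → root) (λ { zero → refl }) (λ { root → refl })
node↔ (stem d t) = (↔-id (Fin 1) +↔ node↔ t) ↔-∘ mk↔ₛ′
  (λ { root → inj₁ zero ; (inS x) → inj₂ x }) (λ { (inj₁ _) → root ; (inj₂ x) → inS x })
  (λ { (inj₁ zero) → refl ; (inj₂ _) → refl }) (λ { root → refl ; (inS _) → refl })
node↔ (fork s t) = (↔-id (Fin 1) +↔ (node↔ s +↔ node↔ t)) ↔-∘ mk↔ₛ′
  (λ { root → inj₁ zero ; (inL x) → inj₂ (inj₁ x) ; (inR x) → inj₂ (inj₂ x) })
  (λ { (inj₁ _) → root ; (inj₂ (inj₁ x)) → inL x ; (inj₂ (inj₂ x)) → inR x })
  (λ { (inj₁ zero) → refl ; (inj₂ (inj₁ _)) → refl ; (inj₂ (inj₂ _)) → refl })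
  (λ { root → refl ; (inL _) → refl ; (inR _) → refl })

triangle↔ : ∀ t → Triangle t ↔ Fin (triangles t)
triangle↔ leaf = mk↔ₛ′ (λ ()) (λ ()) (λ ()) (λ ())
triangle↔ (stem d t) = triangle↔ t ↔-∘ mk↔ₛ′ (λ { (inS τ) → τ }) inS (λ _ → refl) (λ { (inS _) → refl })
triangle↔ (fork s t) = (↔-id (Fin 1) +↔ (triangle↔ s +↔ triangle↔ t)) ↔-∘ mk↔ₛ′
  (λ { top → inj₁ zero ; (inL x) → inj₂ (inj₁ x) ; (inR x) → inj₂ (inj₂ x) })
  (λ { (inj₁ _) → top ; (inj₂ (inj₁ x)) → inL x ; (inj₂ (inj₂ x)) → inR x })
  (λ { (inj₁ zero) → refl ; (inj₂ (inj₁ _)) → refl ; (inj₂ (inj₂ _)) → refl })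
  (λ { top → refl ; (inL _) → refl ; (inR _) → refl })

arrow↔ : ∀ t → ∃ λ n → Arrow t ↔ Fin n
arrow↔ leaf = 0 , mk↔ₛ′ (λ ()) (λ ()) (λ ()) (λ ())
arrow↔ (stem d t) = _ , (↔-id (Fin 1) +↔ proj₂ (arrow↔ t)) ↔-∘ mk↔ₛ′
  (λ { aS → inj₁ zero ; (inS x) → inj₂ x }) (λ { (inj₁ _) → aS ; (inj₂ x) → inS x })
  (λ { (inj₁ zero) → refl ; (inj₂ _) → refl }) (λ { aS → refl ; (inS _) → refl })
arrow↔ (fork s t) = _ , (↔-id (Fin 3) +↔ (proj₂ (arrow↔ s) +↔ proj₂ (arrow↔ t))) ↔-∘ mk↔ₛ′
  (λ { a₁ → inj₁ zero ; a₂ → inj₁ (suc zero) ; a₃ → inj₁ (suc (suc zero)) ; (inL x) → inj₂ (inj₁ x) ; (inR x) → inj₂ (inj₂ x) })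
  (λ { (inj₁ zero) → a₁ ; (inj₁ (suc zero)) → a₂ ; (inj₁ (suc (suc zero))) → a₃ ; (inj₂ (inj₁ x)) → inL x ; (inj₂ (inj₂ x)) → inR x })
  (λ { (inj₁ zero) → refl ; (inj₁ (suc zero)) → refl ; (inj₁ (suc (suc zero))) → refl ; (inj₂ (inj₁ _)) → refl ; (inj₂ (inj₂ _)) → refl })
  (λ { a₁ → refl ; a₂ → refl ; a₃ → refl ; (inL _) → refl ; (inR _) → refl })

localV↔ : ∀ x → LocalV (shape x) ↔ Fin (weight x)
localV↔ (_ , nothing) = mk↔ₛ′ (λ _ → zero) (λ _ → bs) (λ { zero → refl }) (λ { bs → refl ; (nd () _) })
localV↔ (_ , just t) = (↔-id (Fin 1) +↔ node↔ t) ↔-∘ mk↔ₛ′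
  (λ { bs → inj₁ zero ; (nd refl x) → inj₂ x }) (λ { (inj₁ _) → bs ; (inj₂ x) → nd refl x })
  (λ { (inj₁ zero) → refl ; (inj₂ _) → refl }) (λ { bs → refl ; (nd refl _) → refl })

local△↔ : ∀ x → LocalT (shape x) ↔ Fin (weight△ x)
local△↔ (_ , nothing) = mk↔ₛ′ (λ { (top ()) ; (sub () _) }) (λ ()) (λ ()) (λ { (top ()) ; (sub () _) })
local△↔ (_ , just t) = (↔-id (Fin 1) +↔ triangle↔ t) ↔-∘ mk↔ₛ′
  (λ { (top refl) → inj₁ zero ; (sub refl x) → inj₂ x }) (λ { (inj₁ _) → top refl ; (inj₂ x) → sub refl x })
  (λ { (inj₁ zero) → refl ; (inj₂ _) → refl }) (λ { (top refl) → refl ; (sub refl _) → refl })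

localE↔ : ∀ x → ∃ λ n → LocalE (shape x) ↔ Fin n
localE↔ (_ , nothing) = 1 , mk↔ₛ′ (λ _ → zero) (λ _ → ba) (λ { zero → refl }) (λ { ba → refl ; (ent ()) ; (ext ()) ; (sub () _) })
localE↔ (_ , just t) = _ , (↔-id (Fin 3) +↔ proj₂ (arrow↔ t)) ↔-∘ mk↔ₛ′
  (λ { ba → inj₁ zero ; (ent refl) → inj₁ (suc zero) ; (ext refl) → inj₁ (suc (suc zero)) ; (sub refl x) → inj₂ x })
  (λ { (inj₁ zero) → ba ; (inj₁ (suc zero)) → ent refl ; (inj₁ (suc (suc zero))) → ext refl ; (inj₂ x) → sub refl x })
  (λ { (inj₁ zero) → refl ; (inj₁ (suc zero)) → refl ; (inj₁ (suc (suc zero))) → refl ; (inj₂ _) → refl })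
  (λ { ba → refl ; (ent refl) → refl ; (ext refl) → refl ; (sub refl _) → refl })

-- Sums around the cycle

∑< : ℕ → (ℕ → ℕ) → ℕ
∑< n g = sum (applyUpTo g n)

Σ↔ : ∀ n {B : Fin n → Set} (g : ℕ → ℕ) → (∀ i → B i ↔ Fin (g (toℕ i))) → Σ (Fin n) B ↔ Fin (∑< n g)
Σ↔ zero g _ = mk↔ₛ′ (λ ()) (λ ()) (λ ()) (λ ())
Σ↔ (suc n) g b = (b zero +↔ Σ↔ n (g ∘ suc) (b ∘ suc)) ↔-∘ mk↔ₛ′
  (λ { (zero , x) → inj₁ x ; (suc i , x) → inj₂ (i , x) })
  (λ { (inj₁ x) → zero , x ; (inj₂ (i , x)) → suc i , x })
  (λ { (inj₁ _) → refl ; (inj₂ _) → refl }) (λ { (zero , _) → refl ; (suc _ , _) → refl })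

-- Indices are paired by `suc (i + j) ≡ n`, the form in which `Mirror` relates the two halves of the
-- cycle.
sum-reverse : ∀ n (g g′ : ℕ → ℕ) → (∀ i j → suc (i + j) ≡ n → g i ≡ g′ j) → ∑< n g ≡ ∑< n g′
sum-reverse zero    g g′ eq = refl
sum-reverse (suc n) g g′ eq = begin
  g 0 + ∑< n (g ∘ suc)             ≡⟨ cong₂ _+_ (eq 0 n refl) (sum-reverse n (g ∘ suc) g′ (λ i j e → eq (suc i) j (cong suc e))) ⟩
  g′ n + ∑< n g′                   ≡⟨ +-comm (g′ n) _ ⟩
  ∑< n g′ + g′ n                   ≡⟨ cong (∑< n g′ +_) (+-identityʳ (g′ n)) ⟨
  ∑< n g′ + (g′ n + 0)             ≡⟨ sum-++ (applyUpTo g′ n) [ g′ n ] ⟨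
  sum (applyUpTo g′ n ++ [ g′ n ]) ≡⟨ cong sum (applyUpTo-∷ʳ g′ n) ⟩
  ∑< (suc n) g′                    ∎
  where open ≡-Reasoning

∑<-+ : ∀ a b g → ∑< (a + b) g ≡ ∑< a g + ∑< b (λ i → g (a + i))
∑<-+ zero    b g = refl
∑<-+ (suc a) b g = trans (cong (g 0 +_) (∑<-+ a b (g ∘ suc))) (sym (+-assoc (g 0) _ _))

total : (Letter → ℕ) → List Letter → ℕ
total g w = sum (map g w)

sum-around : ∀ (g : Letter → ℕ) → (∀ x → g (flip x) ≡ g x) → ∀ w → 1 ≤ length w →
  ∑< (length w + length w) (g ∘ around w) ≡ 2 * total g w
sum-around g g-flip w@(x ∷ xs) ne = begin
  ∑< (t + t) (g ∘ around w)                                   ≡⟨ ∑<-+ t t (g ∘ around w) ⟩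
  ∑< t (g ∘ around w) + ∑< t (λ i → g (around w (t + i)))     ≡⟨ cong (∑< t (g ∘ around w) +_) (sum-reverse t _ _ opposite) ⟩
  ∑< t (g ∘ around w) + ∑< t (g ∘ around w)                   ≡⟨ cong (λ s → s + s) half ⟩
  total g w + total g w                                       ≡⟨ cong (total g w +_) (+-identityʳ (total g w)) ⟨
  2 * total g w                                               ∎
  where
  open ≡-Reasoning
  t = length w
  half : ∑< t (g ∘ around w) ≡ total g w
  half = cong sum (trans (sym (map-applyUpTo (around w) g t)) (cong (map g) (around-half x xs)))
  opposite : ∀ i j → suc (i + j) ≡ t → g (around w (t + i)) ≡ g (around w j)
  opposite i j e = trans (cong g (around-mirror x xs (t + i) j 1
    (trans (cong suc (+-assoc t i j)) (trans (sym (+-suc t (i + j))) (trans (cong (t +_) e) (sym (*-identityˡ (t + t))))))))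
    (g-flip _)

-- Words preceded by h pending rooted quivers: peeling off one root at a time is the first
-- step decomposition of a bicoloured Motzkin path from height h to 0.
Stack : ℕ → Set
Stack h = Vec Shape h × List Letter

totalˢ : ∀ {h} → (Shape → ℕ) → Vec Shape h → ℕ
totalˢ g []       = 0
totalˢ g (t ∷ ts) = g t + totalˢ g ts

weightˢ triangleˢ : ∀ {h} → Stack h → ℕ
weightˢ   (ts , w) = totalˢ size ts + total weight w
triangleˢ (ts , w) = totalˢ triangles ts + total weight△ w

bare : Bool → Stack 0 → Stack 0
bare d ([] , w) = [] , (d , nothing) ∷ w
decorated : Bool → Stack 1 → Stack 0
decorated d (t ∷ [] , w) = [] , (d , just t) ∷ w
leafˢ : ∀ {h} → Stack h → Stack (suc h)
leafˢ (ts , w) = leaf ∷ ts , w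
stemˢ : ∀ {h} → Bool → Stack (suc h) → Stack (suc h)
stemˢ d (t ∷ ts , w) = stem d t ∷ ts , w
forkˢ : ∀ {h} → Stack (suc (suc h)) → Stack (suc h)
forkˢ (s ∷ t ∷ ts , w) = fork s t ∷ ts , w

-- Undoing any constructor lowers the weight by one: it removes a bare letter, the base vertex of a
-- decorated letter, or the root of the first pending quiver. So the recursion is on the weight
-- alone, while the height may grow.
stacks : ∀ h → ℕ → List (Stack h)
stacks zero    zero    = [ [] , [] ]
stacks (suc h) zero    = []
stacks zero    (suc r) = map (bare true) (stacks 0 r) ++ (map (bare false) (stacks 0 r)
                          ++ (map (decorated true) (stacks 1 r) ++ map (decorated false) (stacks 1 r)))
stacks (suc h) (suc r) = map leafˢ (stacks h r) ++ (map (stemˢ true) (stacks (suc h) r)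
                          ++ (map (stemˢ false) (stacks (suc h) r) ++ map forkˢ (stacks (suc (suc h)) r)))

module _ {A : Set} {x : A} (as es cs ds : List A) where
  ∈₁ : x ∈ as → x ∈ as ++ (es ++ (cs ++ ds))
  ∈₁ = ∈-++⁺ˡ
  ∈₂ : x ∈ es → x ∈ as ++ (es ++ (cs ++ ds))
  ∈₂ = ∈-++⁺ʳ as ∘ ∈-++⁺ˡ
  ∈₃ : x ∈ cs → x ∈ as ++ (es ++ (cs ++ ds))
  ∈₃ = ∈-++⁺ʳ as ∘ ∈-++⁺ʳ es ∘ ∈-++⁺ˡ
  ∈₄ : x ∈ ds → x ∈ as ++ (es ++ (cs ++ ds))
  ∈₄ = ∈-++⁺ʳ as ∘ ∈-++⁺ʳ es ∘ ∈-++⁺ʳ cs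

  ∈-++₄⁻ : x ∈ as ++ (es ++ (cs ++ ds)) → x ∈ as ⊎ x ∈ es ⊎ x ∈ cs ⊎ x ∈ ds
  ∈-++₄⁻ x∈ with ∈-++⁻ as x∈
  ... | inj₁ p = inj₁ p
  ... | inj₂ q with ∈-++⁻ es q
  ...   | inj₁ p = inj₂ (inj₁ p)
  ...   | inj₂ q with ∈-++⁻ cs q
  ...     | inj₁ p = inj₂ (inj₂ (inj₁ p))
  ...     | inj₂ p = inj₂ (inj₂ (inj₂ p))

stacks-complete : ∀ {h} r (x : Stack h) → weightˢ x ≡ r → x ∈ stacks h r
stacks-complete zero ([] , []) _ = here refl
stacks-complete zero ([] , (d , nothing) ∷ w) ()
stacks-complete zero ([] , (d , just t) ∷ w) ()
stacks-complete zero (leaf ∷ ts , w) ()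
stacks-complete zero (stem _ _ ∷ ts , w) ()
stacks-complete zero (fork _ _ ∷ ts , w) ()
stacks-complete (suc r) ([] , []) ()
stacks-complete (suc r) ([] , (true , nothing) ∷ w) e =
  ∈₁ (map (bare true) (stacks 0 r)) (map (bare false) (stacks 0 r)) (map (decorated true) (stacks 1 r)) (map (decorated false) (stacks 1 r))
    (∈-map⁺ (bare true) (stacks-complete r ([] , w) (suc-injective e)))
stacks-complete (suc r) ([] , (false , nothing) ∷ w) e =
  ∈₂ (map (bare true) (stacks 0 r)) (map (bare false) (stacks 0 r)) (map (decorated true) (stacks 1 r)) (map (decorated false) (stacks 1 r))
    (∈-map⁺ (bare false) (stacks-complete r ([] , w) (suc-injective e)))
stacks-complete (suc r) ([] , (true , just t) ∷ w) e =
  ∈₃ (map (bare true) (stacks 0 r)) (map (bare false) (stacks 0 r)) (map (decorated true) (stacks 1 r)) (map (decorated false) (stacks 1 r))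
    (∈-map⁺ (decorated true) (stacks-complete r (t ∷ [] , w) (trans (cong (_+ total weight w) (+-identityʳ (size t))) (suc-injective e))))
stacks-complete (suc r) ([] , (false , just t) ∷ w) e =
  ∈₄ (map (bare true) (stacks 0 r)) (map (bare false) (stacks 0 r)) (map (decorated true) (stacks 1 r)) (map (decorated false) (stacks 1 r))
    (∈-map⁺ (decorated false) (stacks-complete r (t ∷ [] , w) (trans (cong (_+ total weight w) (+-identityʳ (size t))) (suc-injective e))))
stacks-complete {suc h} (suc r) (leaf ∷ ts , w) e =
  ∈₁ (map leafˢ (stacks h r)) (map (stemˢ true) (stacks (suc h) r)) (map (stemˢ false) (stacks (suc h) r)) (map forkˢ (stacks (suc (suc h)) r))
    (∈-map⁺ leafˢ (stacks-complete r (ts , w) (suc-injective e)))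
stacks-complete {suc h} (suc r) (stem true t ∷ ts , w) e =
  ∈₂ (map leafˢ (stacks h r)) (map (stemˢ true) (stacks (suc h) r)) (map (stemˢ false) (stacks (suc h) r)) (map forkˢ (stacks (suc (suc h)) r))
    (∈-map⁺ (stemˢ true) (stacks-complete r (t ∷ ts , w) (suc-injective e)))
stacks-complete {suc h} (suc r) (stem false t ∷ ts , w) e =
  ∈₃ (map leafˢ (stacks h r)) (map (stemˢ true) (stacks (suc h) r)) (map (stemˢ false) (stacks (suc h) r)) (map forkˢ (stacks (suc (suc h)) r))
    (∈-map⁺ (stemˢ false) (stacks-complete r (t ∷ ts , w) (suc-injective e)))
stacks-complete {suc h} (suc r) (fork s t ∷ ts , w) e =
  ∈₄ (map leafˢ (stacks h r)) (map (stemˢ true) (stacks (suc h) r)) (map (stemˢ false) (stacks (suc h) r)) (map forkˢ (stacks (suc (suc h)) r))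
    (∈-map⁺ forkˢ (stacks-complete r (s ∷ t ∷ ts , w)
      (trans (cong (_+ total weight w) (sym (+-assoc (size s) (size t) _))) (suc-injective e))))

stacks-sound : ∀ {h} r {x : Stack h} → x ∈ stacks h r → weightˢ x ≡ r
stacks-sound {zero} zero (here refl) = refl
stacks-sound {zero} (suc r) x∈ with ∈-++₄⁻ (map (bare true) (stacks 0 r)) (map (bare false) (stacks 0 r)) (map (decorated true) (stacks 1 r)) (map (decorated false) (stacks 1 r)) x∈
... | inj₁ p with ∈-map⁻ (bare true) p
...   | ([] , w) , y∈ , refl = cong suc (stacks-sound r y∈)
stacks-sound {zero} (suc r) x∈ | inj₂ (inj₁ p) with ∈-map⁻ (bare false) p
...   | ([] , w) , y∈ , refl = cong suc (stacks-sound r y∈)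
stacks-sound {zero} (suc r) x∈ | inj₂ (inj₂ (inj₁ p)) with ∈-map⁻ (decorated true) p
...   | (t ∷ [] , w) , y∈ , refl = cong suc (trans (cong (_+ total weight w) (sym (+-identityʳ (size t)))) (stacks-sound r y∈))
stacks-sound {zero} (suc r) x∈ | inj₂ (inj₂ (inj₂ p)) with ∈-map⁻ (decorated false) p
...   | (t ∷ [] , w) , y∈ , refl = cong suc (trans (cong (_+ total weight w) (sym (+-identityʳ (size t)))) (stacks-sound r y∈))
stacks-sound {suc h} (suc r) x∈ with ∈-++₄⁻ (map leafˢ (stacks h r)) (map (stemˢ true) (stacks (suc h) r)) (map (stemˢ false) (stacks (suc h) r)) (map forkˢ (stacks (suc (suc h)) r)) x∈
... | inj₁ p with ∈-map⁻ leafˢ p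
...   | (ts , w) , y∈ , refl = cong suc (stacks-sound r y∈)
stacks-sound {suc h} (suc r) x∈ | inj₂ (inj₁ p) with ∈-map⁻ (stemˢ true) p
...   | (t ∷ ts , w) , y∈ , refl = cong suc (stacks-sound r y∈)
stacks-sound {suc h} (suc r) x∈ | inj₂ (inj₂ (inj₁ p)) with ∈-map⁻ (stemˢ false) p
...   | (t ∷ ts , w) , y∈ , refl = cong suc (stacks-sound r y∈)
stacks-sound {suc h} (suc r) x∈ | inj₂ (inj₂ (inj₂ p)) with ∈-map⁻ forkˢ p
...   | (s ∷ t ∷ ts , w) , y∈ , refl = cong suc (trans (cong (_+ total weight w) (+-assoc (size s) (size t) _)) (stacks-sound r y∈))

module _ {A B D E X : Set} (f : A → X) (g : B → X) (h : D → X) (i : E → X)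
  (f-inj : ∀ {x y} → f x ≡ f y → x ≡ y) (g-inj : ∀ {x y} → g x ≡ g y → x ≡ y)
  (h-inj : ∀ {x y} → h x ≡ h y → x ≡ y) (i-inj : ∀ {x y} → i x ≡ i y → x ≡ y)
  (fg : ∀ x y → f x ≢ g y) (fh : ∀ x y → f x ≢ h y) (fi : ∀ x y → f x ≢ i y)
  (gh : ∀ x y → g x ≢ h y) (gi : ∀ x y → g x ≢ i y) (hi : ∀ x y → h x ≢ i y) where
  private
    apart : ∀ {A B : Set} (f : A → X) (g : B → X) → (∀ x y → f x ≢ g y) → ∀ {z as es} → z ∈ map f as → z ∈ map g es → ⊥
    apart f g ne p q with ∈-map⁻ f p | ∈-map⁻ g q
    ... | x , _ , e | y , _ , e′ = ne x y (trans (sym e) e′)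

  unique-map₄ : ∀ {as es cs ds} → Unique as → Unique es → Unique cs → Unique ds →
    Unique (map f as ++ (map g es ++ (map h cs ++ map i ds)))
  unique-map₄ {as} {es} {cs} {ds} ua ub uc ud =
    unique-++⁺ (unique-map⁺ f-inj ua)
      (unique-++⁺ (unique-map⁺ g-inj ub)
        (unique-++⁺ (unique-map⁺ h-inj uc) (unique-map⁺ i-inj ud) (λ (p , q) → apart h i hi p q))
        (λ (p , q) → notg p (∈-++⁻ (map h cs) q)))
      (λ (p , q) → notf p (∈-++⁻ (map g es) q))
    where
    notg : ∀ {z} → z ∈ map g es → z ∈ map h cs ⊎ z ∈ map i ds → ⊥
    notg p (inj₁ q) = apart g h gh p q
    notg p (inj₂ q) = apart g i gi p q
    notf : ∀ {z} → z ∈ map f as → z ∈ map g es ⊎ z ∈ map h cs ++ map i ds → ⊥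
    notf p (inj₁ q) = apart f g fg p q
    notf p (inj₂ q) with ∈-++⁻ (map h cs) q
    ... | inj₁ q′ = apart f h fh p q′
    ... | inj₂ q′ = apart f i fi p q′

stacks-unique : ∀ h r → Unique (stacks h r)
stacks-unique zero    zero    = [] ∷ []
stacks-unique (suc h) zero    = []
stacks-unique zero    (suc r) = unique-map₄ (bare true) (bare false) (decorated true) (decorated false)
  (λ { {[] , _} {[] , _} refl → refl }) (λ { {[] , _} {[] , _} refl → refl })
  (λ { {_ ∷ [] , _} {_ ∷ [] , _} refl → refl }) (λ { {_ ∷ [] , _} {_ ∷ [] , _} refl → refl })
  (λ { ([] , _) ([] , _) () }) (λ { ([] , _) (_ ∷ [] , _) () }) (λ { ([] , _) (_ ∷ [] , _) () })
  (λ { ([] , _) (_ ∷ [] , _) () }) (λ { ([] , _) (_ ∷ [] , _) () }) (λ { (_ ∷ [] , _) (_ ∷ [] , _) () })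
  (stacks-unique 0 r) (stacks-unique 0 r) (stacks-unique 1 r) (stacks-unique 1 r)
stacks-unique (suc h) (suc r) = unique-map₄ leafˢ (stemˢ true) (stemˢ false) forkˢ
  (λ { {_ , _} {_ , _} refl → refl }) (λ { {_ ∷ _ , _} {_ ∷ _ , _} refl → refl })
  (λ { {_ ∷ _ , _} {_ ∷ _ , _} refl → refl }) (λ { {_ ∷ _ ∷ _ , _} {_ ∷ _ ∷ _ , _} refl → refl })
  (λ { (_ , _) (_ ∷ _ , _) () }) (λ { (_ , _) (_ ∷ _ , _) () }) (λ { (_ , _) (_ ∷ _ ∷ _ , _) () })
  (λ { (_ ∷ _ , _) (_ ∷ _ , _) () }) (λ { (_ ∷ _ , _) (_ ∷ _ ∷ _ , _) () }) (λ { (_ ∷ _ , _) (_ ∷ _ ∷ _ , _) () })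
  (stacks-unique h r) (stacks-unique (suc h) r) (stacks-unique (suc h) r) (stacks-unique (suc (suc h)) r)

length-++₄ : ∀ {A : Set} (as es cs ds : List A) →
  length (as ++ (es ++ (cs ++ ds))) ≡ length as + (length es + (length cs + length ds))
length-++₄ as es cs ds = trans (length-++ as) (cong (length as +_)
  (trans (length-++ es) (cong (length es +_) (length-++ cs))))

-- Number of words of given weight

#stacks : ℕ → ℕ → ℕ
#stacks h r = length (stacks h r)

#stacks-zero : ∀ r → #stacks 0 (suc r) ≡ 2 * (#stacks 0 r + #stacks 1 r)
#stacks-zero r = trans
  (length-++₄ (map (bare true) (stacks 0 r)) (map (bare false) (stacks 0 r)) (map (decorated true) (stacks 1 r)) (map (decorated false) (stacks 1 r)))
  (trans (cong₂ _+_ (length-map (bare true) (stacks 0 r)) (cong₂ _+_ (length-map (bare false) (stacks 0 r)) (cong₂ _+_ (length-map (decorated true) (stacks 1 r)) (length-map (decorated false) (stacks 1 r)))))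
    (solve 2 (λ a b → a :+ (a :+ (b :+ b)) := con 2 :* (a :+ b)) refl (#stacks 0 r) (#stacks 1 r)))
  where open +-*-Solver

#stacks-suc : ∀ h r → #stacks (suc h) (suc r) ≡ #stacks h r + #stacks (suc h) r + (#stacks (suc h) r + #stacks (suc (suc h)) r)
#stacks-suc h r = trans
  (length-++₄ (map leafˢ (stacks h r)) (map (stemˢ true) (stacks (suc h) r)) (map (stemˢ false) (stacks (suc h) r)) (map forkˢ (stacks (suc (suc h)) r)))
  (trans (cong₂ _+_ (length-map leafˢ (stacks h r)) (cong₂ _+_ (length-map (stemˢ true) (stacks (suc h) r)) (cong₂ _+_ (length-map (stemˢ false) (stacks (suc h) r)) (length-map forkˢ (stacks (suc (suc h)) r)))))
    (sym (+-assoc (#stacks h r) (#stacks (suc h) r) _)))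

-- A step of a bicoloured path is a pair of steps ±1/2, so Pascal's rule applied twice is one step.
-- At height 0 the absent term from below is replaced by a second copy of the one from above.
#stacks≡C : ∀ h r → #stacks h r ≡ (r + r) C (r + h)
#stacks≡C zero    zero    = refl
#stacks≡C (suc h) zero    = sym (k>n⇒nCk≡0 {0} {suc h} (s≤s z≤n))
#stacks≡C zero    (suc r) = begin
  #stacks 0 (suc r)                              ≡⟨ #stacks-zero r ⟩
  2 * (#stacks 0 r + #stacks 1 r)                ≡⟨ cong (2 *_) (cong₂ _+_ (#stacks≡C 0 r) (#stacks≡C 1 r)) ⟩
  2 * ((r + r) C (r + 0) + (r + r) C (r + 1))    ≡⟨ cong (2 *_) (cong₂ _+_ (cong ((r + r) C_) (+-identityʳ r)) (cong ((r + r) C_) (+-comm r 1))) ⟩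
  2 * ((r + r) C r + (r + r) C suc r)            ≡⟨ cong (2 *_) (nCk+nC[k+1]≡[n+1]C[k+1] (r + r) r) ⟩
  2 * (suc (r + r) C suc r)                      ≡⟨ cong (suc (r + r) C suc r +_) (+-identityʳ _) ⟩
  suc (r + r) C suc r + suc (r + r) C suc r      ≡⟨ cong (_+ suc (r + r) C suc r) middle ⟨
  suc (r + r) C r + suc (r + r) C suc r          ≡⟨ nCk+nC[k+1]≡[n+1]C[k+1] (suc (r + r)) r ⟩
  suc (suc (r + r)) C suc r                      ≡⟨ cong₂ _C_ (cong suc (sym (+-suc r r))) (cong suc (sym (+-identityʳ r))) ⟩
  (suc r + suc r) C (suc r + 0)                  ∎
  where
  open ≡-Reasoning
  -- The symmetry of the binomials reflects that heights 1 and -1 contribute alike.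
  middle : suc (r + r) C r ≡ suc (r + r) C suc r
  middle = trans (nCk≡nC[n∸k] (m≤n⇒m≤1+n (m≤m+n r r)))
    (cong (suc (r + r) C_) (trans (cong (_∸ r) (sym (+-suc r r))) (m+n∸m≡n r (suc r))))
#stacks≡C (suc h) (suc r) = begin
  #stacks (suc h) (suc r)
    ≡⟨ #stacks-suc h r ⟩
  #stacks h r + #stacks (suc h) r + (#stacks (suc h) r + #stacks (suc (suc h)) r)
    ≡⟨ cong₂ _+_ (cong₂ _+_ (#stacks≡C h r) (trans (#stacks≡C (suc h) r) (cong ((r + r) C_) (+-suc r h))))
        (cong₂ _+_ (trans (#stacks≡C (suc h) r) (cong ((r + r) C_) (+-suc r h)))
                   (trans (#stacks≡C (suc (suc h)) r) (cong ((r + r) C_) (trans (+-suc r (suc h)) (cong suc (+-suc r h)))))) ⟩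
  (r + r) C (r + h) + (r + r) C suc (r + h) + ((r + r) C suc (r + h) + (r + r) C suc (suc (r + h)))
    ≡⟨ cong₂ _+_ (nCk+nC[k+1]≡[n+1]C[k+1] (r + r) (r + h)) (nCk+nC[k+1]≡[n+1]C[k+1] (r + r) (suc (r + h))) ⟩
  suc (r + r) C suc (r + h) + suc (r + r) C suc (suc (r + h))
    ≡⟨ nCk+nC[k+1]≡[n+1]C[k+1] (suc (r + r)) (suc (r + h)) ⟩
  suc (suc (r + r)) C suc (suc (r + h))
    ≡⟨ cong₂ _C_ (cong suc (sym (+-suc r r))) (cong suc (sym (+-suc r h))) ⟩
  (suc r + suc r) C (suc r + suc h) ∎
  where open ≡-Reasoning

-- Number of words of given weight and number of triangles

with△ : ∀ {h} → ℕ → List (Stack h) → List (Stack h)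
with△ j = filter (λ x → triangleˢ x ≟ j)

module _ {h h′} (g : Stack h → Stack h′) where
  with△-map : (∀ x → triangleˢ (g x) ≡ triangleˢ x) → ∀ j xs → length (with△ j (map g xs)) ≡ length (with△ j xs)
  with△-map eq j [] = refl
  with△-map eq j (x ∷ xs) rewrite eq x with does (triangleˢ x ≟ j)
  ... | true  = cong suc (with△-map eq j xs)
  ... | false = with△-map eq j xs

  with△-map-suc : (∀ x → triangleˢ (g x) ≡ suc (triangleˢ x)) → ∀ j xs → length (with△ (suc j) (map g xs)) ≡ length (with△ j xs)
  with△-map-suc eq j [] = refl
  -- The tests of `suc (triangleˢ x)` against `suc j` and of `triangleˢ x` against `j` reduce to
  -- this same Boolean.
  with△-map-suc eq j (x ∷ xs) rewrite eq x with triangleˢ x ≡ᵇ j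
  ... | true  = cong suc (with△-map-suc eq j xs)
  ... | false = with△-map-suc eq j xs

  with△-map-zero : (∀ x → triangleˢ (g x) ≡ suc (triangleˢ x)) → ∀ xs → length (with△ 0 (map g xs)) ≡ 0
  with△-map-zero eq [] = refl
  with△-map-zero eq (x ∷ xs) rewrite eq x = with△-map-zero eq xs

triangle-bare : ∀ d x → triangleˢ (bare d x) ≡ triangleˢ x
triangle-bare d ([] , w) = refl

triangle-decorated : ∀ d x → triangleˢ (decorated d x) ≡ suc (triangleˢ x)
triangle-decorated d (t ∷ [] , w) = cong (λ n → suc (n + total weight△ w)) (sym (+-identityʳ (triangles t)))

triangle-leaf : ∀ {h} (x : Stack h) → triangleˢ (leafˢ x) ≡ triangleˢ x
triangle-leaf _ = refl

triangle-stem : ∀ {h} d (x : Stack (suc h)) → triangleˢ (stemˢ d x) ≡ triangleˢ x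
triangle-stem d (_ ∷ _ , _) = refl

triangle-fork : ∀ {h} (x : Stack (suc (suc h))) → triangleˢ (forkˢ x) ≡ suc (triangleˢ x)
triangle-fork (s ∷ t ∷ ts , w) = cong (λ n → suc (n + total weight△ w)) (+-assoc (triangles s) (triangles t) _)

#△ : ℕ → ℕ → ℕ → ℕ
#△ h r j = length (with△ j (stacks h r))

with△-++₄ : ∀ {h} j (as es cs ds : List (Stack h)) →
  length (with△ j (as ++ (es ++ (cs ++ ds))))
    ≡ length (with△ j as) + (length (with△ j es) + (length (with△ j cs) + length (with△ j ds)))
with△-++₄ j as es cs ds = trans (cong length
  (trans (filter-++ _ as _) (cong (with△ j as ++_) (trans (filter-++ _ es _) (cong (with△ j es ++_) (filter-++ _ cs _))))))
  (length-++₄ (with△ j as) (with△ j es) (with△ j cs) (with△ j ds))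

module _ (r : ℕ) where
  private
    split : ∀ j → #△ 0 (suc r) j ≡ #△ 0 r j + (#△ 0 r j + (length (with△ j (map (decorated true) (stacks 1 r))) + length (with△ j (map (decorated false) (stacks 1 r)))))
    split j = trans (with△-++₄ j (map (bare true) (stacks 0 r)) (map (bare false) (stacks 0 r)) (map (decorated true) (stacks 1 r)) (map (decorated false) (stacks 1 r)))
      (cong₂ _+_ (with△-map (bare true) (triangle-bare true) j (stacks 0 r)) (cong₂ _+_ (with△-map (bare false) (triangle-bare false) j (stacks 0 r)) refl))

  #△-zero-zero : #△ 0 (suc r) 0 ≡ 2 * #△ 0 r 0
  #△-zero-zero = trans (split 0) (cong₂ (λ a b → #△ 0 r 0 + (#△ 0 r 0 + (a + b)))
      (with△-map-zero (decorated true) (triangle-decorated true) (stacks 1 r)) (with△-map-zero (decorated false) (triangle-decorated false) (stacks 1 r)))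

  #△-zero-suc : ∀ j → #△ 0 (suc r) (suc j) ≡ 2 * #△ 0 r (suc j) + 2 * #△ 1 r j
  #△-zero-suc j = trans (split (suc j)) (trans (cong₂ (λ a b → #△ 0 r (suc j) + (#△ 0 r (suc j) + (a + b)))
      (with△-map-suc (decorated true) (triangle-decorated true) j (stacks 1 r)) (with△-map-suc (decorated false) (triangle-decorated false) j (stacks 1 r)))
      (solve 2 (λ a b → a :+ (a :+ (b :+ b)) := con 2 :* a :+ con 2 :* b) refl (#△ 0 r (suc j)) (#△ 1 r j)))
    where open +-*-Solver

module _ (h r : ℕ) where
  private
    split : ∀ j → #△ (suc h) (suc r) j ≡ #△ h r j + (#△ (suc h) r j + (#△ (suc h) r j + length (with△ j (map forkˢ (stacks (suc (suc h)) r)))))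
    split j = trans (with△-++₄ j (map leafˢ (stacks h r)) (map (stemˢ true) (stacks (suc h) r)) (map (stemˢ false) (stacks (suc h) r)) (map forkˢ (stacks (suc (suc h)) r)))
      (cong₂ _+_ (with△-map leafˢ triangle-leaf j (stacks h r)) (cong₂ _+_ (with△-map (stemˢ true) (triangle-stem true) j (stacks (suc h) r))
        (cong₂ _+_ (with△-map (stemˢ false) (triangle-stem false) j (stacks (suc h) r)) refl)))

  #△-suc-zero : #△ (suc h) (suc r) 0 ≡ #△ h r 0 + 2 * #△ (suc h) r 0
  #△-suc-zero = trans (split 0) (cong (λ a → #△ h r 0 + (#△ (suc h) r 0 + (#△ (suc h) r 0 + a)))
    (with△-map-zero forkˢ triangle-fork (stacks (suc (suc h)) r)))

  #△-suc-suc : ∀ j → #△ (suc h) (suc r) (suc j) ≡ #△ h r (suc j) + 2 * #△ (suc h) r (suc j) + #△ (suc (suc h)) r j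
  #△-suc-suc j = trans (split (suc j)) (trans (cong (λ a → #△ h r (suc j) + (#△ (suc h) r (suc j) + (#△ (suc h) r (suc j) + a)))
    (with△-map-suc forkˢ triangle-fork j (stacks (suc (suc h)) r)))
    (solve 3 (λ a b c → a :+ (b :+ (b :+ c)) := a :+ con 2 :* b :+ c) refl (#△ h r (suc j)) (#△ (suc h) r (suc j)) (#△ (suc (suc h)) r j)))
    where open +-*-Solver

-- A path from height h to 0 with j up steps needs j + h down steps, hence has length at least h +
-- 2j.
#△-vanish : ∀ h r j → r < h + (j + j) → #△ h r j ≡ 0
#△-vanish zero    zero    (suc j) _ = refl
#△-vanish (suc h) zero    j       _ = refl
#△-vanish zero    (suc r) zero    ()
#△-vanish zero    (suc r) (suc j) (s≤s lt) = trans (#△-zero-suc r j) (cong₂ (λ a b → 2 * a + 2 * b)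
  (#△-vanish 0 r (suc j) (m≤n⇒m≤1+n lt)) (#△-vanish 1 r j (≤-trans lt (≤-reflexive (+-suc j j)))))
#△-vanish (suc h) (suc r) zero    (s≤s lt) = trans (#△-suc-zero h r) (cong₂ (λ a b → a + 2 * b)
  (#△-vanish h r 0 lt) (#△-vanish (suc h) r 0 (m≤n⇒m≤1+n lt)))
#△-vanish (suc h) (suc r) (suc j) (s≤s lt) = trans (#△-suc-suc h r j) (cong₂ _+_ (cong₂ (λ a b → a + 2 * b)
  (#△-vanish h r (suc j) lt) (#△-vanish (suc h) r (suc j) (m≤n⇒m≤1+n lt)))
  (#△-vanish (suc (suc h)) r j (≤-trans lt (≤-reflexive (trans (+-suc h (j + suc j)) (cong suc (trans (cong (h +_) (+-suc j j)) (+-suc h (j + j)))))))))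

-- With denominators cleared: e level steps in two colours, j up and j + h down steps. Up and down
-- refer to |height|, but the end points and the number of level steps fix how many there are of
-- each, so the count is that of unrestricted paths on the integers.
Multinomial : ℕ → Set
Multinomial r = ∀ h j e → r ≡ e + (h + (j + j)) → #△ h r j * (j ! * (j + h) ! * e !) ≡ 2 ^ e * r !

module _ {r : ℕ} (IH : Multinomial r) where
  -- Among the arrangements of the r + 1 steps, those that begin with a given kind of step form a
  -- share proportional to the number of steps of that kind. This lemma and the next two compute the
  -- shares of the three kinds; added up they give the factor `suc r`.
  level-share : ∀ h j e → suc r ≡ e + (h + (j + j)) → 2 * #△ h r j * (j ! * (j + h) ! * e !) ≡ 2 ^ e * r ! * e
  -- Without level steps nothing can begin with one: r steps are too few for h + 2j, in accordance
  -- with the factor 0.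
  level-share h j zero eq = trans (cong (λ c → 2 * c * (j ! * (j + h) ! * 0 !)) (#△-vanish h r j (≤-reflexive eq)))
    (sym (*-zeroʳ (2 ^ 0 * r !)))
  level-share h j (suc e) eq = begin
    2 * #△ h r j * (j ! * (j + h) ! * (suc e * e !))
      ≡⟨ solve 5 (λ c J H E F → con 2 :* c :* (J :* H :* (E :* F)) := con 2 :* E :* (c :* (J :* H :* F))) refl (#△ h r j) (j !) ((j + h) !) (suc e) (e !) ⟩
    2 * suc e * (#△ h r j * (j ! * (j + h) ! * e !))
      ≡⟨ cong (2 * suc e *_) (IH h j e (suc-injective eq)) ⟩
    2 * suc e * (2 ^ e * r !)
      ≡⟨ solve 3 (λ E P R → con 2 :* E :* (P :* R) := con 2 :* P :* R :* E) refl (suc e) (2 ^ e) (r !) ⟩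
    2 * 2 ^ e * r ! * suc e ∎
    where
    open ≡-Reasoning
    open +-*-Solver

  down-share : ∀ h j e → r ≡ e + (h + (j + j)) → #△ h r j * (j ! * (j + suc h) ! * e !) ≡ 2 ^ e * r ! * (j + suc h)
  down-share h j e eq = begin
    #△ h r j * (j ! * (j + suc h) ! * e !)
      ≡⟨ cong (λ n → #△ h r j * (j ! * n ! * e !)) (+-suc j h) ⟩
    #△ h r j * (j ! * (suc (j + h) * (j + h) !) * e !)
      ≡⟨ solve 5 (λ c J D H E → c :* (J :* (D :* H) :* E) := c :* (J :* H :* E) :* D) refl (#△ h r j) (j !) (suc (j + h)) ((j + h) !) (e !) ⟩
    #△ h r j * (j ! * (j + h) ! * e !) * suc (j + h)
      ≡⟨ cong₂ _*_ (IH h j e eq) (sym (+-suc j h)) ⟩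
    2 ^ e * r ! * (j + suc h) ∎
    where
    open ≡-Reasoning
    open +-*-Solver

  up-share : ∀ h j e → r ≡ e + (suc h + (j + j)) → #△ (suc h) r j * (suc j ! * (suc j + h) ! * e !) ≡ 2 ^ e * r ! * suc j
  up-share h j e eq = begin
    #△ (suc h) r j * (suc j * j ! * (suc j + h) ! * e !)
      ≡⟨ cong (λ n → #△ (suc h) r j * (suc j * j ! * n ! * e !)) (sym (+-suc j h)) ⟩
    #△ (suc h) r j * (suc j * j ! * (j + suc h) ! * e !)
      ≡⟨ solve 5 (λ c D J H E → c :* (D :* J :* H :* E) := c :* (J :* H :* E) :* D) refl (#△ (suc h) r j) (suc j) (j !) ((j + suc h) !) (e !) ⟩
    #△ (suc h) r j * (j ! * (j + suc h) ! * e !) * suc j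
      ≡⟨ cong (_* suc j) (IH (suc h) j e eq) ⟩
    2 ^ e * r ! * suc j ∎
    where
    open ≡-Reasoning
    open +-*-Solver

#△-multinomial : ∀ r → Multinomial r
#△-multinomial zero zero zero zero eq = refl
#△-multinomial zero zero zero (suc e) ()
#△-multinomial zero zero (suc j) e eq with () ← trans eq (+-suc e _)
#△-multinomial zero (suc h) j e eq with () ← trans eq (+-suc e _)
#△-multinomial (suc r) zero zero e eq = begin
  #△ 0 (suc r) 0 * D             ≡⟨ cong (_* D) (#△-zero-zero r) ⟩
  2 * #△ 0 r 0 * D               ≡⟨ level-share (#△-multinomial r) 0 0 e eq ⟩
  2 ^ e * r ! * e                ≡⟨ cong (2 ^ e * r ! *_) (trans (sym (+-identityʳ e)) (sym eq)) ⟩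
  2 ^ e * r ! * suc r            ≡⟨ solve 3 (λ P F R → P :* F :* R := P :* (R :* F)) refl (2 ^ e) (r !) (suc r) ⟩
  2 ^ e * (suc r * r !)          ∎
  where
  D = 0 ! * 0 ! * e !
  open ≡-Reasoning
  open +-*-Solver
#△-multinomial (suc r) zero (suc j) e eq = begin
  #△ 0 (suc r) (suc j) * D                          ≡⟨ cong (_* D) (#△-zero-suc r j) ⟩
  (2 * #△ 0 r (suc j) + 2 * #△ 1 r j) * D           ≡⟨ solve 3 (λ a b D → (con 2 :* a :+ con 2 :* b) :* D := con 2 :* a :* D :+ con 2 :* (b :* D)) refl (#△ 0 r (suc j)) (#△ 1 r j) D ⟩
  -- At height 0 a step that is not level leads away from 0, upwards or downwards. The doubled up
  -- share stands in for the absent down share.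
  2 * #△ 0 r (suc j) * D + 2 * (#△ 1 r j * D)       ≡⟨ cong₂ (λ a b → a + 2 * b) (level-share (#△-multinomial r) 0 (suc j) e eq) (up-share (#△-multinomial r) 0 j e eq′) ⟩
  2 ^ e * r ! * e + 2 * (2 ^ e * r ! * suc j)       ≡⟨ solve 3 (λ A e j → A :* e :+ con 2 :* (A :* j) := A :* (e :+ (j :+ j))) refl (2 ^ e * r !) e (suc j) ⟩
  2 ^ e * r ! * (e + (suc j + suc j))               ≡⟨ cong (2 ^ e * r ! *_) (sym eq) ⟩
  2 ^ e * r ! * suc r                               ≡⟨ solve 3 (λ P F R → P :* F :* R := P :* (R :* F)) refl (2 ^ e) (r !) (suc r) ⟩
  2 ^ e * (suc r * r !)                             ∎
  where
  D = suc j ! * (suc j + 0) ! * e !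
  open ≡-Reasoning
  open +-*-Solver
  eq′ : r ≡ e + (1 + (j + j))
  eq′ = suc-injective (trans eq (solve 2 (λ e j → e :+ ((con 1 :+ j) :+ (con 1 :+ j)) := con 1 :+ (e :+ (con 1 :+ (j :+ j)))) refl e j))
#△-multinomial (suc r) (suc h) zero e eq = begin
  #△ (suc h) (suc r) 0 * D                          ≡⟨ cong (_* D) (#△-suc-zero h r) ⟩
  (#△ h r 0 + 2 * #△ (suc h) r 0) * D               ≡⟨ *-distribʳ-+ D (#△ h r 0) (2 * #△ (suc h) r 0) ⟩
  #△ h r 0 * D + 2 * #△ (suc h) r 0 * D             ≡⟨ cong₂ _+_ (down-share (#△-multinomial r) h 0 e eq′) (level-share (#△-multinomial r) (suc h) 0 e eq) ⟩
  2 ^ e * r ! * suc h + 2 ^ e * r ! * e             ≡⟨ solve 3 (λ A h e → A :* h :+ A :* e := A :* (e :+ (h :+ con 0))) refl (2 ^ e * r !) (suc h) e ⟩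
  2 ^ e * r ! * (e + (suc h + 0))                   ≡⟨ cong (2 ^ e * r ! *_) (sym eq) ⟩
  2 ^ e * r ! * suc r                               ≡⟨ solve 3 (λ P F R → P :* F :* R := P :* (R :* F)) refl (2 ^ e) (r !) (suc r) ⟩
  2 ^ e * (suc r * r !)                             ∎
  where
  D = 0 ! * suc h ! * e !
  open ≡-Reasoning
  open +-*-Solver
  eq′ : r ≡ e + (h + (0 + 0))
  eq′ = suc-injective (trans eq (+-suc e _))
#△-multinomial (suc r) (suc h) (suc j) e eq = begin
  #△ (suc h) (suc r) (suc j) * D
    ≡⟨ cong (_* D) (#△-suc-suc h r j) ⟩
  (#△ h r (suc j) + 2 * #△ (suc h) r (suc j) + #△ (suc (suc h)) r j) * D
    ≡⟨ solve 4 (λ a b c D → (a :+ b :+ c) :* D := a :* D :+ b :* D :+ c :* D) refl (#△ h r (suc j)) (2 * #△ (suc h) r (suc j)) (#△ (suc (suc h)) r j) D ⟩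
  #△ h r (suc j) * D + 2 * #△ (suc h) r (suc j) * D + #△ (suc (suc h)) r j * D
    ≡⟨ cong₂ _+_ (cong₂ _+_ (down-share (#△-multinomial r) h (suc j) e eq′) (level-share (#△-multinomial r) (suc h) (suc j) e eq)) (up-share (#△-multinomial r) (suc h) j e eq″) ⟩
  2 ^ e * r ! * (suc j + suc h) + 2 ^ e * r ! * e + 2 ^ e * r ! * suc j
    ≡⟨ solve 4 (λ A h j e → A :* (j :+ h) :+ A :* e :+ A :* j := A :* (e :+ (h :+ (j :+ j)))) refl (2 ^ e * r !) (suc h) (suc j) e ⟩
  2 ^ e * r ! * (e + (suc h + (suc j + suc j)))
    ≡⟨ cong (2 ^ e * r ! *_) (sym eq) ⟩
  2 ^ e * r ! * suc r
    ≡⟨ solve 3 (λ P F R → P :* F :* R := P :* (R :* F)) refl (2 ^ e) (r !) (suc r) ⟩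
  2 ^ e * (suc r * r !) ∎
  where
  D = suc j ! * (suc j + suc h) ! * e !
  open ≡-Reasoning
  open +-*-Solver
  eq′ : r ≡ e + (h + (suc j + suc j))
  eq′ = suc-injective (trans eq (+-suc e _))
  eq″ : r ≡ e + (suc (suc h) + (j + j))
  eq″ = suc-injective (trans eq (solve 3 (λ e h j → e :+ (con 1 :+ h :+ ((con 1 :+ j) :+ (con 1 :+ j))) := con 1 :+ (e :+ (con 2 :+ h :+ (j :+ j)))) refl e h j))

-- Symmetric quivers and words

record Transversal {A : Set} (φ : A → A) (xs : List A) : Set where
  field
    reps      : List A
    unique    : Unique reps
    within    : ∀ {x} → x ∈ reps → x ∈ xs
    meets     : ∀ {x} → x ∈ xs → x ∈ reps ⊎ φ x ∈ reps
    separated : ∀ {x} → x ∈ reps → φ x ∉ reps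
    halves    : 2 * length reps ≡ length xs

-- One member of a pair is chosen and both are removed. What remains is not structurally smaller,
-- hence the bound `n` on the length as recursion measure.
transversal : ∀ {A : Set} (φ : A → A) (xs : List A) → Unique xs →
  (∀ {x} → x ∈ xs → φ x ∈ xs) → (∀ {x} → x ∈ xs → φ (φ x) ≡ x) → (∀ {x} → x ∈ xs → φ x ≢ x) → Transversal φ xs
transversal {A} φ xs = go (length xs) xs ≤-refl
  where
  go : ∀ n xs → length xs ≤ n → Unique xs → (∀ {x} → x ∈ xs → φ x ∈ xs) → (∀ {x} → x ∈ xs → φ (φ x) ≡ x) →
       (∀ {x} → x ∈ xs → φ x ≢ x) → Transversal φ xs
  go _ [] _ _ _ _ _ = record
    { reps = [] ; unique = [] ; within = λ () ; meets = λ () ; separated = λ () ; halves = refl }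
  go (suc n) (x ∷ rest) (s≤s le) u cl inv nofix with cl (here refl)
  ... | here e = ⊥-elim (nofix (here refl) e)
  ... | there φx∈ with ∈-∃++ φx∈
  ...   | ys , zs , refl = record
    { reps = x ∷ reps rest-T
    ; unique = All.tabulate (λ v∈ e → x∉ (subst (_∈ xs′) (sym e) (within rest-T v∈))) ∷ unique rest-T
    ; within = λ { (here refl) → here refl ; (there v∈) → from (within rest-T v∈) }
    ; meets = λ v∈ → meet (∈-resp-↭ perm v∈)
    ; separated = sep
    ; halves = trans (cong (1 +_) (+-suc (length (reps rest-T)) (length (reps rest-T) + 0)))
                     (trans (cong (2 +_) (halves rest-T)) (sym (↭-length perm))) }
    where
    open Transversal
    xs′ = ys ++ zs
    perm : x ∷ (ys ++ φ x ∷ zs) ↭ x ∷ φ x ∷ xs′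
    perm = prep x (↭-shift (φ x) ys zs)
    from : ∀ {v} → v ∈ xs′ → v ∈ x ∷ (ys ++ φ x ∷ zs)
    from v∈ = ∈-resp-↭ (↭-sym perm) (there (there v∈))
    u′ : Unique (x ∷ φ x ∷ xs′)
    u′ = Unique-resp-↭ (setoid A) (↭⇒↭ₛ perm) u
    x∉ : x ∉ xs′
    x∉ v∈ with u′
    ... | (_ ∷ a) ∷ _ = All.lookup a v∈ refl
    φx∉ : φ x ∉ xs′
    φx∉ v∈ with u′
    ... | _ ∷ (a ∷ _) = All.lookup a v∈ refl
    u″ : Unique xs′
    u″ with u′
    ... | _ ∷ (_ ∷ u) = u
    cl′ : ∀ {v} → v ∈ xs′ → φ v ∈ xs′
    cl′ {v} v∈ with ∈-resp-↭ perm (cl (from v∈))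
    ... | here e = ⊥-elim (φx∉ (subst (_∈ xs′) (trans (sym (inv (from v∈))) (cong φ e)) v∈))
    ... | there (here e) = ⊥-elim (x∉ (subst (_∈ xs′) (trans (sym (inv (from v∈))) (trans (cong φ e) (inv (here refl)))) v∈))
    ... | there (there w∈) = w∈
    len : length xs′ ≤ n
    len = ≤-trans (n≤1+n _) (≤-trans (≤-reflexive (sym (suc-injective (↭-length perm)))) le)
    rest-T = go n xs′ len u″ cl′ (λ v∈ → inv (from v∈)) (λ v∈ → nofix (from v∈))
    meet : ∀ {v} → v ∈ x ∷ φ x ∷ xs′ → v ∈ x ∷ reps rest-T ⊎ φ v ∈ x ∷ reps rest-T
    meet (here e) = inj₁ (here e)
    meet (there (here refl)) = inj₂ (here (inv (here refl)))
    meet (there (there v∈)) with meets rest-T v∈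
    ... | inj₁ r = inj₁ (there r)
    ... | inj₂ r = inj₂ (there r)
    sep : ∀ {v} → v ∈ x ∷ reps rest-T → φ v ∉ x ∷ reps rest-T
    sep (here refl) (here e) = nofix (here refl) e
    sep (here refl) (there r) = φx∉ (within rest-T r)
    sep (there v∈) (here e) = φx∉ (subst (_∈ xs′) (trans (sym (inv (from (within rest-T v∈)))) (cong φ e)) (within rest-T v∈))
    sep (there v∈) (there r) = separated rest-T v∈ r

lookup-injective : ∀ {A : Set} {xs : List A} → Unique xs → ∀ i j → lookup xs i ≡ lookup xs j → i ≡ j
lookup-injective (_ ∷ _) zero zero _ = refl
lookup-injective {xs = _ ∷ xs} (a ∷ _) zero (suc j) e = ⊥-elim (All.lookup a (∈-lookup {xs = xs} j) e)
lookup-injective {xs = _ ∷ xs} (a ∷ _) (suc i) zero e = ⊥-elim (All.lookup a (∈-lookup {xs = xs} i) (sym e))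
lookup-injective (_ ∷ u) (suc i) (suc j) e = cong suc (lookup-injective u i j e)

-- An equation links the cycle length to the word, because `length w + length w` is not of the form
-- `suc (suc ℓ)` that cyclic indices require.
record Realizes {n} (Q : Quiver n) (w : List Letter) : Set where
  constructor realizes
  field
    {ℓʷ} : ℕ
    len  : suc (suc ℓʷ) ≡ length w + length w
    real : Real Q {ℓʷ} (around w ∘ toℕ)

module _ (w : List Letter) {ℓ : ℕ} (len : suc (suc ℓ) ≡ length w + length w) where
  open Cyclic {ℓ}

  private
    f : Fin k′ → Letter
    f = around w ∘ toℕ

  nonempty : 1 ≤ length w
  nonempty = go w len
    where
    go : ∀ w → suc (suc ℓ) ≡ length w + length w → 1 ≤ length w
    go [] ()
    go (_ ∷ _) _ = s≤s z≤n

  around-mirror-k : ∀ i j q → suc (i + j) ≡ q * k′ → around w i ≡ flip (around w j)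
  around-mirror-k i j q e = around-mirror′ w nonempty i j q (trans e (cong (q *_) len))

  around-% : ∀ n → around w (n % k′) ≡ around w n
  around-% n = sym (go k′ len n)
    where
    go : ∀ k .{{_ : NonZero k}} → k ≡ length w + length w → ∀ n → around w n ≡ around w (n % k)
    go _ refl n = reduce-period {length w} (mirror⇒halfPeriod nonempty (around-mirror′ w nonempty)) n

  -- The first and the last base arrow meet at the starting vertex on the axis, so they are mirror
  -- images. Their opposite directions make the cycle non-oriented.
  last-flip : f zero ≡ flip (f (fromℕ (suc ℓ)))
  last-flip = around-mirror-k 0 (toℕ (fromℕ (suc ℓ))) 1 (trans (cong suc (toℕ-fromℕ (suc ℓ))) (sym (*-identityˡ k′)))

  around-nonOriented : NonOriented f
  around-nonOriented with dir (f zero) in d₀ | dir (f (fromℕ (suc ℓ))) in d₁ | cong dir last-flip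
  ... | true  | false | _ = (zero , d₀) , (fromℕ (suc ℓ) , d₁)
  ... | false | true  | _ = (fromℕ (suc ℓ) , d₁) , (zero , d₀)
  ... | true  | true  | ()
  ... | false | false | ()

  -- On a cycle of length 2 the two arrows are the first and the last one, hence mirror images with
  -- equal shapes. This makes the ambiguity of double arrows harmless.
  double-arrow : ∀ {i j} → j ≡ nxt i → nxt (nxt i) ≡ i → shape (f i) ≡ shape (f j)
  double-arrow {i} refl two with nxt²≡id⇒two i two zero | nxt²≡id⇒two i two (fromℕ (suc ℓ))
  ... | inj₁ p | inj₂ q = trans (cong (shape ∘ f) (sym p)) (trans (cong shape last-flip) (cong (shape ∘ f) q))
  ... | inj₂ p | inj₁ q = sym (trans (cong (shape ∘ f) (sym p)) (trans (cong shape last-flip) (cong (shape ∘ f) q)))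
  ... | inj₁ p | inj₁ q with () ← trans p (sym q)
  ... | inj₂ p | inj₂ q with () ← trans p (sym q)

  around-parallel : ParallelEqual f
  around-parallel i j x y with dir (f i) | dir (f j)
  ... | true  | true  = cong (shape ∘ f) x
  ... | false | false = cong (shape ∘ f) y
  ... | true  | false = double-arrow (sym y) (trans (cong nxt y) (sym x))
  ... | false | true  = double-arrow (sym x) (trans (cong nxt x) (sym y))

  -- Reflection with c equal to 0 is i ↦ -1 - i, the pairing of `Mirror`.
  around-revE : ∀ i → f (revE zero i) ≡ flip (f i)
  around-revE i with m%n≡0⇒n∣m (toℕ (revE zero i) + suc (toℕ i)) k′
                       (trans (sym (toℕ-⊕ (revE zero i) (suc (toℕ i)))) (cong toℕ (revE-⊕ zero i)))
  ... | divides q e = around-mirror-k (toℕ (revE zero i)) (toℕ i) q (trans (sym (+-suc _ _)) e)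

  vertices↔ : Model.V f ↔ Fin (2 * total weight w)
  vertices↔ = subst (λ n → Model.V f ↔ Fin n)
    (trans (cong (λ k → ∑< k (weight ∘ around w)) len) (sum-around weight weight-flip w nonempty))
    (Σ↔ k′ (weight ∘ around w) (λ i → localV↔ (f i)))
    where
    weight-flip : ∀ x → weight (flip x) ≡ weight x
    weight-flip (_ , nothing) = refl
    weight-flip (_ , just _)  = refl

  triangles↔ : Model.△ f ↔ Fin (2 * total weight△ w)
  triangles↔ = subst (λ n → Model.△ f ↔ Fin n)
    (trans (cong (λ k → ∑< k (weight△ ∘ around w)) len) (sum-around weight△ weight△-flip w nonempty))
    (Σ↔ k′ (weight△ ∘ around w) (λ i → local△↔ (f i)))
    where
    weight△-flip : ∀ x → weight△ (flip x) ≡ weight△ x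
    weight△-flip (_ , nothing) = refl
    weight△-flip (_ , just _)  = refl

  arrows↔ : ∃ λ n → Model.E f ↔ Fin n
  arrows↔ = _ , Σ↔ k′ (proj₁ ∘ localE↔ ∘ around w) (λ i → proj₂ (localE↔ (f i)))

module _ {n} {Q : Quiver n} {w : List Letter} where
  realizes-inQ : Realizes Q w → InQ Q
  realizes-inQ (realizes len R) = Realized.inQ R (around-nonOriented w len)

  realizes-symmetric : Realizes Q w → Symmetric Q
  realizes-symmetric (realizes len R) = symmetric R (around-nonOriented w len) zero (around-revE w len)

  realizes-weight : Realizes Q w → n ≡ 2 * total weight w
  realizes-weight (realizes len R) = ↔⇒≡ (vertices↔ w len ↔-∘ ↔-sym (Real.vm R))

  realizes-num3Cycles : Realizes Q w → num3Cycles Q ≡ 2 * total weight△ w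
  realizes-num3Cycles (realizes len R) = num3Cycles-triangles R (around-nonOriented w len) (triangles↔ w len)

  realizes-partner : Realizes Q w → Realizes Q (partner w)
  realizes-partner (realizes {ℓ} len R) = realizes (trans len (cong (λ t → t + t) (sym (length-partner w))))
    (rotate R (around (partner w) ∘ toℕ) (partnerShift w) λ i → begin
      around w (toℕ (i ⊕ partnerShift w))                ≡⟨ cong (around w) (toℕ-⊕ i (partnerShift w)) ⟩
      around w ((toℕ i + partnerShift w) % k′)           ≡⟨ around-% w len (toℕ i + partnerShift w) ⟩
      around w (toℕ i + partnerShift w)                  ≡⟨ around-partner w (nonempty w len) (toℕ i) ⟨
      around (partner w) (toℕ i)                         ∎)
    where
    open ≡-Reasoning
    open Cyclic {ℓ}

  realizes-≅ : ∀ {Q′ : Quiver n} → Realizes Q w → Realizes Q′ w → Q ≅ Q′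
  realizes-≅ (realizes len R) (realizes len′ R′) with refl ← trans len (sym len′) = Real-≅ R R′

  ≅-realizes : ∀ {Q′ : Quiver n} → Q ≅ Q′ → Realizes Q w → Realizes Q′ w
  ≅-realizes I (realizes len R) = realizes len (≅-Real I R)

build : ∀ w → 1 ≤ length w → Σ (Quiver (2 * total weight w)) λ Q → Realizes Q w
build w@(_ ∷ xs) _ = Q , realizes len record
  { vm = vertices↔ w len ; em = E↔
  ; src-ok = λ a → cong (to ∘ source) (Inverse.strictlyInverseʳ E↔ a)
  ; tgt-ok = λ a → cong (to ∘ target) (Inverse.strictlyInverseʳ E↔ a) }
  where
  len : suc (suc (length xs + length xs)) ≡ length w + length w
  len = cong suc (sym (+-suc (length xs) (length xs)))
  open Model (around w ∘ toℕ {suc (suc (length xs + length xs))})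
  to = Inverse.to (vertices↔ w len)
  E↔ = proj₂ (arrows↔ w len)
  Q : Quiver (2 * total weight w)
  Q = quiver _ (to ∘ source ∘ Inverse.from E↔) (to ∘ target ∘ Inverse.from E↔)

-- The words of one quiver

module _ {w w′ : List Letter} {ℓ} (len : suc (suc ℓ) ≡ length w + length w) (len′ : suc (suc ℓ) ≡ length w′ + length w′) where
  open Cyclic {ℓ}

  half-injective : ∀ {a b} → a + a ≡ b + b → a ≡ b
  half-injective {a} {b} e = *-cancelˡ-≡ a b 2 (trans (cong (a +_) (+-identityʳ a)) (trans e (cong (b +_) (sym (+-identityʳ b)))))

  -- A map that commutes with `nxt` is the shift by its value at 0, which brings the question down
  -- to rotations of sequences.
  rotation-words : (π : Fin k′ → Fin k′) → (∀ i → π (nxt i) ≡ nxt (π i)) →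
    (∀ i → around w′ (toℕ (π i)) ≡ around w (toℕ i)) → w ≡ w′ ⊎ w ≡ partner w′
  rotation-words π comm eq = around-rotation w w′ (nonempty w len) (half-injective (trans (sym len) len′)) c λ n → begin
    around w′ (n + c)                ≡⟨ cong (around w′) (+-comm n c) ⟩
    around w′ (c + n)                ≡⟨ around-% w′ len′ (c + n) ⟨
    around w′ ((c + n) % k′)         ≡⟨ cong (around w′) (toℕ-⊕ (π zero) n) ⟨
    around w′ (toℕ (π zero ⊕ n))     ≡⟨ cong (around w′ ∘ toℕ) (walk n) ⟨
    around w′ (toℕ (π (zero ⊕ n)))   ≡⟨ eq (zero ⊕ n) ⟩
    around w (toℕ (zero ⊕ n))        ≡⟨ cong (around w) (toℕ-⊕ zero n) ⟩
    around w (n % k′)                ≡⟨ around-% w len n ⟩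
    around w n                       ∎
    where
    open ≡-Reasoning
    c = toℕ (π zero)
    walk : ∀ n → π (zero ⊕ n) ≡ π zero ⊕ n
    walk zero    = trans (cong π (⊕-identityʳ zero)) (sym (⊕-identityʳ (π zero)))
    walk (suc n) = begin
      π (zero ⊕ suc n)    ≡⟨ cong π (⊕-suc zero n) ⟩
      π (nxt (zero ⊕ n))  ≡⟨ comm (zero ⊕ n) ⟩
      nxt (π (zero ⊕ n))  ≡⟨ cong nxt (walk n) ⟩
      nxt (π zero ⊕ n)    ≡⟨ ⊕-suc (π zero) n ⟨
      π zero ⊕ suc n      ∎

  module _ {n} {Q : Quiver n} (R : Real Q {ℓ} (around w ∘ toℕ)) (S : Real Q {ℓ} (around w′ ∘ toℕ)) where
    same-length-words : w ≡ w′ ⊎ w ≡ partner w′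
    same-length-words with dihedral R S (around-nonOriented w len) (around-nonOriented w′ len′) (around-parallel w len) (around-parallel w′ len′)
    ... | inj₁ (π , comm , eq) = rotation-words π comm eq
    -- Composed with the mirror reflection of `w`, a matching that reverses the order becomes a
    -- rotation, and the two flips cancel.
    ... | inj₂ (π , comm , eq) = rotation-words (π ∘ revE zero)
      (λ i → sym (trans (cong (nxt ∘ π) (sym (back i))) (comm (revE zero (nxt i)))))
      (λ i → trans (eq (revE zero i)) (trans (cong flip (around-revE w len i)) (flip-involutive _)))
      where
      back : ∀ i → nxt (revE zero (nxt i)) ≡ revE zero i
      back i = trans (nxt-revE zero (nxt i)) (revV-nxt zero i)

realizes-unique : ∀ {n} {Q : Quiver n} {w w′} → Realizes Q w → Realizes Q w′ → w ≡ w′ ⊎ w ≡ partner w′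
realizes-unique {w = w} {w′} (realizes len R) (realizes len′ S)
  with refl ← compare-length R S (around-nonOriented w len) (around-nonOriented w′ len′) = same-length-words len len′ R S

-- A reflection of the cycle fixes no base arrow, since it reverses the cyclic direction; so
-- its axis passes through two vertices.
module _ {n} {Q : Quiver n} {ℓ} (f : Fin (suc (suc ℓ)) → Letter) (R : Real Q f)
  (c : Fin (suc (suc ℓ))) (sym-f : ∀ i → f (revE c i) ≡ flip (f i)) where
  open Cyclic {ℓ}

  no-fixed-arrow : ∀ i → revE c i ≢ i
  no-fixed-arrow i e = flip≢id (f i) (trans (cong f (sym e)) (sym-f i))

  -- The reflection takes arrow i to arrow c - 1 - i, so 2i + 1 congruent to c modulo `k′` would
  -- make it a fixed arrow.
  axis-through-arrow : ∀ i q → i < k′ → suc (i + i) ≡ toℕ c + q * k′ → ⊥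
  axis-through-arrow i q i<k e = no-fixed-arrow j (⊕-injective (suc (toℕ j)) (trans (revE-⊕ c j) (toℕ-injective (begin
    toℕ c                        ≡⟨ toℕ% c ⟨
    toℕ c % k′                   ≡⟨ [m+kn]%n≡m%n (toℕ c) q k′ ⟨
    (toℕ c + q * k′) % k′        ≡⟨ cong (_% k′) e ⟨
    suc (i + i) % k′             ≡⟨ cong (_% k′) (+-suc i i) ⟨
    (i + suc i) % k′             ≡⟨ cong (λ x → (x + suc x) % k′) (toℕ-fromℕ< i<k) ⟨
    (toℕ j + suc (toℕ j)) % k′   ≡⟨ toℕ-⊕ j (suc (toℕ j)) ⟨
    toℕ (j ⊕ suc (toℕ j))        ∎))))
    where
    open ≡-Reasoning
    j = fromℕ< i<k

  axis-vertex : ∃ λ e → ∃ λ t → toℕ c ≡ e + e × k′ ≡ t + t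
  axis-vertex with even⊎odd (toℕ c) | even⊎odd k′
  -- If c is 2e + 1, the arrow e would be fixed.
  ... | e , inj₂ odd | _ = ⊥-elim (axis-through-arrow e 0 (≤-<-trans (≤-trans (m≤m+n e e) (n≤1+n _)) (subst (_< k′) odd (toℕ<n c)))
                             (trans (sym odd) (sym (+-identityʳ (toℕ c)))))
  ... | e , inj₁ even | t , inj₁ even′ = e , t , even , even′
  -- If c is 2e and `k′` is 2t + 1, then 2(e + t) + 1 is c + `k′`, and the arrow e + t would be
  -- fixed.
  ... | e , inj₁ even | t , inj₂ odd = ⊥-elim (axis-through-arrow (e + t) 1
          (subst (e + t <_) (sym odd) (s≤s (+-monoˡ-≤ t e≤t)))
          (trans (solve 2 (λ e t → con 1 :+ (e :+ t :+ (e :+ t)) := e :+ e :+ (con 1 :+ (t :+ t) :+ con 0)) refl e t)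
                 (cong₂ (λ a b → a + (b + 0)) (sym even) (sym odd))))
    where
    open +-*-Solver
    e≤t : e ≤ t
    e≤t with e ≤? t
    ... | yes p = p
    ... | no ¬p = ⊥-elim (<⇒≱ (subst₂ _<_ even odd (toℕ<n c)) (+-mono-≤ (≰⇒> ¬p) (<⇒≤ (≰⇒> ¬p))))

  symmetric-word : ∃ λ w → Realizes Q w
  symmetric-word with axis-vertex
  -- Since c is 2e, the vertex e lies on the axis; the reading starts there.
  ... | e , t , c≡ , k≡ = w , realizes (trans k≡ (cong (λ x → x + x) (sym lw)))
          (rotate R (around w ∘ toℕ) e (λ i → sym (around-applyUpTo t≥1 mirror (toℕ i))))
    where
    open ≡-Reasoning
    u : ℕ → Letter
    u i = f ((i + e) mod k′)
    w = applyUpTo u t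
    lw : length w ≡ t
    lw = length-applyUpTo u t
    t≥1 : 1 ≤ t
    t≥1 = go t k≡
      where
      go : ∀ t → k′ ≡ t + t → 1 ≤ t
      go (suc _) _ = s≤s z≤n
    mirror : Mirror t u
    mirror i j q eq = trans (cong f (⊕-injective (suc (toℕ b)) (trans (toℕ-injective a+b) (sym (revE-⊕ c b))))) (sym-f b)
      where
      a = (i + e) mod k′
      b = (j + e) mod k′
      rearrange : ∀ i j e → i + e + suc (j + e) ≡ e + e + suc (i + j)
      rearrange = solve 3 (λ i j e → i :+ e :+ (con 1 :+ (j :+ e)) := e :+ e :+ (con 1 :+ (i :+ j))) refl
        where open +-*-Solver
      a+b : toℕ (a ⊕ suc (toℕ b)) ≡ toℕ c
      a+b = begin
        toℕ (a ⊕ suc (toℕ b))                    ≡⟨ toℕ-⊕ a (suc (toℕ b)) ⟩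
        (toℕ a + suc (toℕ b)) % k′               ≡⟨ cong₂ (λ x y → (x + suc y) % k′) (toℕ-mod (i + e) k′) (toℕ-mod (j + e) k′) ⟩
        ((i + e) % k′ + suc ((j + e) % k′)) % k′ ≡⟨ [m%k+n]%k (i + e) (suc ((j + e) % k′)) k′ ⟩
        (i + e + suc ((j + e) % k′)) % k′        ≡⟨ cong (_% k′) (trans (+-suc (i + e) _) (+-comm (suc (i + e)) _)) ⟩
        ((j + e) % k′ + suc (i + e)) % k′        ≡⟨ [m%k+n]%k (j + e) (suc (i + e)) k′ ⟩
        (j + e + suc (i + e)) % k′               ≡⟨ cong (_% k′) (trans (rearrange j i e) (cong (λ x → e + e + suc x) (+-comm j i))) ⟩
        (e + e + suc (i + j)) % k′               ≡⟨ cong₂ (λ x y → (x + y) % k′) (sym c≡) (trans eq (cong (q *_) (sym k≡))) ⟩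
        (toℕ c + q * k′) % k′                    ≡⟨ [m+kn]%n≡m%n (toℕ c) q k′ ⟩
        toℕ c % k′                               ≡⟨ toℕ% c ⟩
        toℕ c                                    ∎

abstract
  recognize : ∀ {n} {Q : Quiver n} → InQ Q → Symmetric Q → ∃ λ w → Realizes Q w
  recognize {Q = Q} I S = symmetric-word letters realization (Symmetric.shift S) (symmetric-letters noLoop S)
    where
    noLoop : ∀ a → src Q a ≢ tgt Q a
    noLoop = Valid.noLoops (InQ.valid I)
    open Recognize noLoop (Symmetric.cyc S) (Symmetric.attach S)

-- From words to isomorphism classes

module _ {r : ℕ} (r≥1 : 1 ≤ r) (P : Quiver (2 * r) → Set) (ws : List (List Letter)) (unique-ws : Unique ws)
  (weights : ∀ {w} → w ∈ ws → total weight w ≡ r)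
  (shaped : ∀ {Q} → P Q → InQ Q × Symmetric Q)
  (sound : ∀ {Q w} → w ∈ ws → Realizes Q w → P Q)
  (complete : ∀ {Q w} → P Q → Realizes Q w → w ∈ ws) where
  private
    nonempty-word : ∀ {w} → w ∈ ws → 1 ≤ length w
    nonempty-word {w} w∈ = go w (weights w∈)
      where
      go : ∀ w → total weight w ≡ r → 1 ≤ length w
      go [] e with () ← ≤-trans r≥1 (≤-reflexive (sym e))
      go (_ ∷ _) _ = s≤s z≤n

    abstract
      quiverOf : ∀ {w} → w ∈ ws → Σ (Quiver (2 * r)) λ Q → Realizes Q w
      quiverOf {w} w∈ = subst (λ s → Σ (Quiver (2 * s)) λ Q → Realizes Q w) (weights w∈) (build w (nonempty-word w∈))

    -- Obtained by way of quivers: the partner describes the same quiver, which has the property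
    -- `P`, so `complete` puts the partner into the list. No weight of a partner has to be computed.
    partner-closed : ∀ {w} → w ∈ ws → partner w ∈ ws
    partner-closed {w} w∈ with quiverOf w∈
    ... | Q , R = complete {Q} {partner w} (sound w∈ R) (realizes-partner {w = w} R)

    abstract
      chosen : Transversal partner ws
      chosen = transversal partner ws unique-ws partner-closed
        (λ {w} w∈ → partner-involutive w (nonempty-word w∈)) (λ {w} w∈ → partner≢id w (nonempty-word w∈))
    open Transversal chosen

    word : Fin (length reps) → List Letter
    word = lookup reps

    word∈ : ∀ i → word i ∈ ws
    word∈ i = within (∈-lookup {xs = reps} i)

    rep′ : Fin (length reps) → Quiver (2 * r)
    rep′ i = proj₁ (quiverOf (word∈ i))

    rep′-realizes : ∀ i → Realizes (rep′ i) (word i)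
    rep′-realizes i = proj₂ (quiverOf (word∈ i))

    rep′-distinct : ∀ i j → rep′ i ≅ rep′ j → i ≡ j
    rep′-distinct i j I = go (realizes-unique {w = word i} {word j} (≅-realizes {w = word i} I (rep′-realizes i)) (rep′-realizes j))
      where
      go : word i ≡ word j ⊎ word i ≡ partner (word j) → i ≡ j
      go (inj₁ e) = lookup-injective unique i j e
      go (inj₂ e) = ⊥-elim (separated (∈-lookup {xs = reps} j) (subst (_∈ reps) e (∈-lookup {xs = reps} i)))

    represented : ∀ {Q} w → Realizes Q w → w ∈ reps → ∃ λ i → Q ≅ rep′ i
    represented {Q} w R w∈ = index w∈ ,
      realizes-≅ {w = word (index w∈)} (subst (Realizes Q) (lookup-index w∈) R) (rep′-realizes (index w∈))

    rep′-all : ∀ Q → P Q → ∃ λ i → Q ≅ rep′ i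
    rep′-all Q p = go (recognize (proj₁ (shaped p)) (proj₂ (shaped p)))
      where
      go : (∃ λ w → Realizes Q w) → ∃ λ i → Q ≅ rep′ i
      go (w , R) with meets (complete {Q} {w} p R)
      ... | inj₁ w∈ = represented w R w∈
      ... | inj₂ w∈ = represented (partner w) (realizes-partner {w = w} R) w∈

  abstract
    -- One quiver is taken for each chosen word. Isomorphic ones have equal or partner words, and a
    -- transversal contains no partners of its members; conversely a quiver with `P` has a word, and
    -- this word or its partner is chosen. Keeping `P` general serves both counts.
    isoCount : Σ ℕ λ N → IsoCount P N × 2 * N ≡ length ws
    isoCount = length reps
             , record { rep = rep′ ; rep-P = λ i → sound (word∈ i) (rep′-realizes i) ; rep-dist = rep′-distinct ; rep-all = rep′-all }
             , halves

proj₂-injective : ∀ {x y : Stack 0} → proj₂ x ≡ proj₂ y → x ≡ y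
proj₂-injective {[] , _} {[] , _} refl = refl

module _ {r : ℕ} {Q : Quiver (2 * r)} where
  realizes-stack : ∀ {w} → Realizes Q w → ([] , w) ∈ stacks 0 r
  realizes-stack {w} R = stacks-complete r ([] , w) (sym (*-cancelˡ-≡ r (total weight w) 2 (realizes-weight R)))

∈-words⁻ : ∀ {w} {xs : List (Stack 0)} → w ∈ map proj₂ xs → ([] , w) ∈ xs
∈-words⁻ w∈ with ∈-map⁻ proj₂ w∈
... | ([] , w) , x∈ , refl = x∈

module _ (r : ℕ) (r≥1 : 1 ≤ r) where
  all-count : Σ ℕ λ N → IsoCount {2 * r} (λ Q → InQ Q × Symmetric Q) N × 2 * N ≡ length (map proj₂ (stacks 0 r))
  all-count = isoCount r≥1 (λ Q → InQ Q × Symmetric Q) (map proj₂ (stacks 0 r))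
    (unique-map⁺ proj₂-injective (stacks-unique 0 r))
    (λ w∈ → stacks-sound r (∈-words⁻ w∈))
    id
    (λ _ R → realizes-inQ R , realizes-symmetric R)
    (λ _ R → ∈-map⁺ proj₂ (realizes-stack {r} R))

  module _ (r₂ : ℕ) where
    private
      P : Quiver (2 * r) → Set
      P Q = InQ Q × Symmetric Q × num3Cycles Q ≡ 2 * r₂

      ∈-with△⁻ : ∀ {x} → x ∈ with△ r₂ (stacks 0 r) → x ∈ stacks 0 r × triangleˢ x ≡ r₂
      ∈-with△⁻ = ∈-filter⁻ (λ x → triangleˢ x ≟ r₂) {xs = stacks 0 r}

      sound : ∀ {Q w} → w ∈ map proj₂ (with△ r₂ (stacks 0 r)) → Realizes Q w → P Q
      sound {Q} {w} w∈ R = realizes-inQ R , realizes-symmetric R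
        , trans (realizes-num3Cycles R) (cong (2 *_) (proj₂ (∈-with△⁻ (∈-words⁻ w∈))))

      complete : ∀ {Q w} → P Q → Realizes Q w → w ∈ map proj₂ (with△ r₂ (stacks 0 r))
      complete {Q} {w} (_ , _ , e) R = ∈-map⁺ proj₂ (∈-filter⁺ (λ x → triangleˢ x ≟ r₂) (realizes-stack {r} R)
        (*-cancelˡ-≡ (total weight△ w) r₂ 2 (trans (sym (realizes-num3Cycles R)) e)))

    refined-count : Σ ℕ λ N → IsoCount {2 * r} (λ Q → InQ Q × Symmetric Q × num3Cycles Q ≡ 2 * r₂) N
      × 2 * N ≡ length (map proj₂ (with△ r₂ (stacks 0 r)))
    refined-count = isoCount r≥1 P (map proj₂ (with△ r₂ (stacks 0 r)))
      (unique-map⁺ proj₂-injective (unique-filter⁺ (λ x → triangleˢ x ≟ r₂) (stacks-unique 0 r)))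
      (λ w∈ → stacks-sound r (proj₁ (∈-with△⁻ (∈-words⁻ w∈))))
      (λ (I , S , _) → I , S) sound complete

theorem3p8 : (r : ℕ) → 1 ≤ r →
    (Σ ℕ λ N → IsoCount {2 * r} (λ Q → InQ Q × Symmetric Q) N × 2 * N ≡ (2 * r) C r)
    × (∀ (r₂ : ℕ) → Σ ℕ λ N →
    IsoCount {2 * r} (λ Q → InQ Q × Symmetric Q × num3Cycles Q ≡ 2 * r₂) N
    × (2 * r₂ ≤ r → 2 * N * (r₂ ! * r₂ ! * (r ∸ 2 * r₂) !) ≡ 2 ^ (r ∸ 2 * r₂) * r !)
    × (2 * r₂ > r → N ≡ 0))
theorem3p8 r r≥1 = all (all-count r r≥1) , λ r₂ → refined r₂ (refined-count r r≥1 r₂)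
  where
  twice : ∀ n → n + n ≡ 2 * n
  twice n = cong (n +_) (sym (+-identityʳ n))

  all : (Σ ℕ λ N → IsoCount {2 * r} (λ Q → InQ Q × Symmetric Q) N × 2 * N ≡ length (map proj₂ (stacks 0 r))) →
    Σ ℕ λ N → IsoCount {2 * r} (λ Q → InQ Q × Symmetric Q) N × 2 * N ≡ (2 * r) C r
  all (N , count , 2N) = N , count , trans 2N (trans (length-map proj₂ (stacks 0 r))
    (trans (#stacks≡C 0 r) (cong₂ _C_ (twice r) (+-identityʳ r))))

  refined : ∀ r₂ → (Σ ℕ λ N → IsoCount {2 * r} (λ Q → InQ Q × Symmetric Q × num3Cycles Q ≡ 2 * r₂) N
      × 2 * N ≡ length (map proj₂ (with△ r₂ (stacks 0 r)))) →
    Σ ℕ λ N → IsoCount {2 * r} (λ Q → InQ Q × Symmetric Q × num3Cycles Q ≡ 2 * r₂) N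
      × (2 * r₂ ≤ r → 2 * N * (r₂ ! * r₂ ! * (r ∸ 2 * r₂) !) ≡ 2 ^ (r ∸ 2 * r₂) * r !)
      × (2 * r₂ > r → N ≡ 0)
  refined r₂ (N , count , 2N) = N , count , formula , vanish
    where
    2N≡ : 2 * N ≡ #△ 0 r r₂
    2N≡ = trans 2N (length-map proj₂ (with△ r₂ (stacks 0 r)))
    formula : 2 * r₂ ≤ r → 2 * N * (r₂ ! * r₂ ! * (r ∸ 2 * r₂) !) ≡ 2 ^ (r ∸ 2 * r₂) * r !
    -- At height 0 the factor `(j + h) !` reads `(r₂ + 0) !`.
    formula le = trans (cong₂ (λ c s → c * (r₂ ! * s ! * (r ∸ 2 * r₂) !)) 2N≡ (sym (+-identityʳ r₂)))
      (#△-multinomial r 0 r₂ (r ∸ 2 * r₂) (sym (trans (cong (r ∸ 2 * r₂ +_) (twice r₂)) (m∸n+n≡m le))))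
    vanish : 2 * r₂ > r → N ≡ 0
    vanish gt = *-cancelˡ-≡ N 0 2 (trans 2N≡ (#△-vanish 0 r r₂ (subst (r <_) (sym (twice r₂)) gt)))
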